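{- Let $g\ge 1$, let $p_1,\dots,p_g$ be distinct odd primes, $n=p_1\cdots p_g$, $q$ a prime power with $\gcd(n,q)=1$, $N'=\mathrm{ord}_n(q)$, and $\theta$ a primitive $n$-th root of unity in $\mathbb{F}_{q^{N'}}$. Consider the QR codes of length $n$ defined in the context. Then: (1) the number of QR codes of length $n$ is $\prod_{r=0}^{g-1}\bigl(2(2^{g-r}-1)\bigr)^{\binom{g}{r}}$; (2) there exists an LCD QR code of length $n$ if and only if $p_i\equiv 1\pmod 4$ for every $i=1,\dots,g$; (3) there exists a self-orthogonal QR code of length $n$ if and only if $p_i\equiv 3\pmod 4$ for every $i=1,\dots,g$.
   Context: For $0\le r\le g-1$, $A_r$ is the set of all products of $r$ distinct primes among $p_1,\dots,p_g$ ($A_0=\{1\}$). For $d\in A_r$: $M_d=\{j:1\le j\le n-1,\gcd(j,n)=d\}$, $M^*_d=\{Q: Q\mid n/d,\ Q>1\}$, and for $Q\in M^*_d$, $\epsilon\in\{\pm1\}$: $M^\epsilon_{d,Q}=\{j\in M_d:(\tfrac{j}{Q})=\epsilon\}$ (Jacobi symbol), $F^\epsilon_{d,Q}(x)=\prod_{t\in M^\epsilon_{d,Q}}(x-\theta^t)$. A QR code of length $n$ is the cyclic code of length $n$ (an ideal of $K[x]/(x^n-1)$ with $K=\mathbb{F}_{q^{N'}}$, or $K=\mathbb{F}_q$ when the generator has coefficients in $\mathbb{F}_q$) generated by $g(x)=\prod_{r=0}^{g-1}\prod_{d\in A_r}F^{\epsilon_d}_{d,Q_d}(x)$, for a choice of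 $Q_d\in M^*_d$ and $\epsilon_d\in\{1,-1\}$ for each $d\in\bigcup_r A_r$. A linear code $\mathcal{C}$ is LCD if $\mathcal{C}\cap\mathcal{C}^\perp=\{0\}$, and (in this paper's terminology) self-orthogonal if $\mathcal{C}\cap\mathcal{C}^\perp=\mathcal{C}^\perp$, i.e. $\mathcal{C}^\perp\subseteq\mathcal{C}$, where $\perp$ is the dual for the standard inner product. -}

module Defs where

open import Level using (0ℓ)
open import Data.Nat as ℕ using (ℕ; zero; suc; _<_; _≤_; _≡ᵇ_; _%_)
open import Data.Nat.GCD using (gcd)
open import Data.Nat.Divisibility using (_∣_)
open import Data.Nat.Primality using (Prime)
open import Data.Nat.Combinatorics using (_C_)
open import Data.Integer as ℤ using (ℤ; +_; -[1+_])
open import Data.Fin using (Fin; toℕ)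
open import Data.List using (List; []; _∷_; foldr; map; upTo; allFin; zip)
open import Data.Bool using (Bool; true; false; if_then_else_)
open import Data.Product using (Σ; _×_; _,_; ∃; proj₁; proj₂)
open import Relation.Nullary using (¬_; Dec; does)
open import Relation.Binary.PropositionalEquality using (_≡_; _≢_)
open import Algebra.Bundles using (CommutativeRing)

-- a mod m, with the (never used) convention a mod 0 = a
_mod_ : ℕ → ℕ → ℕ
a mod zero    = a
a mod (suc k) = a % suc k

prodℕ : List ℕ → ℕ
prodℕ = foldr ℕ._*_ 1

prodℤ : List ℤ → ℤ
prodℤ = foldr ℤ._*_ (+ 1)

IsPrimePower : ℕ → Set
IsPrimePower q = Σ ℕ λ p → Σ ℕ λ k → Prime p × 1 ≤ k × q ≡ p ℕ.^ k

IsMultOrder : (n q N' : ℕ) → Set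
IsMultOrder n q N' =
  1 ≤ N' × (q ℕ.^ N') mod n ≡ 1 mod n
  × (∀ m → 1 ≤ m → m < N' → (q ℕ.^ m) mod n ≢ 1 mod n)

legendre : ℕ → ℕ → ℤ
legendre a p =
  if (a mod p) ≡ᵇ 0 then + 0
  else (if foldr Data.Bool._∨_ false
             (map (λ x → ((x ℕ.* x) mod p) ≡ᵇ (a mod p)) (upTo p))
        then + 1 else -[1+ 0 ])
  where import Data.Bool

-- Jacobi symbol (a / Q) for Q a (squarefree) divisor of n = p₁⋯p_g:
-- the product of the Legendre symbols (a / pᵢ) over the pᵢ dividing Q.
jacobi : ∀ {g} → (Fin g → ℕ) → ℕ → ℕ → ℤ
jacobi {g} p a Q =
  prodℤ (map (λ i → if (Q mod p i) ≡ᵇ 0 then legendre a (p i) else + 1) (allFin g))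

sign : Bool → ℤ
sign true  = + 1
sign false = -[1+ 0 ]

prodPrimes : ∀ {g} → (Fin g → ℕ) → ℕ
prodPrimes {g} p = prodℕ (map p (allFin g))

qrCount : ℕ → ℕ
qrCount g = prodℕ (map (λ r → (2 ℕ.* (2 ℕ.^ (g ℕ.∸ r) ℕ.∸ 1)) ℕ.^ (g C r)) (upTo g))

-- Choices (Q_d, ε_d).  A choice assigns to every d a pair (Q_d, ε_d);
-- only the values at divisors d of n with d < n (i.e. d ∈ ⋃_{r ≤ g-1} A_r,
-- n being squarefree) matter.

Choice : Set
Choice = ℕ → ℕ × Bool

-- validity: Q_d ∈ M*_d, i.e. Q_d ∣ n/d (written Q_d · d ∣ n) and Q_d > 1
ValidChoice : ℕ → Choice → Set
ValidChoice n ch = ∀ d → d ∣ n → d < n →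
  (proj₁ (ch d) ℕ.* d) ∣ n × 1 < proj₁ (ch d)

-- j (1 ≤ j ≤ n-1) is a zero exponent of the generator:
-- j ∈ M^{ε_d}_{d,Q_d} for d = gcd(j,n) (the unique d with j ∈ M_d)
inZeroSet : ∀ {g} → (Fin g → ℕ) → Choice → ℕ → Bool
inZeroSet p ch j =
  let d = gcd j (prodPrimes p) in
  does (jacobi p j (proj₁ (ch d)) ℤ.≟ sign (proj₂ (ch d)))

zeroSet : ∀ {g} → (Fin g → ℕ) → Choice → List ℕ
zeroSet p ch = Data.List.filterᵇ (inZeroSet p ch)
                 (Data.List.drop 1 (upTo (prodPrimes p)))
  where import Data.List

record FiniteField : Set₁ where
  field
    commRing : CommutativeRing 0ℓ 0ℓ
  open CommutativeRing commRing public
  field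
    _≟_      : ∀ x y → Dec (x ≈ y)
    1≉0      : ¬ (1# ≈ 0#)
    inverse  : ∀ x → ¬ (x ≈ 0#) → Σ Carrier λ y → x * y ≈ 1#
    size     : ℕ
    enum     : Fin size → Carrier
    enum-inj : ∀ i j → enum i ≈ enum j → i ≡ j
    enum-sur : ∀ x → Σ (Fin size) λ i → enum i ≈ x

module QR (K : FiniteField) where
  open FiniteField K

  pow : Carrier → ℕ → Carrier
  pow x zero    = 1#
  pow x (suc k) = x * pow x k

  IsPrimitiveRoot : ℕ → Carrier → Set
  IsPrimitiveRoot n θ = pow θ n ≈ 1# × (∀ j → 1 ≤ j → j < n → ¬ (pow θ j ≈ 1#))

  sumK : List Carrier → Carrier
  sumK = foldr _+_ 0#

  -- polynomials as coefficient lists (lowest degree first)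
  Poly : Set
  Poly = List Carrier

  scale : Carrier → Poly → Poly
  scale c = map (c *_)

  addP : Poly → Poly → Poly
  addP [] ys = ys
  addP xs [] = xs
  addP (x ∷ xs) (y ∷ ys) = (x + y) ∷ addP xs ys

  mulP : Poly → Poly → Poly
  mulP []       ys = []
  mulP (x ∷ xs) ys = addP (scale x ys) (0# ∷ mulP xs ys)

  generator : ∀ {g} → (Fin g → ℕ) → Carrier → Choice → Poly
  generator p θ ch = foldr (λ t acc → mulP (- pow θ t ∷ 1# ∷ []) acc) (1# ∷ [])
                       (zeroSet p ch)

  indexed : Poly → List (ℕ × Carrier)
  indexed cs = zip (upTo (Data.List.length cs)) cs
    where import Data.List

  Word : ℕ → Set
  Word n = Fin n → Carrier

  -- coefficient k of a(x) g(x) mod (x^n - 1)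
  cycMul : ∀ {n} → Word n → Poly → Fin n → Carrier
  cycMul {n} a gp k =
    sumK (map (λ i → sumK (map (λ jc →
        if ((toℕ i ℕ.+ proj₁ jc) mod n) ≡ᵇ toℕ k then a i * proj₂ jc else 0#)
        (indexed gp))) (allFin n))

  dot : ∀ {n} → Word n → Word n → Carrier
  dot {n} u v = sumK (map (λ i → u i * v i) (allFin n))

  InFq : ℕ → Carrier → Set
  InFq q x = pow x q ≈ x

  -- coefficient field of the code: F_q if the generator has all its
  -- coefficients in F_q, otherwise K.  (Base x holds iff x lies in that field.)
  Base : ℕ → Poly → Carrier → Set
  Base q gp x = (Data.List.Relation.Unary.All.All (InFq q) gp) → InFq q x
    where import Data.List.Relation.Unary.All

  -- the cyclic code generated by gp: the ideal (gp) in F[x]/(x^n - 1),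
  -- F the coefficient field above
  CyclicCode : (n q : ℕ) → Poly → Word n → Set
  CyclicCode n q gp c =
    Σ (Word n) λ a → (∀ i → Base q gp (a i)) × (∀ k → c k ≈ cycMul a gp k)

  DualCode : (n q : ℕ) → Poly → Word n → Set
  DualCode n q gp v =
    (∀ i → Base q gp (v i)) × (∀ c → CyclicCode n q gp c → dot v c ≈ 0#)

  IsLCD : (n q : ℕ) → Poly → Set
  IsLCD n q gp = ∀ v → CyclicCode n q gp v → DualCode n q gp v → ∀ i → v i ≈ 0#

  IsSelfOrthogonal : (n q : ℕ) → Poly → Set
  IsSelfOrthogonal n q gp = ∀ v → DualCode n q gp v → CyclicCode n q gp v

  SameCode : (n q : ℕ) → Poly → Poly → Set
  SameCode n q g₁ g₂ = ∀ c → (CyclicCode n q g₁ c → CyclicCode n q g₂ c)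
                             × (CyclicCode n q g₂ c → CyclicCode n q g₁ c)

{-# OPTIONS --safe #-}
module Submission where

-- A word w of length n is determined by its spectrum ŵ(j) = w(θʲ), because a polynomial of degree
-- below n cannot have the n distinct roots θʲ.  If T is the set of exponents j with g(θʲ) = 0, then
-- the code consists of the words whose spectrum vanishes on T, and its dual of those whose spectrum
-- vanishes on the j with −j ∉ T.  Hence the code is LCD iff T = −T and C^⊥ ⊆ C iff T ∩ −T = ∅.
-- To stay inside F_q when g does, witnesses are built as cyclic products of g and its reversal:
-- if x^(M+1) = 1 for all x ≠ 0, the spectrum of g^(M+1) is the indicator of the complement of T.
--
-- Since (−j / Q) = (−1 / Q)(j / Q), everything reduces to the signs (−1 / Q_d).  For d = n / pᵢ the
-- only choice is Q_d = pᵢ, which gives the conditions on pᵢ modulo 4; conversely one takes for Q_d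
-- any prime not dividing d.  For the count, T determines every (Q_d, ε_d): changing j modulo a
-- single prime distinguishes any two symbols (· / Q) on the class gcd(j, n) = d.

open import Defs

-- `legendre` is defined by a search for a square root, so how (-a / p) relates to (a / p) has to
-- pass through Euler's criterion. That rests on Fermat and on the bound for the number of roots of
-- x^((p - 1)/2) - 1, while the spectrum over `K` rests on the same bound for degree below n. Root
-- counting and the binomial argument are therefore stated for a commutative ring, with the
-- cancellation law free of subtraction, so that ℕ modulo p is an instance. Which coefficient field
-- a code has is never decided. `Base` is an implication, and each witness comes with a proof that
-- its entries lie in F_q whenever those of g do. This is why no word is obtained by inverting the
-- transform: the formula would involve powers of θ, which need not lie in F_q. Sums and products of
-- g and constants 0, 1 stay in F_q, and for sums this is the additivity of x ↦ x^q. The exponent -j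
-- is written `n ∸ j`, so -0 appears as n; the exponent 0 is never a zero of the generator, and this
-- boundary case is settled separately.

module RingTheory where

  open import Level using (0ℓ)
  open import Algebra.Bundles using (CommutativeRing)

  -- The bound on the number of roots of a polynomial.

  module Polynomials (R : CommutativeRing 0ℓ 0ℓ) where
    open import Data.List using (List; []; _∷_; length; _++_; replicate)
    open import Data.List.Relation.Unary.All using (All; []; _∷_)
    import Data.List.Relation.Unary.All as All
    open import Data.List.Relation.Unary.AllPairs using (AllPairs; []; _∷_)
    open import Data.Nat using (ℕ; zero; suc)
    import Data.Nat.Properties as ℕ
    open import Data.Product using (_×_; _,_)
    open import Relation.Nullary using (¬_)
    open import Relation.Binary.PropositionalEquality as ≡ using (_≡_)
    open CommutativeRing R hiding (zero)
    open import Algebra.Properties.Ring ring using (+-cancelˡ)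
    open import Algebra.Properties.Semiring.Exp semiring using (_^_)
    open import Algebra.Solver.Ring.NaturalCoefficients.Default commutativeSemiring
      using (solve; _:+_; _:*_; _:=_)
    open import Relation.Binary.Reasoning.Setoid setoid

    eval : Carrier → List Carrier → Carrier
    eval x []       = 0#
    eval x (c ∷ cs) = c + x * eval x cs

    eval-cong : ∀ {x y} → x ≈ y → ∀ cs → eval x cs ≈ eval y cs
    eval-cong x≈y []       = refl
    eval-cong x≈y (c ∷ cs) = +-congˡ (*-cong x≈y (eval-cong x≈y cs))

    -- The coefficients of (x f(x) − r f(r)) / (x − r) for f with coefficients cs.
    slope : Carrier → List Carrier → List Carrier
    slope r []       = []
    slope r (c ∷ cs) = eval r (c ∷ cs) ∷ slope r cs

    length-slope : ∀ r cs → length (slope r cs) ≡ length cs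
    length-slope r []       = ≡.refl
    length-slope r (c ∷ cs) = ≡.cong suc (length-slope r cs)

    -- This is (x - r) S(x) = x f(x) - r f(r), S being the slope, with every term moved to the
    -- positive side, so that a solver for commutative semirings handles the induction step.
    eval-slope : ∀ x r cs →
      x * eval x cs + r * eval x (slope r cs) ≈ r * eval r cs + x * eval x (slope r cs)
    eval-slope x r [] = +-comm _ _ ⟨ trans ⟩ +-cong zero-eq (sym zero-eq)
      where
      open import Function.Base using (_⟨_⟩_)
      zero-eq : ∀ {y z} → y * 0# ≈ z * 0#
      zero-eq = trans (zeroʳ _) (sym (zeroʳ _))
    eval-slope x r (c ∷ cs) = begin
      x * (c + x * E) + r * (c + r * F + x * S)
        ≈⟨ solve 6 (λ x r c E F S →
             x :* (c :+ x :* E) :+ r :* (c :+ r :* F :+ x :* S) :=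
             x :* (x :* E :+ r :* S) :+ (x :* c :+ r :* (c :+ r :* F))) refl x r c E F S ⟩
      x * (x * E + r * S) + (x * c + r * (c + r * F))
        ≈⟨ +-congʳ (*-congˡ (eval-slope x r cs)) ⟩
      x * (r * F + x * S) + (x * c + r * (c + r * F))
        ≈⟨ solve 6 (λ x r c E F S →
             x :* (r :* F :+ x :* S) :+ (x :* c :+ r :* (c :+ r :* F)) :=
             r :* (c :+ r :* F) :+ x :* (c :+ r :* F :+ x :* S)) refl x r c E F S ⟩
      r * (c + r * F) + x * (c + r * F + x * S) ∎
      where
      E = eval x cs
      F = eval r cs
      S = eval x (slope r cs)

    eval-zero : ∀ x {cs} → All (_≈ 0#) cs → eval x cs ≈ 0#
    eval-zero x []         = refl
    eval-zero x (c≈0 ∷ cs) =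
      trans (+-cong c≈0 (trans (*-congˡ (eval-zero x cs)) (zeroʳ x))) (+-identityˡ 0#)

    head-zero : ∀ r c {cs} → All (_≈ 0#) cs → c + r * eval r cs ≈ 0# → c ≈ 0#
    head-zero r c {cs} cs≈0 root = begin
      c                 ≈⟨ +-identityʳ c ⟨
      c + 0#            ≈⟨ +-congˡ (trans (*-congˡ (eval-zero r cs≈0)) (zeroʳ r)) ⟨
      c + r * eval r cs ≈⟨ root ⟩
      0#                ∎

    -- The entries of `slope r cs` are the values at `r` of the suffixes of `cs`. The last suffix is
    -- the leading coefficient alone, and each earlier coefficient vanishes once those after it do.
    slope-zero : ∀ r cs → All (_≈ 0#) (slope r cs) → All (_≈ 0#) cs
    slope-zero r []       _            = []
    slope-zero r (c ∷ cs) (h ∷ ss) = head-zero r c zs h ∷ zs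
      where zs = slope-zero r cs ss

    eval-monomial : ∀ x k → eval x (replicate k 0# ++ 1# ∷ []) ≈ x ^ k
    eval-monomial x zero    = trans (+-congˡ (zeroʳ x)) (+-identityʳ 1#)
    eval-monomial x (suc k) = trans (+-identityˡ _) (*-congˡ (eval-monomial x k))

    -- Absence of zero divisors, phrased without subtraction: the same bound then serves the
    -- residues modulo a prime, carried by ℕ, and the field `K`.
    module RootBound (cancel : ∀ {x y z} → ¬ (x ≈ y) → x * z ≈ y * z → z ≈ 0#) where

      -- A list of k coefficients has degree below k, hence the equal lengths. If r and s are roots
      -- of c + x f, then r f(r) = s f(s), so `eval-slope` gives (s - r) S(s) = 0: the slope, one
      -- coefficient shorter, has all the other roots.
      too-many-roots : ∀ cs rs → length rs ≡ length cs → AllPairs (λ x y → ¬ (x ≈ y)) rs →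
                       All (λ r → eval r cs ≈ 0#) rs → All (_≈ 0#) cs
      too-many-roots []       rs       _   _             _              = []
      too-many-roots (c ∷ cs) (r ∷ rs) len (r≉rs ∷ dist) (root ∷ roots) =
        head-zero r c cs≈0 root ∷ cs≈0
        where
        slope-root : ∀ {s} → (¬ (r ≈ s)) × eval s (c ∷ cs) ≈ 0# → eval s (slope r cs) ≈ 0#
        slope-root {s} (r≉s , s-root) = cancel r≉s (+-cancelˡ _ _ _ (begin
          s * eval s cs + r * eval s (slope r cs)  ≈⟨ eval-slope s r cs ⟩
          r * eval r cs + s * eval s (slope r cs)
            ≈⟨ +-congʳ (+-cancelˡ c _ _ (trans root (sym s-root))) ⟩
          s * eval s cs + s * eval s (slope r cs)  ∎))
        cs≈0 : All (_≈ 0#) cs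
        cs≈0 = slope-zero r cs (too-many-roots (slope r cs) rs
          (≡.trans (ℕ.suc-injective len) (≡.sym (length-slope r cs))) dist
          (All.zipWith slope-root (r≉rs , roots)))

  -- Additivity of the p-th power in characteristic p.

  module Frobenius (R : CommutativeRing 0ℓ 0ℓ) where
    open import Data.Nat as ℕ using (ℕ; zero; suc; _<_; _∸_; z≤n; s≤s; _!)
    import Data.Nat.Properties as ℕ
    open import Data.Nat.Divisibility using (_∣_; divides; m∣m*n; >⇒∤)
    open import Data.Nat.DivMod using (m/n*n≡m)
    open import Data.Nat.Primality using (Prime; euclidsLemma; prime⇒nonTrivial)
    open import Data.Nat.Combinatorics using (_C_; nCn≡1; nCk≡n!/k![n-k]!; k![n∸k]!∣n!)
    open import Data.Fin using (Fin; zero; suc; toℕ; fromℕ; inject₁)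
    open import Data.Fin.Properties using (toℕ<n; toℕ-fromℕ; toℕ-inject₁)
    open import Data.Sum using (inj₁; inj₂)
    open import Relation.Nullary using (¬_; contradiction)
    open import Relation.Binary.PropositionalEquality as ≡ using (_≡_)
    open CommutativeRing R hiding (zero)
    open import Algebra.Properties.Semiring.Exp semiring using (_^_; ^-assocʳ; ^-congˡ)
    open import Algebra.Properties.Semiring.Mult semiring using (_×_; ×-assocˡ; ×-congʳ; ×-assoc-*; ×-congˡ)
    open import Algebra.Properties.Semiring.Sum semiring
      using (sum; sum-cong-≋; sum-init-last; sum-replicate-zero)
    open import Algebra.Properties.CommutativeSemiring.Binomial commutativeSemiring
      using (binomialTerm) renaming (theorem to binomial-theorem)
    open import Relation.Binary.Reasoning.Setoid setoid

    prime∤! : ∀ {p} → Prime p → ∀ k → k < p → ¬ (p ∣ k !)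
    prime∤! {p} pp zero    k<p p∣ = >⇒∤ (ℕ.nonTrivial⇒n>1 p {{prime⇒nonTrivial pp}}) p∣
    prime∤! {p} pp (suc k) k<p p∣ with euclidsLemma (suc k) (k !) pp p∣
    ... | inj₁ p∣sk = >⇒∤ k<p p∣sk
    ... | inj₂ p∣k! = prime∤! pp k (ℕ.<-trans (ℕ.n<1+n k) k<p) p∣k!

    -- The product C(p, k) k! (p - k)! is p!, which p divides, whereas p divides neither factorial,
    -- both being products of positive numbers below p.
    prime∣C : ∀ {p} → Prime p → ∀ k → 0 < k → k < p → p ∣ (p C k)
    prime∣C {p} pp k 0<k k<p with euclidsLemma (p C k) (k ! ℕ.* (p ∸ k) !) pp p∣product
      where
      instance _ = k ℕ.!* (p ∸ k) !≢0
      product≡p! : (p C k) ℕ.* (k ! ℕ.* (p ∸ k) !) ≡ p !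
      product≡p! = ≡.trans (≡.cong (ℕ._* (k ! ℕ.* (p ∸ k) !)) (nCk≡n!/k![n-k]! (ℕ.<⇒≤ k<p)))
                           (m/n*n≡m (k![n∸k]!∣n! (ℕ.<⇒≤ k<p)))
      p∣p! : ∀ {p} → 0 < p → p ∣ p !
      p∣p! {suc p} _ = m∣m*n (p !)
      p∣product : p ∣ (p C k) ℕ.* (k ! ℕ.* (p ∸ k) !)
      p∣product = ≡.subst (p ∣_) (≡.sym product≡p!) (p∣p! (ℕ.<-trans 0<k k<p))
    ... | inj₁ p∣C = p∣C
    ... | inj₂ p∣k!l! with euclidsLemma (k !) ((p ∸ k) !) pp p∣k!l!
    ...   | inj₁ p∣k! = contradiction p∣k! (prime∤! pp k k<p)
    ...   | inj₂ p∣l! = contradiction p∣l!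
            (prime∤! pp (p ∸ k) (ℕ.∸-monoʳ-< 0<k (ℕ.<⇒≤ k<p)))

    module _ {p : ℕ} (prime : Prime p) (char : p × 1# ≈ 0#) where

      private
        p×x≈0 : ∀ x → p × x ≈ 0#
        p×x≈0 x = begin
          p × x         ≈⟨ ×-congʳ p (*-identityˡ x) ⟨
          p × (1# * x)  ≈⟨ ×-assoc-* p 1# x ⟨
          (p × 1#) * x  ≈⟨ *-congʳ char ⟩
          0# * x        ≈⟨ zeroˡ x ⟩
          0#            ∎

        multiple×x≈0 : ∀ {m} x → p ∣ m → m × x ≈ 0#
        multiple×x≈0 {m} x (divides k ≡.refl) = begin
          (k ℕ.* p) × x  ≈⟨ ×-congˡ {x} (ℕ.*-comm k p) ⟩
          (p ℕ.* k) × x  ≈⟨ ×-assocˡ x p k ⟨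
          p × (k × x)    ≈⟨ p×x≈0 (k × x) ⟩
          0#             ∎

        -- Writing p as m + 2 lets the p + 1 binomial terms split into the two outer ones and m + 1
        -- inner ones, whose coefficients are multiples of p.
        expansion : ∀ m → suc (suc m) ≡ p → ∀ x y → (x + y) ^ p ≈ x ^ p + y ^ p
        expansion m ≡.refl x y = begin
          (x + y) ^ p                                ≈⟨ binomial-theorem p x y ⟩
          t zero + sum (λ k → t (suc k))             ≈⟨ +-congˡ (sum-init-last (λ k → t (suc k))) ⟩
          t zero + (sum (λ k → t (suc (inject₁ k))) + t (suc (fromℕ (suc m))))
            ≈⟨ +-cong first (+-cong middle final) ⟩
          y ^ p + (0# + x ^ p)                       ≈⟨ +-congˡ (+-identityˡ _) ⟩
          y ^ p + x ^ p                              ≈⟨ +-comm _ _ ⟩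
          x ^ p + y ^ p                              ∎
          where
          t = binomialTerm x y p
          first : t zero ≈ y ^ p
          first = trans (+-identityʳ _) (*-identityˡ _)
          middle : sum (λ k → t (suc (inject₁ k))) ≈ 0#
          middle = trans (sum-cong-≋ {suc m} {λ k → t (suc (inject₁ k))} {λ _ → 0#}
            (λ k → multiple×x≈0 _ (prime∣C prime (suc (toℕ (inject₁ k))) (s≤s z≤n)
              (s≤s (≡.subst (_< suc m) (≡.sym (toℕ-inject₁ k)) (toℕ<n k))))))
            (sum-replicate-zero (suc m))
          final : t (suc (fromℕ (suc m))) ≈ x ^ p
          final rewrite toℕ-fromℕ m | nCn≡1 p | ℕ.n∸n≡0 m =
            trans (+-identityʳ _) (*-identityʳ _)

      freshman : ∀ x y → (x + y) ^ p ≈ x ^ p + y ^ p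
      freshman = expansion (p ∸ 2) (ℕ.m+[n∸m]≡n (ℕ.nonTrivial⇒n>1 p {{prime⇒nonTrivial prime}}))

      freshman-iterated : ∀ k x y → (x + y) ^ (p ℕ.^ k) ≈ x ^ (p ℕ.^ k) + y ^ (p ℕ.^ k)
      freshman-iterated zero    x y =
        trans (*-identityʳ _) (+-cong (sym (*-identityʳ _)) (sym (*-identityʳ _)))
      freshman-iterated (suc k) x y = begin
        (x + y) ^ (p ℕ.* p ℕ.^ k)               ≈⟨ ^-assocʳ (x + y) p (p ℕ.^ k) ⟨
        ((x + y) ^ p) ^ (p ℕ.^ k)               ≈⟨ ^-congˡ (p ℕ.^ k) (freshman x y) ⟩
        (x ^ p + y ^ p) ^ (p ℕ.^ k)             ≈⟨ freshman-iterated k (x ^ p) (y ^ p) ⟩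
        (x ^ p) ^ (p ℕ.^ k) + (y ^ p) ^ (p ℕ.^ k)
          ≈⟨ +-cong (^-assocʳ x p (p ℕ.^ k)) (^-assocʳ y p (p ℕ.^ k)) ⟩
        x ^ (p ℕ.* p ℕ.^ k) + y ^ (p ℕ.* p ℕ.^ k) ∎

-- Residues modulo an odd prime and Euler's criterion.

module LegendreSymbol where

  open import Level using (0ℓ)
  open import Algebra.Bundles using (CommutativeRing)
  open RingTheory
  open import Data.Nat as ℕ using (ℕ; zero; suc; _<_; _≤_; z≤n; s≤s; _%_; _/_; _+_; _*_)
  import Data.Nat.Properties as ℕ
  open import Data.Nat.DivMod using (%-distribˡ-+; %-distribˡ-*; m<n⇒m%n≡m; m≡m%n+[m/n]*n; m%n%n≡m%n; m%n<n)
  open import Data.Nat.Divisibility using (_∣_; >⇒∤; m%n≡0⇒n∣m; n∣m⇒m%n≡0; ∣-refl; m∣m*n; ∣m+n∣m⇒∣n)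
  open import Data.Nat.Primality using (Prime; euclidsLemma; prime⇒nonTrivial)
  open import Data.Nat.Solver using (module +-*-Solver)
  open import Data.Integer as ℤ using (ℤ; +_; -[1+_])
  open import Data.Bool as Bool using (Bool; true; false; T)
  open import Data.Fin as Fin using (Fin; toℕ)
  open import Data.Fin.Properties using (¬∀⟶∃¬; toℕ-fromℕ<; toℕ<n)
  open import Data.List using (List; []; _∷_; length; _++_; replicate; applyUpTo; upTo; map; foldr)
  open import Data.List.Properties using (length-++; length-replicate; length-applyUpTo)
  open import Data.List.Membership.Propositional using (_∈_)
  open import Data.List.Membership.Propositional.Properties using (∈-upTo⁺)
  open import Data.List.Relation.Unary.Any using (here; there)
  open import Data.List.Relation.Unary.All as All using (All; []; _∷_)
  import Data.List.Relation.Unary.All.Properties as All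
  open import Data.List.Relation.Unary.AllPairs using (AllPairs; []; _∷_)
  import Data.List.Relation.Unary.AllPairs.Properties as AllPairs
  open import Data.Product using (_×_; _,_; ∃)
  open import Data.Sum using (_⊎_; inj₁; inj₂)
  open import Function.Base using (_∘_)
  open import Relation.Nullary using (¬_; Dec; yes; no; contradiction)
  open import Relation.Nullary.Decidable using (map′)
  open import Relation.Binary.PropositionalEquality as ≡ using (_≡_; _≢_)

  module Residues (m : ℕ) where

    private p = suc m

    infix 4 _≈ₚ_
    -- A record instead of a bare equation of remainders: `x` and `y` can then be recovered by
    -- unification, which is impossible from `x % p`.
    record _≈ₚ_ (x y : ℕ) : Set where
      constructor residue
      field remainder : x % p ≡ y % p
    open _≈ₚ_ public

    reflexiveₚ : ∀ {x y} → x ≡ y → x ≈ₚ y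
    reflexiveₚ eq = residue (≡.cong (_% p) eq)

    -- Negation is multiplication by p − 1, so no quotient type is needed.
    ℤ/p : CommutativeRing 0ℓ 0ℓ
    ℤ/p = record
      { Carrier = ℕ ; _≈_ = _≈ₚ_ ; _+_ = _+_ ; _*_ = _*_ ; -_ = m *_ ; 0# = 0 ; 1# = 1
      ; isCommutativeRing = record
        { isRing = record
          { +-isAbelianGroup = record
            { isGroup = record
              { isMonoid = record
                { isSemigroup = record
                  { isMagma = record
                    { isEquivalence = record
                      { refl = residue ≡.refl
                      ; sym = λ e → residue (≡.sym (remainder e))
                      ; trans = λ e f → residue (≡.trans (remainder e) (remainder f)) }
                    ; ∙-cong = +-congₚ }
                  ; assoc = λ x y z → reflexiveₚ (ℕ.+-assoc x y z) }
                ; identity = (λ x → residue ≡.refl) , λ x → reflexiveₚ (ℕ.+-identityʳ x) }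
              ; inverse = (λ x → trans′ (reflexiveₚ (ℕ.+-comm (m * x) x)) (inverseₚ x)) , inverseₚ
              ; ⁻¹-cong = λ e → *-congₚ {m} {m} (residue ≡.refl) e }
            ; comm = λ x y → reflexiveₚ (ℕ.+-comm x y) }
          ; *-cong = *-congₚ
          ; *-assoc = λ x y z → reflexiveₚ (ℕ.*-assoc x y z)
          ; *-identity = (λ x → reflexiveₚ (ℕ.*-identityˡ x)) , λ x → reflexiveₚ (ℕ.*-identityʳ x)
          ; distrib = (λ x y z → reflexiveₚ (ℕ.*-distribˡ-+ x y z))
                    , λ x y z → reflexiveₚ (ℕ.*-distribʳ-+ x y z) }
        ; *-comm = λ x y → reflexiveₚ (ℕ.*-comm x y) } }
      where
      trans′ : ∀ {x y z} → x ≈ₚ y → y ≈ₚ z → x ≈ₚ z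
      trans′ e f = residue (≡.trans (remainder e) (remainder f))
      +-congₚ : ∀ {x y u v} → x ≈ₚ y → u ≈ₚ v → x + u ≈ₚ y + v
      +-congₚ {x} {y} {u} {v} e f = residue (≡.trans (%-distribˡ-+ x u p)
        (≡.trans (≡.cong₂ (λ a b → (a + b) % p) (remainder e) (remainder f))
                 (≡.sym (%-distribˡ-+ y v p))))
      *-congₚ : ∀ {x y u v} → x ≈ₚ y → u ≈ₚ v → x * u ≈ₚ y * v
      *-congₚ {x} {y} {u} {v} e f = residue (≡.trans (%-distribˡ-* x u p)
        (≡.trans (≡.cong₂ (λ a b → (a * b) % p) (remainder e) (remainder f))
                 (≡.sym (%-distribˡ-* y v p))))
      inverseₚ : ∀ x → x + m * x ≈ₚ 0
      inverseₚ x = residue (n∣m⇒m%n≡0 (p * x) p (m∣m*n x))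

    ∣⇒≈0 : ∀ {x} → p ∣ x → x ≈ₚ 0
    ∣⇒≈0 {x} p∣x = residue (n∣m⇒m%n≡0 x p p∣x)

    ≈0⇒∣ : ∀ {x} → x ≈ₚ 0 → p ∣ x
    ≈0⇒∣ {x} x≈0 = m%n≡0⇒n∣m x p (remainder x≈0)

    infix 4 _≟ₚ_
    _≟ₚ_ : ∀ x y → Dec (x ≈ₚ y)
    x ≟ₚ y = map′ residue remainder (x % p ℕ.≟ y % p)

  -- With p presented as 2h + 1, Euler's exponent (p - 1)/2 is the variable `h`, and p - 1, which
  -- also represents -1, is `m`.
  module OddPrime (h : ℕ) (prime : Prime (suc (h + h))) where

    private
      m = h + h
      p = suc m
    open Residues m
    open CommutativeRing ℤ/p
      using (ring; semiring; commutativeSemiring; setoid; refl; sym; trans; +-cong; +-congˡ; +-congʳ; *-cong; *-congˡ; *-congʳ)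
    open import Algebra.Properties.Ring ring using (+-cancelˡ; +-cancelʳ)
    open import Algebra.Properties.Semiring.Exp semiring using (_^_; ^-homo-*; ^-congˡ)
    open import Algebra.Properties.Semiring.Mult semiring using () renaming (_×_ to _•_)
    open import Algebra.Properties.CommutativeSemiring.Exp commutativeSemiring using (^-distrib-*)
    open Polynomials ℤ/p
    open Frobenius ℤ/p using (freshman)
    open import Relation.Binary.Reasoning.Setoid setoid

    2≤p : 2 ≤ p
    2≤p = ℕ.nonTrivial⇒n>1 p {{prime⇒nonTrivial prime}}

    1≤h : 1 ≤ h
    1≤h = positive h 2≤p
      where
      positive : ∀ h → 2 ≤ suc (h + h) → 1 ≤ h
      positive zero (s≤s ())
      positive (suc h) _ = s≤s z≤n

    h<m : h < m
    h<m = ≡.subst (_≤ m) (ℕ.+-comm h 1) (ℕ.+-monoʳ-≤ h 1≤h)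

    small≉0 : ∀ {x} → 0 < x → x < p → ¬ (x ≈ₚ 0)
    small≉0 0<x x<p x≈0 = >⇒∤ {{ℕ.>-nonZero 0<x}} x<p (≈0⇒∣ x≈0)

    1≉0 : ¬ (1 ≈ₚ 0)
    1≉0 = small≉0 (s≤s z≤n) 2≤p

    2≉0 : ¬ (2 ≈ₚ 0)
    2≉0 = small≉0 (s≤s z≤n) (s≤s (ℕ.+-mono-≤ 1≤h 1≤h))

    no-zero-divisors : ∀ {x y} → x * y ≈ₚ 0 → x ≈ₚ 0 ⊎ y ≈ₚ 0
    no-zero-divisors {x} {y} xy≈0 with euclidsLemma x y prime (≈0⇒∣ xy≈0)
    ... | inj₁ p∣x = inj₁ (∣⇒≈0 p∣x)
    ... | inj₂ p∣y = inj₂ (∣⇒≈0 p∣y)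

    private
      -- Over ℕ the difference exists on one side only: with y = x + d the equation reads d z = 0,
      -- and d is not 0 modulo p.
      cancel-≤ : ∀ {x y z} → x ≤ y → ¬ (x ≈ₚ y) → x * z ≈ₚ y * z → z ≈ₚ 0
      cancel-≤ {x} {y} {z} x≤y x≉y xz≈yz with y ℕ.∸ x | ℕ.m+[n∸m]≡n x≤y
      ... | d | ≡.refl with no-zero-divisors {d} {z} (+-cancelˡ (x * z) _ _ (begin
          x * z + d * z  ≈⟨ reflexiveₚ (ℕ.*-distribʳ-+ z x d) ⟨
          (x + d) * z    ≈⟨ xz≈yz ⟨
          x * z          ≈⟨ reflexiveₚ (ℕ.+-identityʳ (x * z)) ⟨
          x * z + 0      ∎))
      ...   | inj₂ z≈0 = z≈0
      ...   | inj₁ d≈0 = contradiction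
                (trans (reflexiveₚ (≡.sym (ℕ.+-identityʳ x))) (+-congˡ (sym d≈0))) x≉y

    cancel : ∀ {x y z} → ¬ (x ≈ₚ y) → x * z ≈ₚ y * z → z ≈ₚ 0
    cancel {x} {y} x≉y eq with ℕ.≤-total x y
    ... | inj₁ x≤y = cancel-≤ x≤y x≉y eq
    ... | inj₂ y≤x = cancel-≤ y≤x (x≉y ∘ sym) (sym eq)

    open RootBound cancel

    1^k : ∀ k → 1 ^ k ≈ₚ 1
    1^k zero    = refl
    1^k (suc k) = trans (reflexiveₚ (ℕ.*-identityˡ _)) (1^k k)

    -- Induction on a, with (1 + a)^p = 1 + a^p in characteristic p.
    fermat : ∀ a → a ^ p ≈ₚ a
    fermat zero    = refl
    fermat (suc a) = trans (freshman prime p•1≈0 1 a) (+-cong (1^k p) (fermat a))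
      where
      k•1 : ∀ k → k • 1 ≡ k
      k•1 zero    = ≡.refl
      k•1 (suc k) = ≡.cong suc (k•1 k)
      p•1≈0 : p • 1 ≈ₚ 0
      p•1≈0 = trans (reflexiveₚ (k•1 p)) (∣⇒≈0 ∣-refl)

    fermat-unit : ∀ {a} → ¬ (a ≈ₚ 0) → a ^ m ≈ₚ 1
    fermat-unit {a} a≉0 with a ^ m ≟ₚ 1
    ... | yes eq = eq
    ... | no neq = contradiction (cancel neq (begin
          a ^ m * a  ≈⟨ reflexiveₚ (ℕ.*-comm (a ^ m) a) ⟩
          a ^ p      ≈⟨ fermat a ⟩
          a          ≈⟨ reflexiveₚ (ℕ.*-identityˡ a) ⟨
          1 * a      ∎)) a≉0

    solve-linear : ∀ {u} → ¬ (u ≈ₚ 0) → ∀ d b → ∃ λ s → d + s * u ≈ₚ b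
    solve-linear {u} u≉0 d b = c * v , (begin
      d + c * v * u    ≈⟨ +-congˡ {d} (reflexiveₚ (ℕ.*-assoc c v u)) ⟩
      d + c * (v * u)  ≈⟨ +-congˡ {d} (*-congˡ {c} vu≈1) ⟩
      d + c * 1        ≈⟨ reflexiveₚ (rearrange m) ⟩
      d + m * d + b    ≈⟨ +-congʳ (CommutativeRing.-‿inverseʳ ℤ/p d) ⟩
      b                ∎)
      where
      -- This is b - d, since multiplication by `m` is negation; `v`, the power p - 2 of `u`, is the
      -- inverse of `u` by Fermat.
      c = b + m * d
      v = u ^ ℕ.pred m
      vu≈1 : v * u ≈ₚ 1
      vu≈1 = trans (reflexiveₚ (ℕ.*-comm v u)) (≡.subst (λ k → u ^ k ≈ₚ 1)
        (≡.sym (ℕ.suc-pred m {{ℕ.>-nonZero (ℕ.≤-trans (s≤s z≤n) h<m)}})) (fermat-unit u≉0))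
      rearrange : ∀ m → d + (b + m * d) * 1 ≡ d + m * d + b
      rearrange = solve 3 (λ d b m → d :+ (b :+ m :* d) :* con 1 := d :+ m :* d :+ b) ≡.refl d b
        where open +-*-Solver

    -- By Fermat b = a^h squares to 1, so b (b + 1) = 1 · (b + 1), and cancelling leaves b = 1 or b
    -- = -1.
    half-power : ∀ {a} → ¬ (a ≈ₚ 0) → a ^ h ≈ₚ 1 ⊎ a ^ h + 1 ≈ₚ 0
    half-power {a} a≉0 with a ^ h ≟ₚ 1
    ... | yes eq = inj₁ eq
    ... | no neq = inj₂ (cancel neq (begin
          b * (b + 1)    ≈⟨ reflexiveₚ (ℕ.*-distribˡ-+ b b 1) ⟩
          b * b + b * 1  ≈⟨ +-cong (trans (sym (^-homo-* a h h)) (fermat-unit a≉0)) (reflexiveₚ (ℕ.*-identityʳ b)) ⟩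
          1 + b          ≈⟨ reflexiveₚ (ℕ.+-comm 1 b) ⟩
          b + 1          ≈⟨ reflexiveₚ (ℕ.*-identityˡ (b + 1)) ⟨
          1 * (b + 1)    ∎))
      where b = a ^ h

    few-roots-of-unity : ∀ rs → length rs ≡ suc h → AllPairs (λ x y → ¬ (x ≈ₚ y)) rs →
                         ¬ All (λ r → r ^ h ≈ₚ 1) rs
    few-roots-of-unity rs len distinct roots =
      1≉0 (leading (too-many-roots cs rs (≡.trans len (≡.sym len-cs)) distinct (All.map root roots)))
      where
      k = ℕ.pred h
      1+k≡h : suc k ≡ h
      1+k≡h = ℕ.suc-pred h {{ℕ.>-nonZero 1≤h}}
      -- The coefficients of x^h - 1: the constant term `m * 1` is -1, followed by h - 1 zeros and
      -- the leading 1.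
      cs = m * 1 ∷ replicate k 0 ++ 1 ∷ []
      len-cs : length cs ≡ suc h
      len-cs = ≡.cong suc (≡.trans (length-++ (replicate k 0))
        (≡.trans (≡.cong (_+ 1) (length-replicate k)) (≡.trans (ℕ.+-comm k 1) 1+k≡h)))
      root : ∀ {r} → r ^ h ≈ₚ 1 → eval r cs ≈ₚ 0
      root {r} eq = trans (+-congˡ {m * 1} (trans (*-congˡ {r} (eval-monomial r k))
        (≡.subst (λ h → r ^ h ≈ₚ 1) (≡.sym 1+k≡h) eq)))
        (CommutativeRing.-‿inverseˡ ℤ/p 1)
      leading : All (_≈ₚ 0) cs → 1 ≈ₚ 0
      leading (_ ∷ zs) = All.head (All.++⁻ʳ (replicate k 0) zs)

    -- Since h < p - 1, the h + 1 numbers 1, ..., h + 1 are distinct units modulo p. Not all of them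
    -- are roots of x^h - 1, and for one that is not, `half-power` leaves only -1.
    nonresidue : ∃ λ b → ¬ (b ≈ₚ 0) × b ^ h + 1 ≈ₚ 0
    nonresidue with ¬∀⟶∃¬ (suc h) (λ i → suc (toℕ i) ^ h ≈ₚ 1) (λ i → suc (toℕ i) ^ h ≟ₚ 1) ¬all
      where
      distinct : ∀ {i j} → i < j → j < suc h → ¬ (suc i ≈ₚ suc j)
      distinct {i} {j} i<j j<sh eq = ℕ.<⇒≢ (s≤s i<j) (≡.trans (≡.sym (m<n⇒m%n≡m (ℕ.<-trans (s≤s i<j) j<m)))
        (≡.trans (remainder eq) (m<n⇒m%n≡m j<m)))
        where j<m = s≤s (ℕ.≤-trans j<sh h<m)
      ¬all : ¬ (∀ i → suc (toℕ i) ^ h ≈ₚ 1)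
      ¬all all = few-roots-of-unity (applyUpTo suc (suc h)) (length-applyUpTo suc (suc h))
        (AllPairs.applyUpTo⁺₁ suc (suc h) distinct)
        (All.applyUpTo⁺₁ suc (suc h) (λ {i} i<sh →
          ≡.subst (λ k → suc k ^ h ≈ₚ 1) (toℕ-fromℕ< i<sh) (all (Fin.fromℕ< i<sh))))
    ... | i , i^h≉1 = suc (toℕ i) , i≉0 , minus-one (half-power i≉0)
      where
      i≉0 : ¬ (suc (toℕ i) ≈ₚ 0)
      i≉0 = small≉0 (s≤s z≤n) (s≤s (ℕ.≤-trans (toℕ<n i) h<m))
      minus-one : _ ⊎ _ → _
      minus-one (inj₁ eq) = contradiction eq i^h≉1
      minus-one (inj₂ eq) = eq

    square⇒power≈1 : ∀ {a} x → ¬ (a ≈ₚ 0) → x * x ≈ₚ a → a ^ h ≈ₚ 1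
    square⇒power≈1 {a} x a≉0 xx≈a = begin
      a ^ h          ≈⟨ ^-congˡ h xx≈a ⟨
      (x * x) ^ h    ≈⟨ ^-distrib-* x x h ⟩
      x ^ h * x ^ h  ≈⟨ ^-homo-* x h h ⟨
      x ^ m          ≈⟨ fermat-unit (λ x≈0 → a≉0 (trans (sym xx≈a) (*-congʳ x≈0))) ⟩
      1              ∎

    -- The squares of 1, ..., h are h distinct roots of x^h - 1, so a nonsquare root would be one
    -- root too many.
    nonsquare⇒power≉1 : ∀ {a} → (∀ x → ¬ (x * x ≈ₚ a)) → ¬ (a ^ h ≈ₚ 1)
    nonsquare⇒power≉1 {a} nonsquare a^h≈1 = few-roots-of-unity (a ∷ applyUpTo square h)
      (≡.cong suc (length-applyUpTo square h))
      (All.applyUpTo⁺₂ square h (λ i a≈ii → nonsquare (suc i) (sym a≈ii)) ∷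
       AllPairs.applyUpTo⁺₁ square h distinct)
      (a^h≈1 ∷ All.applyUpTo⁺₁ square h (λ {i} i<h →
        square⇒power≈1 (suc i) (square≉0 i<h) refl))
      where
      square : ℕ → ℕ
      square i = suc i * suc i
      unit : ∀ {i} → i < h → ¬ (suc i ≈ₚ 0)
      unit i<h = small≉0 (s≤s z≤n) (s≤s (ℕ.≤-trans i<h (ℕ.<⇒≤ h<m)))
      square≉0 : ∀ {i} → i < h → ¬ (square i ≈ₚ 0)
      square≉0 {i} i<h eq with no-zero-divisors {suc i} {suc i} eq
      ... | inj₁ z = unit i<h z
      ... | inj₂ z = unit i<h z
      -- The difference of the squares is (j - i)(i + j + 2), and both factors lie strictly between
      -- 0 and p = 2h + 1.
      distinct : ∀ {i j} → i < j → j < h → ¬ (square i ≈ₚ square j)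
      distinct {i} {j} i<j j<h eq with j ℕ.∸ suc i | ℕ.m+[n∸m]≡n i<j
      ... | d | ≡.refl with no-zero-divisors {suc d} {suc i + suc j} (+-cancelˡ (square i) _ _ (begin
          square i + suc d * (suc i + suc j)
            ≈⟨ reflexiveₚ (solve 2 (λ i d → (con 1 :+ i) :* (con 1 :+ i) :+ (con 1 :+ d) :* ((con 1 :+ i) :+ (con 1 :+ (con 1 :+ (i :+ d))))
                 := (con 1 :+ (con 1 :+ (i :+ d))) :* (con 1 :+ (con 1 :+ (i :+ d)))) ≡.refl i d) ⟩
          square j      ≈⟨ eq ⟨
          square i      ≈⟨ reflexiveₚ (ℕ.+-identityʳ (square i)) ⟨
          square i + 0  ∎))
        where open +-*-Solver
      ...   | inj₁ z = small≉0 (s≤s z≤n) (s≤s (ℕ.≤-trans (s≤s (ℕ.m≤n+m d i)) (ℕ.≤-trans (ℕ.<⇒≤ j<h) (ℕ.<⇒≤ h<m)))) z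
      ...   | inj₂ z = small≉0 (s≤s z≤n) (s≤s (ℕ.+-mono-≤ (ℕ.<-trans i<j j<h) j<h)) z

    -- Expresses s = a^h modulo p for an integer sign s: Euler's criterion as a relation, through
    -- which facts about powers of a pass to `legendre`.
    IsHalfPower : ℕ → ℤ → Set
    IsHalfPower a s = (s ≡ + 1 × a ^ h ≈ₚ 1) ⊎ (s ≡ -[1+ 0 ] × a ^ h + 1 ≈ₚ 0)

    private
      search : (f : ℕ → Bool) (xs : List ℕ) → Bool
      search f xs = foldr Bool._∨_ false (map f xs)

      search-sound : ∀ f xs → search f xs ≡ true → ∃ λ x → f x ≡ true
      search-sound f (x ∷ xs) eq with f x in fx
      ... | true  = x , fx
      ... | false = search-sound f xs eq

      search-complete : ∀ f xs → search f xs ≡ false → ∀ {x} → x ∈ xs → f x ≡ false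
      search-complete f (x ∷ xs) eq (here ≡.refl) with f x
      ... | false = ≡.refl
      search-complete f (x ∷ xs) eq (there x∈xs) with f x
      ... | false = search-complete f xs eq x∈xs

      ≡ᵇ-sound : ∀ {x y} → (x ℕ.≡ᵇ y) ≡ true → x ≡ y
      ≡ᵇ-sound {x} {y} eq = ℕ.≡ᵇ⇒≡ x y (≡.subst T (≡.sym eq) _)

      ≡ᵇ-complete : ∀ {x y} → (x ℕ.≡ᵇ y) ≡ false → x ≢ y
      ≡ᵇ-complete {x} {y} eq x≡y = ≡.subst T eq (ℕ.≡⇒≡ᵇ x y x≡y)

    -- `legendre` tests the candidates below p. A hit makes a^h equal to 1; a failed search excludes
    -- every square root, because x may be reduced modulo p, and then a^h is -1.
    euler : ∀ a → ¬ (p ∣ a) → IsHalfPower a (legendre a p)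
    euler a p∤a with (a % p) ℕ.≡ᵇ 0 in zero?
    ... | true = contradiction (m%n≡0⇒n∣m a p (≡ᵇ-sound zero?)) p∤a
    ... | false with search (λ x → ((x * x) % p) ℕ.≡ᵇ (a % p)) (upTo p) in found
    ...   | true with search-sound _ (upTo p) found
    ...     | x , eq = inj₁ (≡.refl , square⇒power≈1 x (p∤a ∘ ≈0⇒∣) (residue (≡ᵇ-sound eq)))
    euler a p∤a | false | false = inj₂ (≡.refl , minus-one (half-power (p∤a ∘ ≈0⇒∣)))
      where
      nonsquare : ∀ x → ¬ (x * x ≈ₚ a)
      nonsquare x xx≈a = ≡ᵇ-complete
        (search-complete (λ x → ((x * x) % p) ℕ.≡ᵇ (a % p)) (upTo p) found (∈-upTo⁺ (m%n<n x p)))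
        (remainder (trans (*-cong x%p≈x x%p≈x) xx≈a))
        where
        x%p≈x : x % p ≈ₚ x
        x%p≈x = residue (m%n%n≡m%n x p)
      minus-one : _ ⊎ _ → _
      minus-one (inj₁ eq) = contradiction eq (nonsquare⇒power≉1 nonsquare)
      minus-one (inj₂ eq) = eq

    one≉minus-one : ∀ {b} → b ≈ₚ 1 → ¬ (b + 1 ≈ₚ 0)
    one≉minus-one b≈1 b+1≈0 = 2≉0 (trans (+-congʳ (sym b≈1)) b+1≈0)

    halfPower-cong : ∀ {a b s t} → a ^ h ≈ₚ b ^ h → IsHalfPower a s → IsHalfPower b t → s ≡ t
    halfPower-cong eq (inj₁ (≡.refl , _))  (inj₁ (≡.refl , _))  = ≡.refl
    halfPower-cong eq (inj₂ (≡.refl , _))  (inj₂ (≡.refl , _))  = ≡.refl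
    halfPower-cong eq (inj₁ (≡.refl , a≈)) (inj₂ (≡.refl , b≈)) =
      contradiction b≈ (one≉minus-one (trans (sym eq) a≈))
    halfPower-cong eq (inj₂ (≡.refl , a≈)) (inj₁ (≡.refl , b≈)) =
      contradiction a≈ (one≉minus-one (trans eq b≈))

    halfPower-opposite : ∀ {a b s t} → a ^ h + b ^ h ≈ₚ 0 →
                         IsHalfPower a s → IsHalfPower b t → s ≡ ℤ.- t
    halfPower-opposite eq (inj₁ (≡.refl , _))  (inj₂ (≡.refl , _))  = ≡.refl
    halfPower-opposite eq (inj₂ (≡.refl , _))  (inj₁ (≡.refl , _))  = ≡.refl
    halfPower-opposite eq (inj₁ (≡.refl , a≈)) (inj₁ (≡.refl , b≈)) =
      contradiction (trans (+-cong (sym a≈) (sym b≈)) eq) 2≉0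
    halfPower-opposite {a} {b} eq (inj₂ (≡.refl , a≈)) (inj₂ (≡.refl , b≈)) =
      contradiction (begin
        2                              ≈⟨ +-congʳ {2} eq ⟨
        a ^ h + b ^ h + 2              ≈⟨ reflexiveₚ (solve 2 (λ x y → x :+ y :+ con 2 := (x :+ con 1) :+ (y :+ con 1)) ≡.refl (a ^ h) (b ^ h)) ⟩
        (a ^ h + 1) + (b ^ h + 1)      ≈⟨ +-cong a≈ b≈ ⟩
        0                              ∎) 2≉0
      where open +-*-Solver

    -- Here b stands for -a, and a² = b² follows by expanding a (a + b) = 0 = b (a + b).
    even-power : ∀ {a b} k → a + b ≈ₚ 0 → a ^ (k + k) ≈ₚ b ^ (k + k)
    even-power {a} {b} k a+b≈0 = begin
      a ^ (k + k)    ≈⟨ ^-homo-* a k k ⟩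
      a ^ k * a ^ k  ≈⟨ ^-distrib-* a a k ⟨
      (a * a) ^ k    ≈⟨ ^-congˡ k (+-cancelʳ (a * b) _ _ squares) ⟩
      (b * b) ^ k    ≈⟨ ^-distrib-* b b k ⟩
      b ^ k * b ^ k  ≈⟨ ^-homo-* b k k ⟨
      b ^ (k + k)    ∎
      where
      squares : a * a + a * b ≈ₚ b * b + a * b
      squares = begin
        a * a + a * b  ≈⟨ reflexiveₚ (ℕ.*-distribˡ-+ a a b) ⟨
        a * (a + b)    ≈⟨ *-congˡ {a} a+b≈0 ⟩
        a * 0          ≈⟨ reflexiveₚ (≡.trans (ℕ.*-zeroʳ a) (≡.sym (ℕ.*-zeroʳ b))) ⟩
        b * 0          ≈⟨ *-congˡ {b} a+b≈0 ⟨
        b * (a + b)    ≈⟨ reflexiveₚ (≡.trans (ℕ.*-distribˡ-+ b a b) (≡.trans (ℕ.+-comm (b * a) (b * b)) (≡.cong (λ c → b * b + c) (ℕ.*-comm b a)))) ⟩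
        b * b + a * b  ∎

    odd-power : ∀ {a b} k → a + b ≈ₚ 0 → a ^ suc (k + k) + b ^ suc (k + k) ≈ₚ 0
    odd-power {a} {b} k a+b≈0 = begin
      a * a ^ (k + k) + b * b ^ (k + k)  ≈⟨ +-congˡ {a * a ^ (k + k)} (*-congˡ {b} (even-power k a+b≈0)) ⟨
      a * a ^ (k + k) + b * a ^ (k + k)  ≈⟨ reflexiveₚ (ℕ.*-distribʳ-+ (a ^ (k + k)) a b) ⟨
      (a + b) * a ^ (k + k)              ≈⟨ *-congʳ a+b≈0 ⟩
      0                                  ∎

    euler-unit : ∀ {a} → ¬ (p ∣ a) → legendre a p ≡ + 1 ⊎ legendre a p ≡ -[1+ 0 ]
    euler-unit {a} p∤a with euler a p∤a
    ... | inj₁ (eq , _) = inj₁ eq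
    ... | inj₂ (eq , _) = inj₂ eq

    private
      halfPower-witness : ∀ b ε → ¬ (b ≈ₚ 0) → IsHalfPower b (sign ε) →
                          ∃ λ b → ¬ (p ∣ b) × legendre b p ≡ sign ε
      halfPower-witness b ε b≉0 b^h =
        b , b≉0 ∘ ∣⇒≈0 , halfPower-cong {b} {b} refl (euler b (b≉0 ∘ ∣⇒≈0)) b^h

    euler-both-signs : ∀ ε → ∃ λ b → ¬ (p ∣ b) × legendre b p ≡ sign ε
    euler-both-signs true  = halfPower-witness 1 true 1≉0 (inj₁ (≡.refl , 1^k h))
    euler-both-signs false = let b , b≉0 , b^h≈-1 = nonresidue in
      halfPower-witness b false b≉0 (inj₂ (≡.refl , b^h≈-1))

    private
      ∣-opposite : ∀ {p a b} → ¬ (p ∣ a) → p ∣ a + b → ¬ (p ∣ b)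
      ∣-opposite {p} {a} {b} p∤a p∣a+b p∣b = p∤a (∣m+n∣m⇒∣n (≡.subst (p ∣_) (ℕ.+-comm a b) p∣a+b) p∣b)

    euler-neg-even : ∀ k → h ≡ k + k → ∀ {a b} → ¬ (p ∣ a) → p ∣ a + b → legendre a p ≡ legendre b p
    euler-neg-even k h≡2k {a} {b} p∤a p∣a+b = halfPower-cong {a} {b}
      (≡.subst (λ h → a ^ h ≈ₚ b ^ h) (≡.sym h≡2k) (even-power k (∣⇒≈0 p∣a+b)))
      (euler a p∤a) (euler b (∣-opposite p∤a p∣a+b))

    euler-neg-odd : ∀ k → h ≡ suc (k + k) → ∀ {a b} → ¬ (p ∣ a) → p ∣ a + b →
                    legendre a p ≡ ℤ.- legendre b p
    euler-neg-odd k h≡2k+1 {a} {b} p∤a p∣a+b = halfPower-opposite {a} {b}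
      (≡.subst (λ h → a ^ h + b ^ h ≈ₚ 0) (≡.sym h≡2k+1) (odd-power {a} {b} k (∣⇒≈0 p∣a+b)))
      (euler a p∤a) (euler b (∣-opposite p∤a p∣a+b))

  legendre-cong : ∀ {a b} p → a mod p ≡ b mod p → legendre a p ≡ legendre b p
  legendre-cong p eq rewrite eq = ≡.refl

  half : ∀ p → p % 2 ≡ 1 → p ≡ suc (p / 2 + p / 2)
  half p odd = ≡.trans (m≡m%n+[m/n]*n p 2) (≡.cong₂ _+_ odd
    (solve 1 (λ k → k :* con 2 := k :+ k) ≡.refl (p / 2)))
    where open +-*-Solver

  legendre-unit : ∀ p → Prime p → p % 2 ≡ 1 → ∀ {a} → ¬ (p ∣ a) →
                  legendre a p ≡ + 1 ⊎ legendre a p ≡ -[1+ 0 ]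
  legendre-unit p pp odd = go (p / 2) (half p odd) pp
    where
    go : ∀ h {p} → p ≡ suc (h + h) → Prime p → ∀ {a} → ¬ (p ∣ a) →
         legendre a p ≡ + 1 ⊎ legendre a p ≡ -[1+ 0 ]
    go h ≡.refl pp = OddPrime.euler-unit h pp

  legendre-takes-both-signs : ∀ p → Prime p → p % 2 ≡ 1 → ∀ ε →
                              ∃ λ b → ¬ (p ∣ b) × legendre b p ≡ sign ε
  legendre-takes-both-signs p pp odd = go (p / 2) (half p odd) pp
    where
    go : ∀ h {p} → p ≡ suc (h + h) → Prime p → ∀ ε → ∃ λ b → ¬ (p ∣ b) × legendre b p ≡ sign ε
    go h ≡.refl pp = OddPrime.euler-both-signs h pp

  -- The exponent (p - 1)/2 is twice `p / 4`, so a and b = -a have the same power with that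
  -- exponent.
  legendre-neg-1mod4 : ∀ p → Prime p → p % 4 ≡ 1 → ∀ {a b} → ¬ (p ∣ a) → p ∣ a + b →
                       legendre a p ≡ legendre b p
  legendre-neg-1mod4 p pp p%4≡1 = go (p / 4) _ ≡.refl quarter pp
    where
    open +-*-Solver
    quarter : p ≡ suc ((p / 4 + p / 4) + (p / 4 + p / 4))
    quarter = ≡.trans (m≡m%n+[m/n]*n p 4) (≡.cong₂ _+_ p%4≡1
      (solve 1 (λ k → k :* con 4 := (k :+ k) :+ (k :+ k)) ≡.refl (p / 4)))
    go : ∀ k h {p} → h ≡ k + k → p ≡ suc (h + h) → Prime p → ∀ {a b} → ¬ (p ∣ a) → p ∣ a + b →
         legendre a p ≡ legendre b p
    go k h h≡2k ≡.refl pp = OddPrime.euler-neg-even h pp k h≡2k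

  -- Here (p - 1)/2 is one more than twice `p / 4`, so the two powers differ in sign.
  legendre-neg-3mod4 : ∀ p → Prime p → p % 4 ≡ 3 → ∀ {a b} → ¬ (p ∣ a) → p ∣ a + b →
                       legendre a p ≡ ℤ.- legendre b p
  legendre-neg-3mod4 p pp p%4≡3 = go (p / 4) _ ≡.refl quarter pp
    where
    open +-*-Solver
    quarter : p ≡ suc (suc (p / 4 + p / 4) + suc (p / 4 + p / 4))
    quarter = ≡.trans (m≡m%n+[m/n]*n p 4) (≡.trans (≡.cong (_+ p / 4 * 4) p%4≡3)
      (solve 1 (λ k → con 3 :+ k :* con 4 := con 1 :+ ((con 1 :+ (k :+ k)) :+ (con 1 :+ (k :+ k)))) ≡.refl (p / 4)))
    go : ∀ k h {p} → h ≡ suc (k + k) → p ≡ suc (h + h) → Prime p → ∀ {a b} → ¬ (p ∣ a) → p ∣ a + b →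
         legendre a p ≡ ℤ.- legendre b p
    go k h h≡2k+1 ≡.refl pp = OddPrime.euler-neg-odd h pp k h≡2k+1

  -- With u = n / pᵢ this is the Chinese remainder step: adding multiples of u changes the residue
  -- modulo pᵢ and modulo no other prime of n.
  linear-congruence : ∀ p → Prime p → p % 2 ≡ 1 → ∀ {u} → ¬ (p ∣ u) → ∀ d b →
                      ∃ λ s → (d + s * u) mod p ≡ b mod p
  linear-congruence p pp odd p∤u = go (p / 2) (half p odd) pp p∤u
    where
    go : ∀ h {p} → p ≡ suc (h + h) → Prime p → ∀ {u} → ¬ (p ∣ u) → ∀ d b →
         ∃ λ s → (d + s * u) mod p ≡ b mod p
    go h ≡.refl pp p∤u d b with OddPrime.solve-linear h pp (p∤u ∘ Residues.≈0⇒∣ (h + h)) d b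
    ... | s , eq = s , Residues.remainder eq

-- Counting the choices (Q_d, ε_d) up to a relation.

module Counting where

  open import Data.Nat as ℕ using (ℕ; zero; suc; _<_; z≤n; s≤s; _∸_; _*_; _^_)
  import Data.Nat.Properties as ℕ
  open import Data.Nat.Combinatorics using (_C_; nCk+nC[k+1]≡[n+1]C[k+1]; k>n⇒nCk≡0)
  open import Data.Bool using (Bool; true; false)
  open import Data.Fin using (Fin; zero; suc; combine; remQuot; punchIn; punchOut)
  open import Data.Fin.Properties using (punchIn-injective; punchInᵢ≢i; punchIn-punchOut; remQuot-combine; combine-remQuot)
  open import Data.Fin.Subset using (Subset; ∣_∣; ∁; ⊥)
  open import Data.Fin.Subset.Properties using (∣∁p∣≡n∸∣p∣)
  open import Data.List using (upTo; applyUpTo; map)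
  open import Data.Vec using (Vec; []; _∷_; lookup)
  open import Data.Vec.Properties using (lookup-replicate)
  open import Data.Product using (_×_; _,_; ∃; proj₁; proj₂)
  open import Function.Base using (_∘_; id)
  open import Relation.Nullary using (yes; no; contradiction)
  open import Relation.Binary.PropositionalEquality as ≡ using (_≡_; _≢_; refl; sym; trans; cong; cong₂; subst)
  open import Algebra.Properties.CommutativeSemigroup ℕ.*-commutativeSemigroup using (interchange; x∙yz≈y∙xz)

  -- The setoid of elements satisfying P, up to ~, has exactly m elements.
  record Count {A : Set} (P : A → Set) (_~_ : A → A → Set) (m : ℕ) : Set where
    field
      decode     : Fin m → A
      valid      : ∀ i → P (decode i)
      injective  : ∀ i j → decode i ~ decode j → i ≡ j
      surjective : ∀ a → P a → ∃ λ i → a ~ decode i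
  open Count

  private variable
    A B : Set
    P : A → Set
    Q : B → Set
    _~_ : A → A → Set
    _≈_ : B → B → Set
    m k : ℕ

  -- The relations need not be equivalences and `F` need not respect them everywhere. So the
  -- preimage chosen for b has to carry the conclusion to every valid a′ it is related to, the
  -- decoded element being one of these.
  count-map : (F : A → B) → (∀ {a} → P a → Q (F a)) → (∀ {a b} → P a → P b → F a ≈ F b → a ~ b) →
              (∀ {b} → Q b → ∃ λ a → P a × (∀ {a′} → P a′ → a ~ a′ → b ≈ F a′)) →
              Count P _~_ m → Count Q _≈_ m
  count-map F F-valid F-injective F-surjective c = record
    { decode = F ∘ decode c
    ; valid = F-valid ∘ valid c
    ; injective = λ i j → injective c i j ∘ F-injective (valid c i) (valid c j)
    ; surjective = λ b Qb → let a , Pa , b≈F = F-surjective Qb ; i , a~i = surjective c a Pa in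
        i , b≈F (valid c i) a~i }

  count-× : Count P _~_ m → Count Q _≈_ k →
            Count (λ (a , b) → P a × Q b) (λ (a , b) (a′ , b′) → (a ~ a′) × (b ≈ b′)) (m * k)
  count-× {_~_ = _~_} {m = m} {_≈_ = _≈_} {k = k} c d = record
    { decode = λ i → decode c (proj₁ (remQuot {m} k i)) , decode d (proj₂ (remQuot {m} k i))
    ; valid = λ i → valid c _ , valid d _
    ; injective = λ i j (e , f) → trans (sym (combine-remQuot {m} k i)) (trans
        (cong₂ combine (injective c _ _ e) (injective d _ _ f)) (combine-remQuot {m} k j))
    ; surjective = λ (a , b) (Pa , Qb) →
        let i , a~ = surjective c a Pa ; j , b≈ = surjective d b Qb in
        combine i j , subst (λ ij → (a ~ decode c (proj₁ ij)) × (b ≈ decode d (proj₂ ij)))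
          (sym (remQuot-combine i j)) (a~ , b≈) }

  -- Serves to discard the empty set of primes, that is Q = 1.
  count-remove : Count P _≡_ m → ∀ {a} → P a → Count (λ b → P b × b ≢ a) _≡_ (m ∸ 1)
  count-remove {m = zero}  c {a} Pa with surjective c a Pa
  ... | () , _
  count-remove {m = suc m} c {a} Pa with surjective c a Pa
  ... | i₀ , a≡i₀ = record
    { decode = decode c ∘ punchIn i₀
    ; valid = λ i → valid c _ , λ eq → punchInᵢ≢i i₀ i (injective c _ _ (trans eq a≡i₀))
    ; injective = λ i j eq → punchIn-injective i₀ i j (injective c _ _ eq)
    ; surjective = λ b (Pb , b≢a) → let i , b≡i = surjective c b Pb
                                        i₀≢i = λ i₀≡i → b≢a (trans b≡i (trans (cong (decode c) (sym i₀≡i)) (sym a≡i₀))) in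
        punchOut i₀≢i , trans b≡i (cong (decode c) (sym (punchIn-punchOut i₀≢i))) }

  data Always {A : Set} (a : A) : Set where
    always : Always a

  count-Bool : Count {Bool} Always _≡_ 2
  count-Bool = record
    { decode = λ { zero → false ; (suc zero) → true }
    ; valid = λ _ → always
    ; injective = λ { zero zero _ → refl ; (suc zero) (suc zero) _ → refl
                    ; zero (suc zero) () ; (suc zero) zero () }
    ; surjective = λ { false _ → zero , refl ; true _ → suc zero , refl } }

  -- With D the primes dividing d and E those dividing Q, this is the condition Q d ∣ n, n being
  -- squarefree.
  Disjoint : ∀ {g} → Subset g → Subset g → Set
  Disjoint D E = ∀ i → lookup D i ≡ true → lookup E i ≡ false

  count-disjoint : ∀ {g} (D : Subset g) → Count (Disjoint D) _≡_ (2 ^ ∣ ∁ D ∣)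
  count-disjoint [] = record
    { decode = λ _ → [] ; valid = λ _ () ; injective = λ { zero zero _ → refl }
    ; surjective = λ { [] _ → zero , refl } }
  count-disjoint (true ∷ D) = count-map (false ∷_)
    (λ { disj zero _ → refl ; disj (suc i) → disj i })
    (λ { _ _ refl → refl })
    (λ { {false ∷ E} disj → E , disj ∘ suc , λ { _ refl → refl }
       ; {true ∷ E} disj → contradiction (disj zero refl) λ () })
    (count-disjoint D)
  count-disjoint (false ∷ D) = count-map (λ (b , E) → b ∷ E)
    (λ { (_ , disj) zero () ; (_ , disj) (suc i) → disj i })
    (λ { _ _ refl → refl , refl })
    (λ { {b ∷ E} disj → (b , E) , (always , disj ∘ suc) , λ { _ (refl , refl) → refl } })
    (count-× count-Bool (count-disjoint D))

  ∏Subsets : ∀ {g} → (Subset g → ℕ) → ℕ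
  ∏Subsets {zero}  W = W []
  ∏Subsets {suc g} W = ∏Subsets (W ∘ (true ∷_)) * ∏Subsets (W ∘ (false ∷_))

  -- A function on the subsets of g + 1 points is a pair of functions on the subsets of g points,
  -- according to the first point. The comparison is pointwise, so function extensionality does not
  -- enter.
  count-Π : ∀ {g} {A : Set} {P : Subset g → A → Set} {R : Subset g → A → A → Set} {W : Subset g → ℕ} →
            (∀ D → Count (P D) (R D) (W D)) →
            Count {Subset g → A} (λ φ → ∀ D → P D (φ D)) (λ φ ψ → ∀ D → R D (φ D) (ψ D)) (∏Subsets W)
  count-Π {zero} c = count-map (λ a _ → a) (λ { Pa [] → Pa }) (λ _ _ r → r [])
    (λ {φ} Pφ → φ [] , Pφ [] , λ { _ r [] → r }) (c [])
  count-Π {suc g} {A} {P} {R} c = count-map join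
    (λ { (p , q) (true ∷ D) → p D ; (p , q) (false ∷ D) → q D })
    (λ _ _ r → r ∘ (true ∷_) , r ∘ (false ∷_))
    (λ {φ} Pφ → (φ ∘ (true ∷_) , φ ∘ (false ∷_)) , (Pφ ∘ (true ∷_) , Pφ ∘ (false ∷_)) ,
       λ { _ (r , s) (true ∷ D) → r D ; _ (r , s) (false ∷ D) → s D })
    (count-× (count-Π (c ∘ (true ∷_))) (count-Π (c ∘ (false ∷_))))
    where
    join : (Subset g → A) × (Subset g → A) → Subset (suc g) → A
    join (φ , ψ) (true  ∷ D) = φ D
    join (φ , ψ) (false ∷ D) = ψ D

  ∏< : ℕ → (ℕ → ℕ) → ℕ
  ∏< zero    f = 1
  ∏< (suc m) f = f 0 * ∏< m (f ∘ suc)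

  ∏<-cong : ∀ m {f h : ℕ → ℕ} → (∀ r → r < m → f r ≡ h r) → ∏< m f ≡ ∏< m h
  ∏<-cong zero    eq = refl
  ∏<-cong (suc m) eq = cong₂ _*_ (eq 0 (s≤s z≤n)) (∏<-cong m (λ r r<m → eq (suc r) (s≤s r<m)))

  ∏<-* : ∀ m (f h : ℕ → ℕ) → ∏< m (λ r → f r * h r) ≡ ∏< m f * ∏< m h
  ∏<-* zero    f h = refl
  ∏<-* (suc m) f h = trans (cong (f 0 * h 0 *_) (∏<-* m (f ∘ suc) (h ∘ suc))) (interchange (f 0) (h 0) _ _)

  ∏<-last : ∀ m f → ∏< (suc m) f ≡ ∏< m f * f m
  ∏<-last zero    f = trans (ℕ.*-identityʳ (f 0)) (sym (ℕ.*-identityˡ (f 0)))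
  ∏<-last (suc m) f = trans (cong (f 0 *_) (∏<-last m (f ∘ suc))) (sym (ℕ.*-assoc (f 0) _ _))

  prodℕ-upTo : ∀ m f → prodℕ (map f (upTo m)) ≡ ∏< m f
  prodℕ-upTo m f = go m id
    where
    go : ∀ m h → prodℕ (map f (applyUpTo h m)) ≡ ∏< m (f ∘ h)
    go zero    h = refl
    go (suc m) h = cong (f (h 0) *_) (go m (h ∘ suc))

  -- A subset of size r + 1 contains the first point or not, which gives w(r + 1) the exponents C(g,
  -- r) and C(g, r + 1); Pascal's rule adds them.
  ∏Subsets-by-size : ∀ g {W : Subset g → ℕ} (w : ℕ → ℕ) → (∀ D → W D ≡ w ∣ D ∣) →
                     ∏Subsets W ≡ ∏< (suc g) (λ r → w r ^ (g C r))
  ∏Subsets-by-size zero    w W≡w = trans (W≡w []) (sym (trans (ℕ.*-identityʳ _) (ℕ.*-identityʳ _)))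
  ∏Subsets-by-size (suc g) {W} w W≡w = begin
    ∏Subsets (W ∘ (true ∷_)) * ∏Subsets (W ∘ (false ∷_))
      ≡⟨ cong₂ _*_ (∏Subsets-by-size g (w ∘ suc) (W≡w ∘ (true ∷_))) (∏Subsets-by-size g w (W≡w ∘ (false ∷_))) ⟩
    X * (w 0 ^ 1 * Y)
      ≡⟨ x∙yz≈y∙xz X (w 0 ^ 1) Y ⟩
    w 0 ^ 1 * (X * Y)
      ≡⟨ cong (λ y → w 0 ^ 1 * (X * y)) (sym extend) ⟩
    w 0 ^ 1 * (X * ∏< (suc g) (λ r → w (suc r) ^ (g C suc r)))
      ≡⟨ cong (w 0 ^ 1 *_) (sym (∏<-* (suc g) (λ r → w (suc r) ^ (g C r)) (λ r → w (suc r) ^ (g C suc r)))) ⟩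
    w 0 ^ 1 * ∏< (suc g) (λ r → w (suc r) ^ (g C r) * w (suc r) ^ (g C suc r))
      ≡⟨ cong (w 0 ^ 1 *_) (∏<-cong (suc g) (λ r _ → trans (sym (ℕ.^-distribˡ-+-* (w (suc r)) (g C r) (g C suc r)))
           (cong (w (suc r) ^_) (nCk+nC[k+1]≡[n+1]C[k+1] g r)))) ⟩
    ∏< (suc (suc g)) (λ r → w r ^ (suc g C r)) ∎
    where
    open ≡.≡-Reasoning
    X = ∏< (suc g) (λ r → w (suc r) ^ (g C r))
    Y = ∏< g (λ r → w (suc r) ^ (g C suc r))
    -- Pads the product by the factor r = g, whose exponent C(g, g + 1) is 0, so that both products
    -- have the same range.
    extend : ∏< (suc g) (λ r → w (suc r) ^ (g C suc r)) ≡ Y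
    extend = trans (∏<-last g (λ r → w (suc r) ^ (g C suc r)))
      (trans (cong (λ e → Y * w (suc g) ^ e) (k>n⇒nCk≡0 (ℕ.n<1+n g))) (ℕ.*-identityʳ Y))

  -- The divisor d = n carries no choice, so it contributes the factor 1.
  optionCount : ℕ → ℕ → ℕ
  optionCount g r with r ℕ.≟ g
  ... | yes _ = 1
  ... | no  _ = 2 * (2 ^ (g ∸ r) ∸ 1)

  ∏Subsets≡qrCount : ∀ g → ∏Subsets {g} (λ D → optionCount g ∣ D ∣) ≡ qrCount g
  ∏Subsets≡qrCount g = begin
    ∏Subsets {g} (λ D → optionCount g ∣ D ∣)       ≡⟨ ∏Subsets-by-size g (optionCount g) (λ _ → refl) ⟩
    ∏< (suc g) (λ r → optionCount g r ^ (g C r))   ≡⟨ ∏<-last g _ ⟩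
    ∏< g (λ r → optionCount g r ^ (g C r)) * optionCount g g ^ (g C g)
      ≡⟨ cong₂ _*_ (∏<-cong g proper) full ⟩
    ∏< g (λ r → (2 * (2 ^ (g ∸ r) ∸ 1)) ^ (g C r)) * 1  ≡⟨ ℕ.*-identityʳ _ ⟩
    ∏< g (λ r → (2 * (2 ^ (g ∸ r) ∸ 1)) ^ (g C r))      ≡⟨ prodℕ-upTo g _ ⟨
    qrCount g                                           ∎
    where
    open ≡.≡-Reasoning
    full : optionCount g g ^ (g C g) ≡ 1
    full with g ℕ.≟ g
    ... | yes _  = ℕ.^-zeroˡ (g C g)
    ... | no g≢g = contradiction refl g≢g
    proper : ∀ r → r < g → optionCount g r ^ (g C r) ≡ (2 * (2 ^ (g ∸ r) ∸ 1)) ^ (g C r)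
    proper r r<g with r ℕ.≟ g
    ... | yes r≡g = contradiction r≡g (ℕ.<⇒≢ r<g)
    ... | no _    = refl

  -- D encodes d, and the pair encodes (ε_d, Q_d): Q_d d ∣ n and Q_d > 1. The full set encodes d =
  -- n, where `ValidChoice` imposes no condition either.
  Option : ∀ {g} → Subset g → Bool × Subset g → Set
  Option {g} D (ε , E) = ∣ D ∣ ≢ g → Disjoint D E × E ≢ ⊥

  -- Two signs and a nonempty subset of the complement of D. For full D the relation is vacuous, so
  -- all pairs form a single class.
  count-options : ∀ {g} (D : Subset g) →
                  Count (Option D) (λ o o′ → ∣ D ∣ ≢ g → o ≡ o′) (optionCount g ∣ D ∣)
  count-options {g} D with ∣ D ∣ ℕ.≟ g
  ... | yes full = record
    { decode = λ _ → true , ⊥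
    ; valid = λ _ proper → contradiction full proper
    ; injective = λ { zero zero _ → refl }
    ; surjective = λ _ _ → zero , λ proper → contradiction full proper }
  ... | no proper = subst (Count (Option D) _) (cong (λ k → 2 * (2 ^ k ∸ 1)) (∣∁p∣≡n∸∣p∣ D))
    (count-map id (λ (_ , o) _ → o) (λ { _ _ r → split (r proper) })
      (λ {o} o-valid → o , (always , o-valid proper) , λ { _ (refl , refl) _ → refl })
      (count-× count-Bool (count-remove (count-disjoint D) {⊥} (λ i _ → lookup-replicate i false))))
    where
    split : ∀ {o o′ : Bool × Subset g} → o ≡ o′ → proj₁ o ≡ proj₁ o′ × proj₂ o ≡ proj₂ o′
    split refl = refl , refl

-- Divisors of a squarefree number and products of signs.

module Divisors where

  open import Data.Nat as ℕ using (ℕ; zero; suc; _<_; _%_; _/_; _+_; _*_)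
  import Data.Nat.Properties as ℕ
  open import Data.Nat.DivMod using (m≡m%n+[m/n]*n; %-remove-+ʳ; m%n<n)
  open import Data.Nat.Divisibility
  open import Data.Nat.GCD using (gcd; gcd[m,n]∣m; gcd[m,n]∣n; gcd-greatest)
  open import Data.Nat.Coprimality using (Coprime; coprime-divisor)
  import Data.Nat.Coprimality as Coprimality
  open import Data.Nat.Primality using (Prime; euclidsLemma; prime⇒nonTrivial; prime⇒nonZero; prime⇒irreducible)
  open import Data.Integer as ℤ using (ℤ; +_; -[1+_])
  import Data.Integer.Properties as ℤ
  open import Data.Bool using (Bool; true; false; T)
  open import Data.Fin using (Fin; zero; suc)
  open import Data.Fin.Properties using (suc-injective)
  open import Data.Fin.Subset using (Subset; ∣_∣; ⊥)
  open import Data.List as List using (map; allFin)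
  open import Data.List.Properties using (map-tabulate)
  open import Data.Vec using ([]; _∷_; lookup; tabulate)
  open import Data.Product using (_×_; _,_; ∃)
  open import Data.Sum using (_⊎_; inj₁; inj₂)
  open import Function.Base using (_∘_; id)
  open import Relation.Nullary using (¬_; yes; no; contradiction)
  open import Relation.Binary.PropositionalEquality using (_≡_; _≢_; refl; sym; trans; cong; cong₂; subst)
  open import Algebra.Properties.CommutativeSemigroup ℕ.*-commutativeSemigroup using (x∙yz≈y∙xz)
  open Counting using (Disjoint)

  prime>0 : ∀ {p} → Prime p → 0 < p
  prime>0 {p} pp = ℕ.>-nonZero⁻¹ p {{prime⇒nonZero pp}}

  prime>1 : ∀ {p} → Prime p → 1 < p
  prime>1 {p} pp = ℕ.nonTrivial⇒n>1 p {{prime⇒nonTrivial pp}}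

  prime∣prime : ∀ {p r} → Prime p → Prime r → p ∣ r → p ≡ r
  prime∣prime pp pr p∣r with prime⇒irreducible pr p∣r
  ... | inj₁ refl = contradiction (prime>1 pp) (ℕ.<-irrefl refl)
  ... | inj₂ p≡r  = p≡r

  prime⇒coprime′ : ∀ {p m} → Prime p → ¬ (p ∣ m) → Coprime p m
  prime⇒coprime′ pp p∤m (i∣p , i∣m) with prime⇒irreducible pp i∣p
  ... | inj₁ i≡1  = i≡1
  ... | inj₂ refl = contradiction i∣m p∤m

  mod≡0⇒∣ : ∀ {p} → 0 < p → ∀ a → a mod p ≡ 0 → p ∣ a
  mod≡0⇒∣ {suc p} _ a = m%n≡0⇒n∣m a (suc p)

  ∣⇒mod≡0 : ∀ {p} → 0 < p → ∀ {a} → p ∣ a → a mod p ≡ 0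
  ∣⇒mod≡0 {suc p} _ {a} = n∣m⇒m%n≡0 a (suc p)

  ∣-mod : ∀ {p a b} → 0 < p → a mod p ≡ b mod p → p ∣ a → p ∣ b
  ∣-mod 0<p eq p∣a = mod≡0⇒∣ 0<p _ (trans (sym eq) (∣⇒mod≡0 0<p p∣a))

  mod-+-multiple : ∀ {p} a {b} → 0 < p → p ∣ b → (a + b) mod p ≡ a mod p
  mod-+-multiple {suc p} a _ p∣b = %-remove-+ʳ a p∣b

  mod-mod : ∀ {p n} → 0 < p → 0 < n → p ∣ n → ∀ a → (a mod n) mod p ≡ a mod p
  mod-mod {p} {n@(suc _)} 0<p _ p∣n a = trans
    (sym (mod-+-multiple (a % n) 0<p (∣n⇒∣m*n (a / n) p∣n))) (cong (_mod p) (sym (m≡m%n+[m/n]*n a n)))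

  mod<n : ∀ {n} → 0 < n → ∀ a → a mod n < n
  mod<n {suc n} _ a = m%n<n a (suc n)

  ≡ᵇ-true : ∀ {x y} → x ≡ y → (x ℕ.≡ᵇ y) ≡ true
  ≡ᵇ-true {zero}  refl = refl
  ≡ᵇ-true {suc x} refl = ≡ᵇ-true {x} refl

  ≡ᵇ-false : ∀ {x y} → x ≢ y → (x ℕ.≡ᵇ y) ≡ false
  ≡ᵇ-false {x} {y} x≢y with x ℕ.≡ᵇ y in eq
  ... | false = refl
  ... | true  = contradiction (ℕ.≡ᵇ⇒≡ x y (subst T (sym eq) _)) x≢y

  -- Places j and -j in the same class, hence under the same choice (Q_d, ε_d).
  gcd-complement : ∀ {a b n} → a + b ≡ n → gcd a n ≡ gcd b n
  gcd-complement {a} {b} a+b≡n = ∣-antisym (half-way a b a+b≡n) (half-way b a (trans (ℕ.+-comm b a) a+b≡n))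
    where
    half-way : ∀ a b {n} → a + b ≡ n → gcd a n ∣ gcd b n
    half-way a b {n} a+b≡n = gcd-greatest
      (∣m+n∣m⇒∣n (subst (gcd a n ∣_) (sym a+b≡n) (gcd[m,n]∣n a n)) (gcd[m,n]∣m a n)) (gcd[m,n]∣n a n)

  prodPrimes-suc : ∀ {g} (p : Fin (suc g) → ℕ) → prodPrimes p ≡ p zero * prodPrimes (p ∘ suc)
  prodPrimes-suc p = cong (λ xs → p zero * prodℕ xs) (trans (map-tabulate suc p) (sym (map-tabulate id (p ∘ suc))))

  -- The number n / pᵢ, built as a product so that no division occurs.
  cofactor : ∀ {g} → (Fin g → ℕ) → Fin g → ℕ
  cofactor p zero    = prodPrimes (p ∘ suc)
  cofactor p (suc i) = p zero * cofactor (p ∘ suc) i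

  prodPrimes-cofactor : ∀ {g} (p : Fin g → ℕ) i → prodPrimes p ≡ p i * cofactor p i
  prodPrimes-cofactor p zero    = prodPrimes-suc p
  prodPrimes-cofactor p (suc i) = trans (prodPrimes-suc p)
    (trans (cong (p zero *_) (prodPrimes-cofactor (p ∘ suc) i)) (x∙yz≈y∙xz (p zero) (p (suc i)) _))

  p∣prodPrimes : ∀ {g} (p : Fin g → ℕ) i → p i ∣ prodPrimes p
  p∣prodPrimes p i = subst (p i ∣_) (sym (prodPrimes-cofactor p i)) (m∣m*n (cofactor p i))

  prodSubset : ∀ {g} → (Fin g → ℕ) → Subset g → ℕ
  prodSubset p []          = 1
  prodSubset p (true  ∷ E) = p zero * prodSubset (p ∘ suc) E
  prodSubset p (false ∷ E) = prodSubset (p ∘ suc) E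

  ∈⇒∣prodSubset : ∀ {g} (p : Fin g → ℕ) E i → lookup E i ≡ true → p i ∣ prodSubset p E
  ∈⇒∣prodSubset p (true  ∷ E) zero    _  = m∣m*n _
  ∈⇒∣prodSubset p (true  ∷ E) (suc i) i∈ = ∣n⇒∣m*n (p zero) (∈⇒∣prodSubset (p ∘ suc) E i i∈)
  ∈⇒∣prodSubset p (false ∷ E) (suc i) i∈ = ∈⇒∣prodSubset (p ∘ suc) E i i∈

  prodSubset-⊥ : ∀ {g} (p : Fin g → ℕ) → prodSubset p ⊥ ≡ 1
  prodSubset-⊥ {zero}  p = refl
  prodSubset-⊥ {suc g} p = prodSubset-⊥ (p ∘ suc)

  prodSubset-disjoint : ∀ {g} (p : Fin g → ℕ) D E → Disjoint D E → prodSubset p E * prodSubset p D ∣ prodPrimes p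
  prodSubset-disjoint p []      []      _    = ∣-refl
  prodSubset-disjoint p (b ∷ D) (c ∷ E) disj =
    subst (prodSubset p (c ∷ E) * prodSubset p (b ∷ D) ∣_) (sym (prodPrimes-suc p)) (cases b c (disj zero))
    where
    e = prodSubset (p ∘ suc) E
    d = prodSubset (p ∘ suc) D
    IH : e * d ∣ prodPrimes (p ∘ suc)
    IH = prodSubset-disjoint (p ∘ suc) D E (disj ∘ suc)
    cases : ∀ b c → (b ≡ true → c ≡ false) →
            prodSubset p (c ∷ E) * prodSubset p (b ∷ D) ∣ p zero * prodPrimes (p ∘ suc)
    cases true  true  disj₀ = contradiction (disj₀ refl) λ ()
    cases true  false _     = subst (_∣ p zero * prodPrimes (p ∘ suc)) (x∙yz≈y∙xz (p zero) e d) (*-monoʳ-∣ (p zero) IH)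
    cases false true  _     = subst (_∣ p zero * prodPrimes (p ∘ suc)) (sym (ℕ.*-assoc (p zero) e d)) (*-monoʳ-∣ (p zero) IH)
    cases false false _     = ∣n⇒∣m*n (p zero) IH

  prodSubset∣ : ∀ {g} (p : Fin g → ℕ) E → prodSubset p E ∣ prodPrimes p
  prodSubset∣ p []          = ∣-refl
  prodSubset∣ p (true  ∷ E) = subst (prodSubset p (true ∷ E) ∣_) (sym (prodPrimes-suc p)) (*-monoʳ-∣ (p zero) (prodSubset∣ (p ∘ suc) E))
  prodSubset∣ p (false ∷ E) = subst (prodSubset p (false ∷ E) ∣_) (sym (prodPrimes-suc p)) (∣n⇒∣m*n (p zero) (prodSubset∣ (p ∘ suc) E))

  prodℤ-allFin : ∀ {g} (F : Fin g → ℤ) → prodℤ (map F (allFin g)) ≡ prodℤ (List.tabulate F)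
  prodℤ-allFin F = cong prodℤ (map-tabulate id F)

  IsUnit : ℤ → Set
  IsUnit s = s ≡ + 1 ⊎ s ≡ -[1+ 0 ]

  unit≢neg : ∀ {s} → IsUnit s → s ≢ ℤ.- s
  unit≢neg (inj₁ refl) ()
  unit≢neg (inj₂ refl) ()

  unit-sign : ∀ {s t} → IsUnit s → IsUnit t → s ≢ t → ℤ.- s ≡ t
  unit-sign (inj₁ refl) (inj₁ refl) s≢t = contradiction refl s≢t
  unit-sign (inj₁ refl) (inj₂ refl) _   = refl
  unit-sign (inj₂ refl) (inj₁ refl) _   = refl
  unit-sign (inj₂ refl) (inj₂ refl) s≢t = contradiction refl s≢t

  sign-unit : ∀ ε → IsUnit (sign ε)
  sign-unit true  = inj₁ refl
  sign-unit false = inj₂ refl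

  sign-injective : ∀ {ε ε′} → sign ε ≡ sign ε′ → ε ≡ ε′
  sign-injective {true}  {true}  _ = refl
  sign-injective {false} {false} _ = refl

  opposite-sign : ∀ {s} → IsUnit s → ∃ λ ε → sign ε ≡ ℤ.- s
  opposite-sign (inj₁ refl) = false , refl
  opposite-sign (inj₂ refl) = true , refl

  prodℤ-unit : ∀ {g} (F : Fin g → ℤ) → (∀ i → IsUnit (F i)) → IsUnit (prodℤ (List.tabulate F))
  prodℤ-unit {zero}  F units = inj₁ refl
  prodℤ-unit {suc g} F units = mul (units zero) (prodℤ-unit (F ∘ suc) (units ∘ suc))
    where
    mul : ∀ {s t} → IsUnit s → IsUnit t → IsUnit (s ℤ.* t)
    mul (inj₁ refl) (inj₁ refl) = inj₁ refl
    mul (inj₁ refl) (inj₂ refl) = inj₂ refl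
    mul (inj₂ refl) (inj₁ refl) = inj₂ refl
    mul (inj₂ refl) (inj₂ refl) = inj₁ refl

  prodℤ-cong : ∀ {g} (F G : Fin g → ℤ) → (∀ i → F i ≡ G i) → prodℤ (List.tabulate F) ≡ prodℤ (List.tabulate G)
  prodℤ-cong {zero}  F G eq = refl
  prodℤ-cong {suc g} F G eq = cong₂ ℤ._*_ (eq zero) (prodℤ-cong (F ∘ suc) (G ∘ suc) (eq ∘ suc))

  -- Describes a Jacobi symbol whose argument is altered modulo a single prime dividing Q.
  prodℤ-flip : ∀ {g} (F G : Fin g → ℤ) l → F l ≡ ℤ.- G l → (∀ i → i ≢ l → F i ≡ G i) →
               prodℤ (List.tabulate F) ≡ ℤ.- prodℤ (List.tabulate G)
  prodℤ-flip F G zero at off = trans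
    (cong₂ ℤ._*_ at (prodℤ-cong (F ∘ suc) (G ∘ suc) (λ i → off (suc i) λ ())))
    (sym (ℤ.neg-distribˡ-* (G zero) _))
  prodℤ-flip F G (suc l) at off = trans
    (cong₂ ℤ._*_ (off zero λ ()) (prodℤ-flip (F ∘ suc) (G ∘ suc) l at (λ i i≢l → off (suc i) (i≢l ∘ suc-injective))))
    (sym (ℤ.neg-distribʳ-* (G zero) _))

  prodℤ-single : ∀ {g} (F : Fin g → ℤ) l → (∀ i → i ≢ l → F i ≡ + 1) → prodℤ (List.tabulate F) ≡ F l
  prodℤ-single {suc g} F zero off = trans
    (cong (F zero ℤ.*_) (trans (prodℤ-cong (F ∘ suc) (λ _ → + 1) (λ i → off (suc i) λ ())) (ones g)))
    (ℤ.*-identityʳ (F zero))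
    where
    ones : ∀ g → prodℤ (List.tabulate {n = g} (λ _ → + 1)) ≡ + 1
    ones zero    = refl
    ones (suc g) = trans (ℤ.*-identityˡ _) (ones g)
  prodℤ-single F (suc l) off = trans
    (cong₂ ℤ._*_ (off zero λ ()) (prodℤ-single (F ∘ suc) l (λ i i≢l → off (suc i) (i≢l ∘ suc-injective))))
    (ℤ.*-identityˡ _)

  prime∣prodPrimes : ∀ {g} (p : Fin g → ℕ) {r} → Prime r → r ∣ prodPrimes p → ∃ λ i → r ∣ p i
  prime∣prodPrimes {zero}  p pr r∣1 = contradiction (∣1⇒≡1 r∣1) (λ { refl → ℕ.<-irrefl refl (prime>1 pr) })
  prime∣prodPrimes {suc g} p {r} pr r∣n with euclidsLemma (p zero) _ pr (subst (r ∣_) (prodPrimes-suc p) r∣n)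
  ... | inj₁ r∣p₀ = zero , r∣p₀
  ... | inj₂ r∣n′ with prime∣prodPrimes (p ∘ suc) pr r∣n′
  ...   | i , r∣pᵢ = suc i , r∣pᵢ

  prime∣prodSubset : ∀ {g} (p : Fin g → ℕ) {r} → Prime r → ∀ E → r ∣ prodSubset p E → ∃ λ i → lookup E i ≡ true × r ∣ p i
  prime∣prodSubset p pr []          r∣1 = contradiction (∣1⇒≡1 r∣1) (λ { refl → ℕ.<-irrefl refl (prime>1 pr) })
  prime∣prodSubset p pr (false ∷ E) r∣e with prime∣prodSubset (p ∘ suc) pr E r∣e
  ... | i , i∈E , r∣pᵢ = suc i , i∈E , r∣pᵢ
  prime∣prodSubset p pr (true  ∷ E) r∣e with euclidsLemma (p zero) _ pr r∣e
  ... | inj₁ r∣p₀ = zero , refl , r∣p₀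
  ... | inj₂ r∣e′ with prime∣prodSubset (p ∘ suc) pr E r∣e′
  ...   | i , i∈E , r∣pᵢ = suc i , i∈E , r∣pᵢ

  Distinct : ∀ {g} → (Fin g → ℕ) → Set
  Distinct p = ∀ i j → p i ≡ p j → i ≡ j

  tail-distinct : ∀ {g} {p : Fin (suc g) → ℕ} → Distinct p → Distinct (p ∘ suc)
  tail-distinct distinct i j eq = suc-injective (distinct (suc i) (suc j) eq)

  -- Squarefreeness of n: a second factor pᵢ would have to equal one of the other primes.
  p∤cofactor : ∀ {g} (p : Fin g → ℕ) → Distinct p → (∀ i → Prime (p i)) → ∀ i → ¬ (p i ∣ cofactor p i)
  p∤cofactor p distinct primes zero p∣ with prime∣prodPrimes (p ∘ suc) (primes zero) p∣
  ... | i , p₀∣pᵢ with distinct zero (suc i) (prime∣prime (primes zero) (primes (suc i)) p₀∣pᵢ)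
  ...   | ()
  p∤cofactor p distinct primes (suc i) p∣ with euclidsLemma (p zero) _ (primes (suc i)) p∣
  ... | inj₂ p∣c = p∤cofactor (p ∘ suc) (tail-distinct distinct) (primes ∘ suc) i p∣c
  ... | inj₁ p∣p₀ with distinct (suc i) zero (prime∣prime (primes (suc i)) (primes zero) p∣p₀)
  ...   | ()

  other∣cofactor : ∀ {g} (p : Fin g → ℕ) {i l} → l ≢ i → p l ∣ cofactor p i
  other∣cofactor p {zero}  {zero}  l≢i = contradiction refl l≢i
  other∣cofactor p {zero}  {suc l} l≢i = p∣prodPrimes (p ∘ suc) l
  other∣cofactor p {suc i} {zero}  l≢i = m∣m*n _
  other∣cofactor p {suc i} {suc l} l≢i = ∣n⇒∣m*n (p zero) (other∣cofactor (p ∘ suc) (l≢i ∘ cong suc))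

  -- Induction on the primes: if p₀ does not divide d, then d divides the product of the others;
  -- otherwise d = c p₀ with c dividing that product, so that p₀ cannot divide c again.
  squarefree-∣ : ∀ {g} (p : Fin g → ℕ) → Distinct p → (∀ i → Prime (p i)) → ∀ {d e} →
                 d ∣ prodPrimes p → (∀ i → p i ∣ d → p i ∣ e) → d ∣ e
  squarefree-∣ {zero}  p distinct primes {d} {e} d∣1 sub = subst (_∣ e) (sym (∣1⇒≡1 d∣1)) (1∣ e)
  squarefree-∣ {suc g} p distinct primes {d} {e} d∣n sub with p zero ∣? d
  ... | no p₀∤d = squarefree-∣ (p ∘ suc) (tail-distinct distinct) (primes ∘ suc)
        (coprime-divisor (Coprimality.sym (prime⇒coprime′ (primes zero) p₀∤d)) (subst (d ∣_) (prodPrimes-suc p) d∣n))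
        (sub ∘ suc)
  ... | yes p₀∣d@(divides c refl) = combine (squarefree-∣ (p ∘ suc) (tail-distinct distinct) (primes ∘ suc)
        c∣n′ (λ i pᵢ∣c → sub (suc i) (∣m⇒∣m*n (p zero) pᵢ∣c)))
    where
    instance _ = prime⇒nonZero (primes zero)
    c∣n′ : c ∣ prodPrimes (p ∘ suc)
    c∣n′ = *-cancelˡ-∣ (p zero) (subst (_∣ p zero * prodPrimes (p ∘ suc)) (ℕ.*-comm c (p zero))
      (subst (c * p zero ∣_) (prodPrimes-suc p) d∣n))
    p₀∤c : ¬ (p zero ∣ c)
    p₀∤c p₀∣c = p∤cofactor p distinct primes zero (∣-trans p₀∣c c∣n′)
    -- With e = k c, the prime p₀ divides k c but not c, hence divides k.
    combine : c ∣ e → c * p zero ∣ e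
    combine (divides k refl) = subst (_∣ k * c) (ℕ.*-comm (p zero) c) (*-monoˡ-∣ c
      (coprime-divisor (prime⇒coprime′ (primes zero) p₀∤c) (subst (p zero ∣_) (ℕ.*-comm k c) (sub zero p₀∣d))))

-- Finite fields: characteristic, exponent, and roots of products.

module FiniteFields where

  open RingTheory
  open import Data.Nat as ℕ using (ℕ; zero; suc; _<_; _≤_; _∸_; _!)
  import Data.Nat.Properties as ℕ
  open import Data.Nat.Divisibility using (divides; m≤n⇒m!∣n!; ∣-trans; m∣m*n)
  open import Data.Nat.Primality using (prime⇒nonZero)
  open import Data.Bool using (Bool)
  open import Data.Fin using (Fin; zero; suc; toℕ)
  open import Data.Fin.Properties using (toℕ<n; pigeonhole; suc-injective)
  import Data.Fin.Permutation as Perm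
  open import Data.List using (List; []; _∷_; map; foldr; tabulate; allFin)
  open import Data.List.Properties using (map-tabulate)
  open import Data.List.Membership.Propositional using (_∈_)
  open import Data.List.Relation.Unary.Any using (here; there)
  open import Data.Product using (_×_; _,_; ∃; proj₁; proj₂)
  open import Function.Base using (_∘_; id)
  open import Relation.Nullary using (¬_; yes; no; contradiction)
  open import Relation.Binary.PropositionalEquality as ≡ using (_≡_; _≢_)

  primePower>0 : ∀ {q} → IsPrimePower q → 0 < q
  primePower>0 (r , k , pr , _ , ≡.refl) = ℕ.m^n>0 r {{prime⇒nonZero pr}} k

  module FieldTheory (K : FiniteField) where
    open FiniteField K hiding (zero)
    open QR K
    open import Algebra.Properties.Ring ring using (+-cancelˡ)
    open import Algebra.Properties.Semiring.Exp semiring using (_^_; ^-homo-*; ^-assocʳ)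
    open import Algebra.Properties.CommutativeSemiring.Exp commutativeSemiring using (^-distrib-*)
    open import Algebra.Properties.Semiring.Mult semiring using (×1-homo-*; ×-congˡ; ×-homo-1)
      renaming (_×_ to _•_)
    open import Algebra.Properties.Semiring.Sum semiring
      using (sum; sum-cong-≋; sum-replicate-zero; sum-replicate; ∑-distrib-+; sum-permute)
    open import Algebra.Solver.Ring.NaturalCoefficients.Default commutativeSemiring
      using (solve; _:+_; _:*_; _:=_)
    open import Relation.Binary.Reasoning.Setoid setoid
    open Polynomials commRing public

    cancel : ∀ {x y z} → ¬ (x ≈ y) → x * z ≈ y * z → z ≈ 0#
    cancel {x} {y} {z} x≉y xz≈yz with z ≟ 0#
    ... | yes z≈0 = z≈0
    ... | no  z≉0 with inverse z z≉0
    ...   | w , zw≈1 = contradiction (begin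
            x            ≈⟨ *-identityʳ x ⟨
            x * 1#       ≈⟨ *-congˡ zw≈1 ⟨
            x * (z * w)  ≈⟨ *-assoc x z w ⟨
            x * z * w    ≈⟨ *-congʳ xz≈yz ⟩
            y * z * w    ≈⟨ *-assoc y z w ⟩
            y * (z * w)  ≈⟨ *-congˡ zw≈1 ⟩
            y * 1#       ≈⟨ *-identityʳ y ⟩
            y            ∎) x≉y

    open RootBound cancel public

    zero-factor : ∀ {x y} → x * y ≈ 0# → ¬ (x ≈ 0#) → y ≈ 0#
    zero-factor xy≈0 x≉0 = cancel x≉0 (trans xy≈0 (sym (zeroˡ _)))

    pow≡^ : ∀ x k → pow x k ≡ x ^ k
    pow≡^ x zero    = ≡.refl
    pow≡^ x (suc k) = ≡.cong (x *_) (pow≡^ x k)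

    pow-cong : ∀ {x y} k → x ≈ y → pow x k ≈ pow y k
    pow-cong zero    x≈y = refl
    pow-cong (suc k) x≈y = *-cong x≈y (pow-cong k x≈y)

    pow-+ : ∀ x j k → pow x (j ℕ.+ k) ≈ pow x j * pow x k
    pow-+ x j k rewrite pow≡^ x (j ℕ.+ k) | pow≡^ x j | pow≡^ x k = ^-homo-* x j k

    pow-* : ∀ x j k → pow (pow x j) k ≈ pow x (j ℕ.* k)
    pow-* x j k rewrite pow≡^ x j | pow≡^ (x ^ j) k | pow≡^ x (j ℕ.* k) = ^-assocʳ x j k

    pow-distrib : ∀ x y k → pow (x * y) k ≈ pow x k * pow y k
    pow-distrib x y k rewrite pow≡^ (x * y) k | pow≡^ x k | pow≡^ y k = ^-distrib-* x y k

    pow-1 : ∀ k → pow 1# k ≈ 1#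
    pow-1 zero    = refl
    pow-1 (suc k) = trans (*-identityˡ _) (pow-1 k)

    pow-≉0 : ∀ {x} k → ¬ (x ≈ 0#) → ¬ (pow x k ≈ 0#)
    pow-≉0 zero    x≉0 eq = 1≉0 eq
    pow-≉0 (suc k) x≉0 eq = pow-≉0 k x≉0 (zero-factor eq x≉0)

    sumK-allFin : ∀ {n} (f : Fin n → Carrier) → sumK (map f (allFin n)) ≡ sum f
    sumK-allFin f = ≡.trans (≡.cong sumK (map-tabulate id f)) (sumK-tabulate f)
      where
      sumK-tabulate : ∀ {n} (f : Fin n → Carrier) → sumK (tabulate f) ≡ sum f
      sumK-tabulate {zero}  f = ≡.refl
      sumK-tabulate {suc n} f = ≡.cong (f zero +_) (sumK-tabulate (f ∘ suc))

    sum-zero : ∀ {n} (f : Fin n → Carrier) → (∀ i → f i ≈ 0#) → sum f ≈ 0#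
    sum-zero {n} f f≈0 = trans (sum-cong-≋ {n} {f} {λ _ → 0#} f≈0) (sum-replicate-zero n)

    sum-single : ∀ {n} (f : Fin n → Carrier) i → (∀ j → j ≢ i → f j ≈ 0#) → sum f ≈ f i
    sum-single f zero off = trans
      (+-congˡ (sum-zero (f ∘ suc) (λ j → off (suc j) λ ()))) (+-identityʳ _)
    sum-single f (suc i) off = trans
      (+-cong (off zero λ ()) (sum-single (f ∘ suc) i (λ j j≢i → off (suc j) (j≢i ∘ suc-injective)))) (+-identityˡ _)

    private
      index : Carrier → Fin size
      index x = proj₁ (enum-sur x)

      enum-index : ∀ x → enum (index x) ≈ x
      enum-index x = proj₂ (enum-sur x)

      index-enum : ∀ {x} i → x ≈ enum i → index x ≡ i
      index-enum i x≈ = enum-inj _ _ (trans (enum-index _) x≈)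

    -- Translation by 1 permutes K, so the sum of all elements equals itself plus size • 1.
    size•1≈0 : size • 1# ≈ 0#
    size•1≈0 = +-cancelˡ (sum enum) _ _ (begin
      sum enum + size • 1#               ≈⟨ +-congˡ (sum-replicate size) ⟨
      sum enum + sum (λ (_ : Fin size) → 1#)  ≈⟨ ∑-distrib-+ enum (λ _ → 1#) ⟨
      sum (λ i → enum i + 1#)            ≈⟨ sum-cong-≋ (λ i → enum-index (enum i + 1#)) ⟨
      sum (λ i → enum (index (enum i + 1#)))  ≈⟨ sum-permute enum translate ⟨
      sum enum                           ≈⟨ +-identityʳ _ ⟨
      sum enum + 0#                      ∎)
      where
      translate : Perm.Permutation size size
      translate = Perm.permutation (λ i → index (enum i + 1#)) (λ i → index (enum i + - 1#))
        (λ i → index-enum i (begin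
          enum (index (enum i + - 1#)) + 1#  ≈⟨ +-congʳ (enum-index _) ⟩
          enum i + - 1# + 1#                 ≈⟨ +-assoc _ _ _ ⟩
          enum i + (- 1# + 1#)               ≈⟨ +-congˡ (-‿inverseˡ 1#) ⟩
          enum i + 0#                        ≈⟨ +-identityʳ _ ⟩
          enum i                             ∎))
        (λ i → index-enum i (begin
          enum (index (enum i + 1#)) + - 1#  ≈⟨ +-congʳ (enum-index _) ⟩
          enum i + 1# + - 1#                 ≈⟨ +-assoc _ _ _ ⟩
          enum i + (1# + - 1#)               ≈⟨ +-congˡ (-‿inverseʳ 1#) ⟩
          enum i + 0#                        ≈⟨ +-identityʳ _ ⟩
          enum i                             ∎))

    -- The multiple p^k of 1 is 0 and factors into k copies of p · 1; without zero divisors one copy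
    -- is 0.
    characteristic : ∀ {p} k → size ≡ p ℕ.^ k → p • 1# ≈ 0#
    characteristic {p} k size≡ = descend k (trans (sym (×-congˡ {1#} size≡)) size•1≈0)
      where
      descend : ∀ k → (p ℕ.^ k) • 1# ≈ 0# → p • 1# ≈ 0#
      descend zero    eq = contradiction (trans (sym (×-homo-1 1#)) eq) 1≉0
      descend (suc k) eq with (p • 1#) ≟ 0#
      ... | yes p≈0 = p≈0
      ... | no  p≉0 = descend k (zero-factor (trans (sym (×1-homo-* p (p ℕ.^ k))) eq) p≉0)

    -- With q = r^k the field has r^(kN) elements, hence characteristic r, and x^q is the r-th power
    -- iterated k times. This closes F_q, the set where x^q = x, under addition.
    frobenius : ∀ {q} → IsPrimePower q → ∀ N → size ≡ q ℕ.^ N → ∀ x y → pow (x + y) q ≈ pow x q + pow y q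
    frobenius (r , k , pr , _ , ≡.refl) N size≡ x y
      rewrite pow≡^ (x + y) (r ℕ.^ k) | pow≡^ x (r ℕ.^ k) | pow≡^ y (r ℕ.^ k) =
      Frobenius.freshman-iterated commRing pr
        (characteristic (k ℕ.* N) (≡.trans size≡ (ℕ.^-*-assoc r k N))) k x y

    -- Among the powers x⁰, …, x^size two coincide, so the order of x is at most size.
    exponent : ∃ λ M → ∀ {x} → ¬ (x ≈ 0#) → pow x (suc M) ≈ 1#
    exponent = ℕ.pred (size !) , λ {x} x≉0 →
      ≡.subst (λ k → pow x k ≈ 1#) (≡.sym (ℕ.suc-pred (size !) {{size ℕ.!≢0}})) (pow-size! x≉0)
      where
      -- The factorial is a common multiple of all numbers from 1 to `size`, so one exponent serves
      -- every x without Lagrange's theorem.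
      pow-size! : ∀ {x} → ¬ (x ≈ 0#) → pow x (size !) ≈ 1#
      pow-size! {x} x≉0 with pigeonhole (ℕ.n<1+n size) (λ i → index (pow x (toℕ i)))
      ... | i , j , i<j , same = order≤size d d≤size x^d≈1
        where
        d = toℕ j ∸ toℕ i
        i+d≡j : toℕ i ℕ.+ d ≡ toℕ j
        i+d≡j = ℕ.m+[n∸m]≡n (ℕ.<⇒≤ i<j)
        d≤size : 0 < d × d ≤ size
        d≤size = ℕ.m<n⇒0<n∸m i<j , ℕ.≤-trans (ℕ.m∸n≤m (toℕ j) (toℕ i)) (ℕ.≤-pred (toℕ<n j))
        x^i≈x^j : pow x (toℕ i) ≈ pow x (toℕ j)
        x^i≈x^j = trans (sym (enum-index _)) (trans (reflexive (≡.cong enum same)) (enum-index _))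
        x^d≈1 : pow x d ≈ 1#
        x^d≈1 with 1# ≟ pow x d
        ... | yes eq = sym eq
        ... | no neq = contradiction (cancel neq (begin
              1# * pow x (toℕ i)       ≈⟨ *-identityˡ _ ⟩
              pow x (toℕ i)            ≈⟨ x^i≈x^j ⟩
              pow x (toℕ j)            ≈⟨ reflexive (≡.cong (pow x) i+d≡j) ⟨
              pow x (toℕ i ℕ.+ d)      ≈⟨ pow-+ x (toℕ i) d ⟩
              pow x (toℕ i) * pow x d  ≈⟨ *-comm _ _ ⟩
              pow x d * pow x (toℕ i)  ∎)) (pow-≉0 (toℕ i) x≉0)
        order≤size : ∀ d → 0 < d × d ≤ size → pow x d ≈ 1# → pow x (size !) ≈ 1#
        order≤size (suc d) (_ , d≤) x^d≈1 with ∣-trans (m∣m*n {suc d} (d !)) (m≤n⇒m!∣n! d≤)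
        ... | divides k eq = begin
            pow x (size !)          ≈⟨ reflexive (≡.cong (pow x) (≡.trans eq (ℕ.*-comm k (suc d)))) ⟩
            pow x (suc d ℕ.* k)     ≈⟨ pow-* x (suc d) k ⟨
            pow (pow x (suc d)) k   ≈⟨ pow-cong k x^d≈1 ⟩
            pow 1# k                ≈⟨ pow-1 k ⟩
            1#                      ∎

    eval-addP : ∀ z xs ys → eval z (addP xs ys) ≈ eval z xs + eval z ys
    eval-addP z []       ys = sym (+-identityˡ _)
    eval-addP z (x ∷ xs) [] = sym (+-identityʳ _)
    eval-addP z (x ∷ xs) (y ∷ ys) = begin
      (x + y) + z * eval z (addP xs ys)            ≈⟨ +-congˡ (*-congˡ (eval-addP z xs ys)) ⟩
      (x + y) + z * (eval z xs + eval z ys)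
        ≈⟨ solve 5 (λ x y z a b → (x :+ y) :+ z :* (a :+ b) := (x :+ z :* a) :+ (y :+ z :* b)) refl x y z (eval z xs) (eval z ys) ⟩
      (x + z * eval z xs) + (y + z * eval z ys)    ∎

    eval-scale : ∀ z c xs → eval z (scale c xs) ≈ c * eval z xs
    eval-scale z c []       = sym (zeroʳ c)
    eval-scale z c (x ∷ xs) = begin
      c * x + z * eval z (scale c xs)  ≈⟨ +-congˡ (*-congˡ (eval-scale z c xs)) ⟩
      c * x + z * (c * eval z xs)
        ≈⟨ solve 4 (λ c x z a → c :* x :+ z :* (c :* a) := c :* (x :+ z :* a)) refl c x z (eval z xs) ⟩
      c * (x + z * eval z xs)          ∎

    eval-mulP : ∀ z xs ys → eval z (mulP xs ys) ≈ eval z xs * eval z ys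
    eval-mulP z []       ys = sym (zeroˡ _)
    eval-mulP z (x ∷ xs) ys = begin
      eval z (addP (scale x ys) (0# ∷ mulP xs ys))          ≈⟨ eval-addP z (scale x ys) (0# ∷ mulP xs ys) ⟩
      eval z (scale x ys) + (0# + z * eval z (mulP xs ys))
        ≈⟨ +-cong (eval-scale z x ys) (trans (+-identityˡ _) (*-congˡ (eval-mulP z xs ys))) ⟩
      x * eval z ys + z * (eval z xs * eval z ys)           ≈⟨ +-congˡ (*-assoc z _ _) ⟨
      x * eval z ys + z * eval z xs * eval z ys             ≈⟨ distribʳ _ _ _ ⟨
      (x + z * eval z xs) * eval z ys                       ∎

    -- By definition `generator p θ ch` is this product at `zeroSet p ch`; the free list makes
    -- induction possible.
    rootProduct : Carrier → List ℕ → Poly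
    rootProduct θ = foldr (λ t acc → mulP (- pow θ t ∷ 1# ∷ []) acc) (1# ∷ [])

    private
      eval-linear : ∀ z x → eval z (- x ∷ 1# ∷ []) ≈ - x + z
      eval-linear z x = +-congˡ (trans (*-congˡ (trans (+-congˡ (zeroʳ z)) (+-identityʳ 1#))) (*-identityʳ z))

      linear-root : ∀ {z x} → z ≈ x → - x + z ≈ 0#
      linear-root z≈x = trans (+-congˡ z≈x) (-‿inverseˡ _)

      linear-root⁻ : ∀ {z x} → - x + z ≈ 0# → z ≈ x
      linear-root⁻ {z} {x} eq = +-cancelˡ (- x) _ _ (trans eq (sym (-‿inverseˡ x)))

    rootProduct-root : ∀ θ z ts {t} → t ∈ ts → z ≈ pow θ t → eval z (rootProduct θ ts) ≈ 0#
    rootProduct-root θ z (t ∷ ts) t∈ z≈ = trans (eval-mulP z (- pow θ t ∷ 1# ∷ []) (rootProduct θ ts)) (vanish t∈)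
      where
      vanish : _ ∈ t ∷ ts → eval z (- pow θ t ∷ 1# ∷ []) * eval z (rootProduct θ ts) ≈ 0#
      vanish (here ≡.refl) = trans (*-congʳ (trans (eval-linear z _) (linear-root z≈))) (zeroˡ _)
      vanish (there t∈ts) = trans (*-congˡ (rootProduct-root θ z ts t∈ts z≈)) (zeroʳ _)

    rootProduct-root⁻ : ∀ θ z ts → eval z (rootProduct θ ts) ≈ 0# → ∃ λ t → t ∈ ts × z ≈ pow θ t
    rootProduct-root⁻ θ z [] eq =
      contradiction (trans (sym (trans (+-congˡ (zeroʳ z)) (+-identityʳ 1#))) eq) 1≉0
    rootProduct-root⁻ θ z (t ∷ ts) eq with (- pow θ t + z) ≟ 0#
    ... | yes root = t , here ≡.refl , linear-root⁻ root
    ... | no ¬root with rootProduct-root⁻ θ z ts (zero-factor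
          (trans (sym (eval-mulP z (- pow θ t ∷ 1# ∷ []) (rootProduct θ ts))) eq)
          (¬root ∘ trans (sym (eval-linear z (pow θ t)))))
    ...   | s , s∈ts , z≈ = s , there s∈ts , z≈

-- Cyclic products, reversal and the spectrum of a word.

module Spectra where

  open FiniteFields
  open Divisors using (mod<n; ≡ᵇ-true; ≡ᵇ-false)
  open import Data.Nat as ℕ using (ℕ; zero; suc; _<_; _≤_; z≤n; s≤s; _∸_)
  import Data.Nat.Properties as ℕ
  open import Data.Nat.DivMod using (m≡m%n+[m/n]*n; m<n⇒m%n≡m; [m+n]%n≡m%n)
  open import Data.Bool using (Bool; if_then_else_)
  open import Data.Fin using (Fin; zero; suc; toℕ; fromℕ<; opposite)
  open import Data.Fin.Properties using (toℕ<n; toℕ-fromℕ<; toℕ-injective; opposite-prop; opposite-involutive)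
  import Data.Fin.Permutation as Perm
  open import Data.List using (List; []; _∷_; length; applyUpTo; map; tabulate; zip)
  open import Data.List.Properties using (length-applyUpTo; length-tabulate)
  open import Data.List.Relation.Unary.All as All using (All; []; _∷_)
  import Data.List.Relation.Unary.All.Properties as All
  import Data.List.Relation.Unary.AllPairs.Properties as AllPairs
  open import Data.Product using (_×_; _,_; proj₁; proj₂)
  open import Function.Base using (_∘_; id)
  open import Relation.Binary.Definitions using (tri<; tri≈; tri>)
  open import Relation.Nullary using (¬_; yes; no; contradiction)
  open import Relation.Binary.PropositionalEquality as ≡ using (_≡_; _≢_)

  module CyclicCodes (K : FiniteField) {n : ℕ} (0<n : 0 < n) where
    open FiniteField K hiding (zero)
    open QR K
    open FieldTheory K
    open import Algebra.Properties.Semiring.Sum semiring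
      using (sum; sum-cong-≋; ∑-distrib-+; sum-permute; ∑-comm; *-distribˡ-sum; *-distribʳ-sum)
    open import Algebra.Properties.CommutativeSemigroup *-commutativeSemigroup using (interchange)
    open import Relation.Binary.Reasoning.Setoid setoid

    ev : Carrier → Word n → Carrier
    ev z w = sum (λ i → w i * pow z (toℕ i))

    ev-cong : ∀ z {v w : Word n} → (∀ i → v i ≈ w i) → ev z v ≈ ev z w
    ev-cong z v≈w = sum-cong-≋ {n} (λ i → *-congʳ (v≈w i))

    ev-+ : ∀ z (v w : Word n) → ev z (λ i → v i + w i) ≈ ev z v + ev z w
    ev-+ z v w = trans (sum-cong-≋ {n} (λ i → distribʳ _ _ _)) (∑-distrib-+ (λ i → v i * pow z (toℕ i)) (λ i → w i * pow z (toℕ i)))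

    eval-tabulate : ∀ z {m} (w : Fin m → Carrier) → eval z (tabulate w) ≈ sum (λ i → w i * pow z (toℕ i))
    eval-tabulate z {zero}  w = refl
    eval-tabulate z {suc m} w = +-cong (sym (*-identityʳ _)) (begin
      z * eval z (tabulate (w ∘ suc))                        ≈⟨ *-congˡ (eval-tabulate z (w ∘ suc)) ⟩
      z * sum (λ i → w (suc i) * pow z (toℕ i))              ≈⟨ *-distribˡ-sum z (λ i → w (suc i) * pow z (toℕ i)) ⟩
      sum (λ i → z * (w (suc i) * pow z (toℕ i)))            ≈⟨ sum-cong-≋ {m} (λ i →
        trans (sym (*-assoc _ _ _)) (trans (*-congʳ (*-comm _ _)) (*-assoc _ _ _))) ⟩
      sum (λ i → w (suc i) * (z * pow z (toℕ i)))            ∎)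

    pow-mod : ∀ {z} → pow z n ≈ 1# → ∀ k → pow z (k mod n) ≈ pow z k
    pow-mod {z} z^n≈1 k = go n 0<n z^n≈1
      where
      go : ∀ n → 0 < n → pow z n ≈ 1# → pow z (k mod n) ≈ pow z k
      go n@(suc _) _ z^n≈1 = sym (begin
        pow z k                                      ≈⟨ reflexive (≡.cong (pow z) (m≡m%n+[m/n]*n k n)) ⟩
        pow z (k ℕ.% n ℕ.+ k ℕ./ n ℕ.* n)            ≈⟨ pow-+ z (k ℕ.% n) _ ⟩
        pow z (k ℕ.% n) * pow z (k ℕ./ n ℕ.* n)      ≈⟨ *-congˡ (reflexive (≡.cong (pow z) (ℕ.*-comm (k ℕ./ n) n))) ⟩
        pow z (k ℕ.% n) * pow z (n ℕ.* (k ℕ./ n))    ≈⟨ *-congˡ (pow-* z n (k ℕ./ n)) ⟨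
        pow z (k ℕ.% n) * pow (pow z n) (k ℕ./ n)    ≈⟨ *-congˡ (trans (pow-cong (k ℕ./ n) z^n≈1) (pow-1 (k ℕ./ n))) ⟩
        pow z (k ℕ.% n) * 1#                         ≈⟨ *-identityʳ _ ⟩
        pow z (k ℕ.% n)                              ∎)

    private
      term : Word n → Fin n → Fin n → ℕ × Carrier → Carrier
      term a k i jc = if ((toℕ i ℕ.+ proj₁ jc) mod n) ℕ.≡ᵇ toℕ k then a i * proj₂ jc else 0#

      -- The inner sum of `cycMul` for an arbitrary list of indexed coefficients, since `indexed gp`
      -- itself does not decompose along `gp`.
      terms : Word n → List (ℕ × Carrier) → Fin n → Fin n → Carrier
      terms a jcs k i = sumK (map (term a k i) jcs)

      cycMul-sum : ∀ a gp k → cycMul a gp k ≈ sum (terms a (indexed gp) k)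
      cycMul-sum a gp k = reflexive (sumK-allFin (terms a (indexed gp) k))

      evalIndexed : Carrier → List (ℕ × Carrier) → Carrier
      evalIndexed z jcs = sumK (map (λ jc → proj₂ jc * pow z (proj₁ jc)) jcs)

      -- In the recursion the indices of a suffix start at some k instead of 0, and `u` carries the
      -- accumulated factor z^k.
      evalIndexed-zip : ∀ z u (h : ℕ → ℕ) cs → (∀ j → pow z (h j) ≈ u * pow z j) →
        evalIndexed z (zip (applyUpTo h (length cs)) cs) ≈ u * eval z cs
      evalIndexed-zip z u h []       shift = sym (zeroʳ u)
      evalIndexed-zip z u h (c ∷ cs) shift = begin
        c * pow z (h 0) + evalIndexed z (zip (applyUpTo (h ∘ suc) (length cs)) cs)
          ≈⟨ +-cong (trans (*-congˡ (trans (shift 0) (*-identityʳ u))) (*-comm c u))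
                    (evalIndexed-zip z (u * z) (h ∘ suc) cs (λ j → trans (shift (suc j)) (sym (*-assoc u z _)))) ⟩
        u * c + u * z * eval z cs    ≈⟨ +-congˡ (*-assoc u z _) ⟩
        u * c + u * (z * eval z cs)  ≈⟨ distribˡ u _ _ ⟨
        u * (c + z * eval z cs)      ∎

      evalIndexed-indexed : ∀ z cs → evalIndexed z (indexed cs) ≈ eval z cs
      evalIndexed-indexed z cs =
        trans (evalIndexed-zip z 1# id cs (λ j → sym (*-identityˡ _))) (*-identityˡ _)

      -- Only the position (i + j) mod n receives this product, and z^n = 1 allows the exponent to
      -- be replaced by i + j.
      term-sum : ∀ {z} → pow z n ≈ 1# → ∀ a i jc →
        sum (λ k → term a k i jc * pow z (toℕ k)) ≈ a i * pow z (toℕ i) * (proj₂ jc * pow z (proj₁ jc))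
      term-sum {z} z^n≈1 a i (j , c) = begin
        sum f                                  ≈⟨ sum-single f k₀ off ⟩
        term a k₀ i (j , c) * pow z (toℕ k₀)   ≈⟨ *-cong at (reflexive (≡.cong (pow z) (toℕ-fromℕ< k₀<n))) ⟩
        a i * c * pow z ((toℕ i ℕ.+ j) mod n)  ≈⟨ *-congˡ (trans (pow-mod z^n≈1 _) (pow-+ z (toℕ i) j)) ⟩
        a i * c * (pow z (toℕ i) * pow z j)    ≈⟨ interchange _ _ _ _ ⟩
        a i * pow z (toℕ i) * (c * pow z j)    ∎
        where
        f = λ k → term a k i (j , c) * pow z (toℕ k)
        k₀<n = mod<n 0<n (toℕ i ℕ.+ j)
        k₀ = fromℕ< k₀<n
        at : term a k₀ i (j , c) ≈ a i * c
        at rewrite ≡ᵇ-true (≡.sym (toℕ-fromℕ< k₀<n)) = refl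
        off : ∀ k → k ≢ k₀ → f k ≈ 0#
        off k k≢k₀ rewrite ≡ᵇ-false {(toℕ i ℕ.+ j) mod n} {toℕ k}
          (λ eq → k≢k₀ (toℕ-injective (≡.trans (≡.sym eq) (≡.sym (toℕ-fromℕ< k₀<n))))) = zeroˡ _

      terms-sum : ∀ {z} → pow z n ≈ 1# → ∀ a i jcs →
        sum (λ k → terms a jcs k i * pow z (toℕ k)) ≈ a i * pow z (toℕ i) * evalIndexed z jcs
      terms-sum {z} z^n≈1 a i [] =
        trans (sum-zero {n} (λ k → 0# * pow z (toℕ k)) (λ k → zeroˡ _)) (sym (zeroʳ _))
      terms-sum {z} z^n≈1 a i (jc ∷ jcs) = begin
        sum (λ k → (term a k i jc + terms a jcs k i) * pow z (toℕ k))
          ≈⟨ sum-cong-≋ {n} (λ k → distribʳ _ _ _) ⟩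
        sum (λ k → term a k i jc * pow z (toℕ k) + terms a jcs k i * pow z (toℕ k))
          ≈⟨ ∑-distrib-+ (λ k → term a k i jc * pow z (toℕ k)) (λ k → terms a jcs k i * pow z (toℕ k)) ⟩
        sum (λ k → term a k i jc * pow z (toℕ k)) + sum (λ k → terms a jcs k i * pow z (toℕ k))
          ≈⟨ +-cong (term-sum z^n≈1 a i jc) (terms-sum z^n≈1 a i jcs) ⟩
        a i * pow z (toℕ i) * (proj₂ jc * pow z (proj₁ jc)) + a i * pow z (toℕ i) * evalIndexed z jcs
          ≈⟨ distribˡ _ _ _ ⟨
        a i * pow z (toℕ i) * evalIndexed z (jc ∷ jcs) ∎

    -- Evaluation at an n-th root of unity factors through reduction modulo x^n - 1; exchanging the
    -- sums over k and i reduces this to one entry of a at a time.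
    ev-cycMul : ∀ {z} → pow z n ≈ 1# → ∀ a gp → ev z (cycMul a gp) ≈ ev z a * eval z gp
    ev-cycMul {z} z^n≈1 a gp = begin
      ev z (cycMul a gp)
        ≈⟨ sum-cong-≋ {n} (λ k → trans (*-congʳ (cycMul-sum a gp k)) (*-distribʳ-sum (pow z (toℕ k)) (terms a (indexed gp) k))) ⟩
      sum (λ k → sum (λ i → terms a (indexed gp) k i * pow z (toℕ k)))
        ≈⟨ ∑-comm (λ k i → terms a (indexed gp) k i * pow z (toℕ k)) ⟩
      sum (λ i → sum (λ k → terms a (indexed gp) k i * pow z (toℕ k)))
        ≈⟨ sum-cong-≋ {n} (λ i → terms-sum z^n≈1 a i (indexed gp)) ⟩
      sum (λ i → a i * pow z (toℕ i) * evalIndexed z (indexed gp))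
        ≈⟨ *-distribʳ-sum _ (λ i → a i * pow z (toℕ i)) ⟨
      ev z a * evalIndexed z (indexed gp)  ≈⟨ *-congˡ (evalIndexed-indexed z gp) ⟩
      ev z a * eval z gp                   ∎

    rev : Word n → Word n
    rev w i = w (opposite i)

    private
      sum-opposite : (f : Fin n → Carrier) → sum f ≈ sum (f ∘ opposite)
      sum-opposite f = sum-permute f Perm.reverse

      toℕ-opposite : ∀ i → suc (toℕ (opposite i) ℕ.+ toℕ i) ≡ n
      toℕ-opposite i = ≡.trans (≡.cong (λ k → suc (k ℕ.+ toℕ i)) (opposite-prop i))
        (≡.trans (≡.sym (ℕ.+-suc (n ∸ suc (toℕ i)) (toℕ i))) (ℕ.m∸n+n≡m (toℕ<n i)))

    -- `rev w` is x^(n - 1) w(1 / x). At z its value is z^(n - 1) w(z′), and the extra factor z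
    -- completes z^n = 1.
    ev-rev : ∀ {z z′} → pow z n ≈ 1# → z * z′ ≈ 1# → ∀ w → ev z (rev w) * z ≈ ev z′ w
    ev-rev {z} {z′} z^n≈1 zz′≈1 w = begin
      ev z (rev w) * z                                    ≈⟨ *-congʳ (sum-opposite _) ⟩
      sum (λ i → rev w (opposite i) * pow z (toℕ (opposite i))) * z
        ≈⟨ *-distribʳ-sum z (λ i → rev w (opposite i) * pow z (toℕ (opposite i))) ⟩
      sum (λ i → rev w (opposite i) * pow z (toℕ (opposite i)) * z)
        ≈⟨ sum-cong-≋ {n} (λ i → trans (*-assoc _ _ _)
             (*-cong (reflexive (≡.cong w (opposite-involutive i))) (inverse-power i))) ⟩
      ev z′ w ∎
      where
      inverse-power : ∀ i → pow z (toℕ (opposite i)) * z ≈ pow z′ (toℕ i)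
      inverse-power i = begin
        pow z j * z                                ≈⟨ *-identityʳ _ ⟨
        pow z j * z * 1#                           ≈⟨ *-congˡ (trans (pow-cong (toℕ i) zz′≈1) (pow-1 (toℕ i))) ⟨
        pow z j * z * pow (z * z′) (toℕ i)         ≈⟨ *-congˡ (pow-distrib z z′ (toℕ i)) ⟩
        pow z j * z * (pow z (toℕ i) * pow z′ (toℕ i))  ≈⟨ *-assoc _ _ _ ⟨
        pow z j * z * pow z (toℕ i) * pow z′ (toℕ i)    ≈⟨ *-congʳ full ⟩
        1# * pow z′ (toℕ i)                        ≈⟨ *-identityˡ _ ⟩
        pow z′ (toℕ i)                             ∎
        where
        j = toℕ (opposite i)
        full : pow z j * z * pow z (toℕ i) ≈ 1#
        full = begin
          pow z j * z * pow z (toℕ i)    ≈⟨ *-congʳ (*-comm _ _) ⟩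
          pow z (suc j) * pow z (toℕ i)  ≈⟨ pow-+ z (suc j) (toℕ i) ⟨
          pow z (suc j ℕ.+ toℕ i)        ≈⟨ reflexive (≡.cong (pow z) (toℕ-opposite i)) ⟩
          pow z n                        ≈⟨ z^n≈1 ⟩
          1#                             ∎

    dot-sum : ∀ (v w : Word n) → dot v w ≈ sum (λ i → v i * w i)
    dot-sum v w = reflexive (sumK-allFin (λ i → v i * w i))

    private
      last : Fin n
      last = fromℕ< {n ∸ 1} (ℕ.∸-monoʳ-< {n} (s≤s z≤n) 0<n)

      toℕ-last : suc (toℕ last) ≡ n
      toℕ-last = ≡.trans (≡.cong suc (toℕ-fromℕ< _)) (ℕ.suc-pred n {{ℕ.>-nonZero 0<n}})

      sumK-zip-tabulate : ∀ (F : ℕ × Carrier → Carrier) (h : ℕ → ℕ) {m} (w : Fin m → Carrier) →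
        sumK (map F (zip (applyUpTo h (length (tabulate w))) (tabulate w))) ≡ sum (λ j → F (h (toℕ j) , w j))
      sumK-zip-tabulate F h {zero}  w = ≡.refl
      sumK-zip-tabulate F h {suc m} w = ≡.cong (F (h 0 , w zero) +_) (sumK-zip-tabulate F (h ∘ suc) (w ∘ suc))

      mod-small : ∀ {k m} → 0 < m → k < m → k mod m ≡ k
      mod-small {m = suc _} _ k<m = m<n⇒m%n≡m k<m

      mod-large : ∀ k {m} → 0 < m → (k ℕ.+ m) mod m ≡ k mod m
      mod-large k {suc m} _ = [m+n]%n≡m%n k (suc m)

      -- For i, j < n the residue of i + j is n − 1 only if i + j = n − 1, since i + j < 2n − 1.
      wrap : ∀ (i j : Fin n) → (toℕ i ℕ.+ toℕ j) mod n ≡ toℕ last → j ≡ opposite i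
      wrap i j eq with toℕ i ℕ.+ toℕ j ℕ.<? n
      ... | yes small = toℕ-injective (ℕ.+-cancelʳ-≡ (toℕ i) _ _ (ℕ.suc-injective
            (≡.trans (≡.cong suc (ℕ.+-comm (toℕ j) (toℕ i)))
            (≡.trans (≡.cong suc (≡.trans (≡.sym (mod-small 0<n small)) eq))
            (≡.trans toℕ-last (≡.sym (toℕ-opposite i)))))))
      ... | no large = contradiction too-big (ℕ.<⇒≱ (toℕ<n j))
        where
        l = toℕ i ℕ.+ toℕ j ∸ n
        l+n : l ℕ.+ n ≡ toℕ i ℕ.+ toℕ j
        l+n = ℕ.m∸n+n≡m (ℕ.≮⇒≥ large)
        l<n : l < n
        l<n = ℕ.+-cancelʳ-< n l n (≡.subst (_< n ℕ.+ n) (≡.sym l+n) (ℕ.+-mono-< (toℕ<n i) (toℕ<n j)))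
        l≡last : suc l ≡ n
        l≡last = ≡.trans (≡.cong suc (≡.trans (≡.sym (mod-small 0<n l<n)) (≡.trans (≡.sym (mod-large l 0<n))
          (≡.trans (≡.cong (_mod n) l+n) eq)))) toℕ-last
        too-big : n ≤ toℕ j
        too-big = ℕ.+-cancelˡ-≤ (suc l) n (toℕ j) (≡.subst (_≤ suc l ℕ.+ toℕ j) (≡.cong suc (≡.sym l+n))
          (ℕ.+-monoˡ-≤ (toℕ j) (≡.subst (toℕ i <_) (≡.sym l≡last) (toℕ<n i))))

      -- Coefficient n - 1 collects the products with i + j = n - 1, that is with j = `opposite i`.
      -- This turns inner products into cyclic products.
      cycMul-last : ∀ x c → cycMul x (tabulate c) last ≈ dot (rev x) c
      cycMul-last x c = begin
        cycMul x (tabulate c) last                        ≈⟨ cycMul-sum x (tabulate c) last ⟩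
        sum (terms x (indexed (tabulate c)) last)         ≈⟨ sum-cong-≋ {n} inner ⟩
        sum (λ i → x i * c (opposite i))                  ≈⟨ sum-opposite _ ⟩
        sum (λ i → x (opposite i) * c (opposite (opposite i)))
          ≈⟨ sum-cong-≋ {n} (λ i → *-congˡ (reflexive (≡.cong c (opposite-involutive i)))) ⟩
        sum (λ i → rev x i * c i)                         ≈⟨ dot-sum (rev x) c ⟨
        dot (rev x) c                                     ∎
        where
        inner : ∀ i → terms x (indexed (tabulate c)) last i ≈ x i * c (opposite i)
        inner i = begin
          terms x (indexed (tabulate c)) last i
            ≈⟨ reflexive (sumK-zip-tabulate (term x last i) id c) ⟩
          sum (λ j → term x last i (toℕ j , c j))
            ≈⟨ sum-single (λ j → term x last i (toℕ j , c j)) (opposite i) off ⟩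
          term x last i (toℕ (opposite i) , c (opposite i))  ≈⟨ at ⟩
          x i * c (opposite i) ∎
          where
          i+opp : toℕ i ℕ.+ toℕ (opposite i) ≡ toℕ last
          i+opp = ≡.trans (ℕ.+-comm (toℕ i) _) (ℕ.suc-injective (≡.trans (toℕ-opposite i) (≡.sym toℕ-last)))
          at : term x last i (toℕ (opposite i) , c (opposite i)) ≈ x i * c (opposite i)
          at rewrite ≡ᵇ-true {(toℕ i ℕ.+ toℕ (opposite i)) mod n} {toℕ last}
            (≡.trans (≡.cong (_mod n) i+opp) (mod-small 0<n (toℕ<n last))) = refl
          off : ∀ j → j ≢ opposite i → term x last i (toℕ j , c j) ≈ 0#
          off j j≢ rewrite ≡ᵇ-false {(toℕ i ℕ.+ toℕ j) mod n} {toℕ last} (j≢ ∘ wrap i j) = refl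

    module PrimitiveRoot (θ : Carrier) (prim : IsPrimitiveRoot n θ) where

      θ≉0 : ¬ (θ ≈ 0#)
      θ≉0 θ≈0 = 1≉0 (trans (sym (proj₁ prim)) (go n 0<n))
        where
        go : ∀ n → 0 < n → pow θ n ≈ 0#
        go (suc n) _ = trans (*-congʳ θ≈0) (zeroˡ _)

      distinct-powers : ∀ {i j} → i < j → j < n → ¬ (pow θ i ≈ pow θ j)
      distinct-powers {i} {j} i<j j<n eq = pow-≉0 i θ≉0 (cancel (λ 1≈ → proj₂ prim (j ∸ i)
          (ℕ.m<n⇒0<n∸m i<j) (ℕ.≤-<-trans (ℕ.m∸n≤m j i) j<n) (sym 1≈)) (begin
        1# * pow θ i             ≈⟨ *-identityˡ _ ⟩
        pow θ i                  ≈⟨ eq ⟩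
        pow θ j                  ≈⟨ reflexive (≡.cong (pow θ) (ℕ.m∸n+n≡m (ℕ.<⇒≤ i<j))) ⟨
        pow θ ((j ∸ i) ℕ.+ i)    ≈⟨ pow-+ θ (j ∸ i) i ⟩
        pow θ (j ∸ i) * pow θ i  ∎))

      pow-injective : ∀ {i j} → i < n → j < n → pow θ i ≈ pow θ j → i ≡ j
      pow-injective {i} {j} i<n j<n eq with ℕ.<-cmp i j
      ... | tri< i<j _ _ = contradiction eq (distinct-powers i<j j<n)
      ... | tri≈ _ i≡j _ = i≡j
      ... | tri> _ _ j<i = contradiction (sym eq) (distinct-powers j<i i<n)

      unity : ∀ j → pow (pow θ j) n ≈ 1#
      unity j = begin
        pow (pow θ j) n  ≈⟨ pow-* θ j n ⟩
        pow θ (j ℕ.* n)  ≈⟨ reflexive (≡.cong (pow θ) (ℕ.*-comm j n)) ⟩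
        pow θ (n ℕ.* j)  ≈⟨ pow-* θ n j ⟨
        pow (pow θ n) j  ≈⟨ trans (pow-cong j (proj₁ prim)) (pow-1 j) ⟩
        1#               ∎

      _ˆ_ : Word n → ℕ → Carrier
      w ˆ j = ev (pow θ j) w

      private
        spectrum-zero : ∀ w → (∀ j → j < n → w ˆ j ≈ 0#) → ∀ i → w i ≈ 0#
        spectrum-zero w vanish i = All.tabulate⁻ (too-many-roots (tabulate w) (applyUpTo (pow θ) n)
          (≡.trans (length-applyUpTo (pow θ) n) (≡.sym (length-tabulate w)))
          (AllPairs.applyUpTo⁺₁ (pow θ) n distinct-powers)
          (All.applyUpTo⁺₁ (pow θ) n (λ {j} j<n → trans (eval-tabulate (pow θ j) w) (vanish j j<n)))) i

      spectrum-injective : ∀ v w → (∀ j → j < n → v ˆ j ≈ w ˆ j) → ∀ i → v i ≈ w i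
      spectrum-injective v w same i = begin
        v i                  ≈⟨ +-identityʳ _ ⟨
        v i + 0#             ≈⟨ +-congˡ (-‿inverseˡ (w i)) ⟨
        v i + (- w i + w i)  ≈⟨ +-assoc _ _ _ ⟨
        v i + - w i + w i    ≈⟨ +-congʳ (spectrum-zero (λ i → v i + - w i) difference i) ⟩
        0# + w i             ≈⟨ +-identityˡ _ ⟩
        w i                  ∎
        where
        -- Additivity of the spectrum suffices: once the spectrum of v is replaced by that of w, the
        -- sum recombines into the spectrum of w - w.
        difference : ∀ j → j < n → (λ i → v i + - w i) ˆ j ≈ 0#
        difference j j<n = begin
          (λ i → v i + - w i) ˆ j         ≈⟨ ev-+ (pow θ j) v (λ i → - w i) ⟩
          v ˆ j + (λ i → - w i) ˆ j       ≈⟨ +-congʳ (same j j<n) ⟩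
          w ˆ j + (λ i → - w i) ˆ j       ≈⟨ ev-+ (pow θ j) w (λ i → - w i) ⟨
          (λ i → w i + - w i) ˆ j
            ≈⟨ sum-zero _ (λ i → trans (*-congʳ (-‿inverseʳ (w i))) (zeroˡ _)) ⟩
          0#                              ∎

      cycMul-ˆ : ∀ a gp j → cycMul a gp ˆ j ≈ a ˆ j * eval (pow θ j) gp
      cycMul-ˆ a gp j = ev-cycMul (unity j) a gp

      conv-ˆ : ∀ a (w : Word n) j → cycMul a (tabulate w) ˆ j ≈ a ˆ j * w ˆ j
      conv-ˆ a w j = trans (cycMul-ˆ a (tabulate w) j) (*-congˡ (eval-tabulate (pow θ j) w))

      -- Both sides are the last coefficient of rev v · gp · a.
      adjoint : ∀ v a gp → dot v (cycMul a gp) ≈ dot (rev (cycMul (rev v) gp)) a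
      adjoint v a gp = begin
        dot v c                               ≈⟨ dot-cong (λ i → reflexive (≡.cong v (≡.sym (opposite-involutive i)))) c ⟩
        dot (rev (rev v)) c                   ≈⟨ cycMul-last (rev v) c ⟨
        cycMul (rev v) (tabulate c) last      ≈⟨ spectrum-injective _ _ same last ⟩
        cycMul u (tabulate a) last            ≈⟨ cycMul-last u a ⟩
        dot (rev u) a                         ∎
        where
        c = cycMul a gp
        u = cycMul (rev v) gp
        dot-cong : ∀ {v w : Word n} → (∀ i → v i ≈ w i) → ∀ c → dot v c ≈ dot w c
        dot-cong {v} {w} v≈w c = trans (dot-sum v c) (trans (sum-cong-≋ {n} (λ i → *-congʳ (v≈w i))) (sym (dot-sum w c)))
        same : ∀ j → j < n → cycMul (rev v) (tabulate c) ˆ j ≈ cycMul u (tabulate a) ˆ j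
        same j _ = begin
          cycMul (rev v) (tabulate c) ˆ j              ≈⟨ conv-ˆ (rev v) c j ⟩
          rev v ˆ j * c ˆ j                            ≈⟨ *-congˡ (trans (cycMul-ˆ a gp j) (*-comm _ _)) ⟩
          rev v ˆ j * (eval (pow θ j) gp * a ˆ j)      ≈⟨ *-assoc _ _ _ ⟨
          rev v ˆ j * eval (pow θ j) gp * a ˆ j        ≈⟨ *-congʳ (cycMul-ˆ (rev v) gp j) ⟨
          u ˆ j * a ˆ j                                ≈⟨ conv-ˆ u a j ⟨
          cycMul u (tabulate a) ˆ j                    ∎

-- LCD and self-orthogonality as conditions on the zeros of g.

module CodeCriteria where

  open FiniteFields
  open Spectra
  open Divisors using (≡ᵇ-true; ≡ᵇ-false)
  open import Data.Nat as ℕ using (ℕ; zero; suc; _<_; _≤_; _∸_)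
  import Data.Nat.Properties as ℕ
  open import Data.Bool using (Bool; true; false; if_then_else_)
  open import Data.Fin using (Fin; zero; suc; toℕ; fromℕ<; opposite)
  open import Data.Fin.Properties using (toℕ-fromℕ<; toℕ-injective; opposite-involutive)
  open import Data.List using (List; []; _∷_; length; map; tabulate; upTo; zip)
  open import Data.List.Relation.Unary.All as All using (All; []; _∷_)
  import Data.List.Relation.Unary.All.Properties as All
  open import Data.Product using (_,_; proj₁; proj₂)
  open import Function.Base using (_∘_)
  open import Function.Bundles using (_⇔_; mk⇔)
  open import Relation.Nullary using (¬_; Dec; yes; no; contradiction)
  open import Relation.Binary.PropositionalEquality as ≡ using (_≡_; _≢_)

  module Criteria (K : FiniteField) {n : ℕ} (0<n : 0 < n)
    (θ : FiniteField.Carrier K) (prim : QR.IsPrimitiveRoot K n θ) {q : ℕ} (q-power : IsPrimePower q)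
    (N : ℕ) (size≡ : FiniteField.size K ≡ q ℕ.^ N) where
    open FiniteField K hiding (zero)
    open QR K
    open FieldTheory K
    open CyclicCodes K 0<n
    open PrimitiveRoot θ prim
    open import Algebra.Properties.Ring ring using (+-cancelˡ)
    open import Algebra.Properties.Semiring.Sum semiring using (sum; sum-cong-≋)
    open import Relation.Binary.Reasoning.Setoid setoid

    InFq-0 : InFq q 0#
    InFq-0 = go q (primePower>0 q-power)
      where
      go : ∀ q → 0 < q → InFq q 0#
      go (suc q) _ = zeroˡ _

    InFq-+ : ∀ {x y} → InFq q x → InFq q y → InFq q (x + y)
    InFq-+ x∈F y∈F = trans (frobenius q-power N size≡ _ _) (+-cong x∈F y∈F)

    InFq-* : ∀ {x y} → InFq q x → InFq q y → InFq q (x * y)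
    InFq-* x∈F y∈F = trans (pow-distrib _ _ q) (*-cong x∈F y∈F)

    -- Derived from additivity of x^q at x + (-x) = 0, so that the parity of q makes no difference.
    InFq-neg : ∀ {x} → InFq q x → InFq q (- x)
    InFq-neg {x} x∈F = +-cancelˡ x _ _ (begin
      x + pow (- x) q        ≈⟨ +-congʳ x∈F ⟨
      pow x q + pow (- x) q  ≈⟨ frobenius q-power N size≡ x (- x) ⟨
      pow (x + - x) q        ≈⟨ pow-cong q (-‿inverseʳ x) ⟩
      pow 0# q               ≈⟨ InFq-0 ⟩
      0#                     ≈⟨ -‿inverseʳ x ⟨
      x + - x                ∎)

    InFq-if : ∀ b {x} → InFq q x → InFq q (if b then x else 0#)
    InFq-if true  x∈F = x∈F
    InFq-if false _   = InFq-0

    InFq-sumK : ∀ {xs} → All (InFq q) xs → InFq q (sumK xs)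
    InFq-sumK []           = InFq-0
    InFq-sumK (x∈F ∷ xs∈F) = InFq-+ x∈F (InFq-sumK xs∈F)

    InFq-cycMul : ∀ {a : Word n} {gp} → (∀ i → InFq q (a i)) → All (InFq q) gp → ∀ k → InFq q (cycMul a gp k)
    InFq-cycMul {a} {gp} a∈F gp∈F k = InFq-sumK (All.map⁺ (All.tabulate⁺ λ i →
      InFq-sumK (All.map⁺ {xs = indexed gp} (All.map (λ c∈F → InFq-if _ (InFq-* (a∈F i) c∈F))
        (indexed∈F (upTo (length gp)) gp∈F)))))
      where
      indexed∈F : ∀ (js : List ℕ) {cs} → All (InFq q) cs → All (InFq q ∘ proj₂) (zip js cs)
      indexed∈F []       _            = []
      indexed∈F (j ∷ js) []           = []
      indexed∈F (j ∷ js) (c∈F ∷ cs∈F) = c∈F ∷ indexed∈F js cs∈F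

    -- The monomial x^s. Its entries 0 and 1 lie in F_q, so it is admissible over either coefficient
    -- field.
    unit : Fin n → Word n
    unit s i = if toℕ i ℕ.≡ᵇ toℕ s then 1# else 0#

    unit-at : ∀ s → unit s s ≈ 1#
    unit-at s rewrite ≡ᵇ-true {toℕ s} {toℕ s} ≡.refl = refl

    unit-off : ∀ s i → i ≢ s → unit s i ≈ 0#
    unit-off s i i≢s rewrite ≡ᵇ-false {toℕ i} {toℕ s} (i≢s ∘ toℕ-injective) = refl

    unit∈F : ∀ s i → InFq q (unit s i)
    unit∈F s i = InFq-if _ (pow-1 q)

    origin : Fin n
    origin = fromℕ< 0<n

    origin-ˆ : ∀ j → unit origin ˆ j ≈ 1#
    origin-ˆ j = begin
      unit origin ˆ j
        ≈⟨ sum-single _ origin (λ i i≢0 → trans (*-congʳ (unit-off origin i i≢0)) (zeroˡ _)) ⟩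
      unit origin origin * pow (pow θ j) (toℕ origin)
        ≈⟨ *-cong (unit-at origin) (reflexive (≡.cong (pow (pow θ j)) (toℕ-fromℕ< 0<n))) ⟩
      1# * 1#  ≈⟨ *-identityˡ 1# ⟩
      1#       ∎

    dot-unit : ∀ w s → dot w (unit s) ≈ w s
    dot-unit w s = begin
      dot w (unit s)               ≈⟨ dot-sum w (unit s) ⟩
      sum (λ i → w i * unit s i)   ≈⟨ sum-single _ s (λ i i≢s → trans (*-congˡ (unit-off s i i≢s)) (zeroʳ _)) ⟩
      w s * unit s s               ≈⟨ trans (*-congˡ (unit-at s)) (*-identityʳ _) ⟩
      w s                          ∎

    dot-zero : ∀ {v : Word n} → (∀ i → v i ≈ 0#) → ∀ w → dot v w ≈ 0#
    dot-zero {v} v≈0 w = trans (dot-sum v w) (sum-zero _ (λ i → trans (*-congʳ (v≈0 i)) (zeroˡ _)))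

    opposite-roots : ∀ {j} → j ≤ n → pow θ j * pow θ (n ∸ j) ≈ 1#
    opposite-roots {j} j≤n = begin
      pow θ j * pow θ (n ∸ j)  ≈⟨ pow-+ θ j (n ∸ j) ⟨
      pow θ (j ℕ.+ (n ∸ j))    ≈⟨ reflexive (≡.cong (pow θ) (ℕ.m+[n∸m]≡n j≤n)) ⟩
      pow θ n                  ≈⟨ proj₁ prim ⟩
      1#                       ∎

    -- Reversal exchanges the spectrum at j and at -j up to a power of θ. Powers of θ are nonzero,
    -- so vanishing transfers in all directions, as in the two variants that follow.
    rev-ˆ : ∀ {j} → j ≤ n → ∀ w → rev w ˆ (n ∸ j) ≈ 0# → w ˆ j ≈ 0#
    rev-ˆ {j} j≤n w eq = trans
      (sym (ev-rev (unity (n ∸ j)) (trans (*-comm _ _) (opposite-roots j≤n)) w)) (trans (*-congʳ eq) (zeroˡ _))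

    rev-ˆ⁻ : ∀ {j} → j ≤ n → ∀ w → w ˆ (n ∸ j) ≈ 0# → rev w ˆ j ≈ 0#
    rev-ˆ⁻ {j} j≤n w eq = zero-factor (trans (*-comm _ _)
      (trans (ev-rev (unity j) (opposite-roots j≤n) w) eq)) (pow-≉0 j θ≉0)

    rev-ˆ′ : ∀ {j} → j ≤ n → ∀ w → rev w ˆ j ≈ 0# → w ˆ (n ∸ j) ≈ 0#
    rev-ˆ′ {j} j≤n w eq = trans
      (sym (ev-rev (unity j) (opposite-roots j≤n) w)) (trans (*-congʳ eq) (zeroˡ _))

    Zero : Poly → ℕ → Set
    Zero gp j = eval (pow θ j) gp ≈ 0#

    zero? : ∀ gp j → Dec (Zero gp j)
    zero? gp j = eval (pow θ j) gp ≟ 0#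

    module _ (gp : Poly) where

      private
        ĝ : ℕ → Carrier
        ĝ j = eval (pow θ j) gp

        M : ℕ
        M = proj₁ exponent

      -- Each entry is a function of the hypothesis that g has coefficients in F_q, which treats
      -- both coefficient fields at once.
      Based : Word n → Set
      Based w = ∀ i → Base q gp (w i)

      times : ℕ → Word n → Word n
      times zero    w = w
      times (suc k) w = cycMul (times k w) gp

      times-based : ∀ k {w} → Based w → Based (times k w)
      times-based zero    w∈F = w∈F
      times-based (suc k) w∈F i gp∈F = InFq-cycMul (λ i → times-based k w∈F i gp∈F) gp∈F i

      times-ˆ : ∀ k w j → times k w ˆ j ≈ w ˆ j * pow (ĝ j) k
      times-ˆ zero    w j = sym (*-identityʳ _)
      times-ˆ (suc k) w j = begin
        cycMul (times k w) gp ˆ j     ≈⟨ cycMul-ˆ (times k w) gp j ⟩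
        times k w ˆ j * ĝ j           ≈⟨ *-congʳ (times-ˆ k w j) ⟩
        w ˆ j * pow (ĝ j) k * ĝ j     ≈⟨ *-assoc _ _ _ ⟩
        w ˆ j * (pow (ĝ j) k * ĝ j)   ≈⟨ *-congˡ (*-comm _ _) ⟩
        w ˆ j * pow (ĝ j) (suc k)     ∎

      codeword-zero : ∀ {c} → CyclicCode n q gp c → ∀ j → Zero gp j → c ˆ j ≈ 0#
      codeword-zero {c} (a , _ , c≈ag) j ĝ≈0 = begin
        c ˆ j              ≈⟨ ev-cong (pow θ j) c≈ag ⟩
        cycMul a gp ˆ j    ≈⟨ cycMul-ˆ a gp j ⟩
        a ˆ j * ĝ j        ≈⟨ trans (*-congˡ ĝ≈0) (zeroʳ _) ⟩
        0#                 ∎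

      -- The cofactor is c · g ^ M: since x ^ (M + 1) = 1 for x ≠ 0, it inverts g on the support of
      -- the spectrum of c, and it is visibly defined over the field of coefficients of g.
      codeword : ∀ {c} → Based c → (∀ {j} → j < n → Zero gp j → c ˆ j ≈ 0#) → CyclicCode n q gp c
      codeword {c} c∈F vanish = times M c , times-based M c∈F , spectrum-injective c (times (suc M) c) same
        where
        same : ∀ j → j < n → c ˆ j ≈ times (suc M) c ˆ j
        same j j<n with zero? gp j
        ... | yes ĝ≈0 = begin
              c ˆ j                           ≈⟨ vanish j<n ĝ≈0 ⟩
              0#                              ≈⟨ zeroˡ _ ⟨
              0# * pow (ĝ j) (suc M)          ≈⟨ *-congʳ (vanish j<n ĝ≈0) ⟨
              c ˆ j * pow (ĝ j) (suc M)       ≈⟨ times-ˆ (suc M) c j ⟨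
              times (suc M) c ˆ j             ∎
        ... | no ĝ≉0 = begin
              c ˆ j                           ≈⟨ *-identityʳ _ ⟨
              c ˆ j * 1#                      ≈⟨ *-congˡ (proj₂ exponent ĝ≉0) ⟨
              c ˆ j * pow (ĝ j) (suc M)       ≈⟨ times-ˆ (suc M) c j ⟨
              times (suc M) c ˆ j             ∎

      -- It is enough to test v on the codewords x^s g. By `adjoint` these inner products are the
      -- entries of the reversed word rev v · g, which is therefore 0, and so is its spectrum.
      dual-zero : ∀ {v} → DualCode n q gp v → ∀ j → ¬ Zero gp j → rev v ˆ j ≈ 0#
      dual-zero {v} (_ , ⊥C) j ĝ≉0 = zero-factor (trans (*-comm _ _) (begin
        rev v ˆ j * ĝ j          ≈⟨ cycMul-ˆ (rev v) gp j ⟨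
        cycMul (rev v) gp ˆ j    ≈⟨ sum-zero _ (λ i → trans (*-congʳ (u≈0 i)) (zeroˡ _)) ⟩
        0#                       ∎)) ĝ≉0
        where
        u = cycMul (rev v) gp
        rev-u≈0 : ∀ s → rev u s ≈ 0#
        rev-u≈0 s = begin
          rev u s                     ≈⟨ dot-unit (rev u) s ⟨
          dot (rev u) (unit s)        ≈⟨ adjoint v (unit s) gp ⟨
          dot v (cycMul (unit s) gp)  ≈⟨ ⊥C _ (unit s , (λ i _ → unit∈F s i) , λ _ → refl) ⟩
          0#                          ∎
        u≈0 : ∀ i → u i ≈ 0#
        u≈0 i = trans (reflexive (≡.cong u (≡.sym (opposite-involutive i)))) (rev-u≈0 (opposite i))

      -- At each j either g or rev v vanishes, so rev v · g has zero spectrum and is 0; `adjoint`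
      -- then makes v orthogonal to every multiple of g.
      dualword : ∀ {v} → Based v → (∀ {j} → j < n → ¬ Zero gp j → rev v ˆ j ≈ 0#) → DualCode n q gp v
      dualword {v} v∈F vanish = v∈F , orthogonal
        where
        u = cycMul (rev v) gp
        u≈0 : ∀ i → u i ≈ 0#
        u≈0 = spectrum-injective u (λ _ → 0#) (λ j j<n → trans (cycMul-ˆ (rev v) gp j)
          (trans (product-zero j j<n) (sym (sum-zero {n} _ (λ i → zeroˡ _)))))
          where
          product-zero : ∀ j → j < n → rev v ˆ j * ĝ j ≈ 0#
          product-zero j j<n with zero? gp j
          ... | yes ĝ≈0 = trans (*-congˡ ĝ≈0) (zeroʳ _)
          ... | no  ĝ≉0 = trans (*-congʳ (vanish j<n ĝ≉0)) (zeroˡ _)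
        orthogonal : ∀ c → CyclicCode n q gp c → dot v c ≈ 0#
        orthogonal c (a , _ , c≈ag) = begin
          dot v c                ≈⟨ dot-sum v c ⟩
          sum (λ i → v i * c i)  ≈⟨ sum-cong-≋ {n} (λ i → *-congˡ (c≈ag i)) ⟩
          sum (λ i → v i * cycMul a gp i)  ≈⟨ dot-sum v (cycMul a gp) ⟨
          dot v (cycMul a gp)    ≈⟨ adjoint v a gp ⟩
          dot (rev u) a          ≈⟨ dot-zero (λ i → u≈0 (opposite i)) a ⟩
          0#                     ∎

      support : Word n
      support = times (suc M) (unit origin)

      support-based : Based support
      support-based = times-based (suc M) (λ i _ → unit∈F origin i)

      support-zero : ∀ j → Zero gp j → support ˆ j ≈ 0#
      support-zero j ĝ≈0 = trans (times-ˆ (suc M) (unit origin) j)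
        (trans (*-congˡ (trans (*-congʳ ĝ≈0) (zeroˡ _))) (zeroʳ _))

      support-one : ∀ j → ¬ Zero gp j → support ˆ j ≈ 1#
      support-one j ĝ≉0 = trans (times-ˆ (suc M) (unit origin) j)
        (trans (*-cong (origin-ˆ j) (proj₂ exponent ĝ≉0)) (*-identityˡ 1#))

      -- The idempotent 1 - g^(M + 1), complementary to `support`: its spectrum is the indicator of
      -- T.
      cosupport : Word n
      cosupport i = unit origin i + - support i

      cosupport-based : Based cosupport
      cosupport-based i gp∈F = InFq-+ (unit∈F origin i) (InFq-neg (support-based i gp∈F))

      private
        cosupport+support : ∀ j → cosupport ˆ j + support ˆ j ≈ 1#
        cosupport+support j = begin
          cosupport ˆ j + support ˆ j                    ≈⟨ ev-+ (pow θ j) cosupport support ⟨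
          (λ i → cosupport i + support i) ˆ j            ≈⟨ ev-cong (pow θ j) (λ i →
            trans (+-assoc _ _ _) (trans (+-congˡ (-‿inverseˡ _)) (+-identityʳ _))) ⟩
          unit origin ˆ j                                ≈⟨ origin-ˆ j ⟩
          1#                                             ∎

      cosupport-zero : ∀ j → ¬ Zero gp j → cosupport ˆ j ≈ 0#
      cosupport-zero j ĝ≉0 = +-cancelˡ 1# _ _ (begin
        1# + cosupport ˆ j             ≈⟨ +-comm _ _ ⟩
        cosupport ˆ j + 1#             ≈⟨ +-congˡ (support-one j ĝ≉0) ⟨
        cosupport ˆ j + support ˆ j    ≈⟨ cosupport+support j ⟩
        1#                             ≈⟨ +-identityʳ 1# ⟨
        1# + 0#                        ∎)

      cosupport-one : ∀ j → Zero gp j → cosupport ˆ j ≈ 1#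
      cosupport-one j ĝ≈0 = begin
        cosupport ˆ j                  ≈⟨ +-identityʳ _ ⟨
        cosupport ˆ j + 0#             ≈⟨ +-congˡ (support-zero j ĝ≈0) ⟨
        cosupport ˆ j + support ˆ j    ≈⟨ cosupport+support j ⟩
        1#                             ∎

      -- The one inclusion -T ⊆ T already gives equality, negation being an involution. For a word
      -- in both codes the spectrum vanishes on T and at every j with -j outside T, and symmetry
      -- makes these cover everything.
      LCD⇔ : IsLCD n q gp ⇔ (∀ {j} → j < n → Zero gp (n ∸ j) → Zero gp j)
      LCD⇔ = mk⇔ to from
        where
        from : (∀ {j} → j < n → Zero gp (n ∸ j) → Zero gp j) → IsLCD n q gp
        from symmetric v v∈C v∈C⊥ = spectrum-injective v (λ _ → 0#) (λ j j<n →
          trans (vanish j j<n) (sym (sum-zero {n} _ (λ i → zeroˡ _))))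
          where
          vanish : ∀ j → j < n → v ˆ j ≈ 0#
          vanish j j<n with zero? gp j
          ... | yes ĝ≈0 = codeword-zero v∈C j ĝ≈0
          ... | no  ĝ≉0 = rev-ˆ (ℕ.<⇒≤ j<n) v (dual-zero v∈C⊥ (n ∸ j) (ĝ≉0 ∘ symmetric j<n))
        -- The witness has spectrum 1 exactly at the j outside T with −j in T.
        to : IsLCD n q gp → ∀ {j} → j < n → Zero gp (n ∸ j) → Zero gp j
        to lcd {j} j<n ĝ′≈0 with zero? gp j
        ... | yes ĝ≈0 = ĝ≈0
        ... | no  ĝ≉0 = contradiction (trans (sym (cosupport-one (n ∸ j) ĝ′≈0)) (rev-ˆ′ (ℕ.<⇒≤ j<n) cosupport (begin
              rev cosupport ˆ j                ≈⟨ *-identityˡ _ ⟨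
              1# * rev cosupport ˆ j           ≈⟨ *-congʳ (support-one j ĝ≉0) ⟨
              support ˆ j * rev cosupport ˆ j  ≈⟨ conv-ˆ support (rev cosupport) j ⟨
              v ˆ j                            ≈⟨ sum-zero _ (λ i → trans (*-congʳ (v≈0 i)) (zeroˡ _)) ⟩
              0#                               ∎))) 1≉0
          where
          -- The factor `support` puts `v` in the code and the factor `rev cosupport` puts it in the
          -- dual. If `v` is 0, then the spectrum of `cosupport` vanishes at -j, where it is 1.
          v = cycMul support (tabulate (rev cosupport))
          v∈F : Based v
          v∈F i gp∈F = InFq-cycMul (λ i → support-based i gp∈F)
            (All.tabulate⁺ (λ i → cosupport-based (opposite i) gp∈F)) i
          v∈C : CyclicCode n q gp v
          v∈C = codeword v∈F (λ {j} _ ĝ≈0 → trans (conv-ˆ support (rev cosupport) j)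
            (trans (*-congʳ (support-zero j ĝ≈0)) (zeroˡ _)))
          v∈C⊥ : DualCode n q gp v
          v∈C⊥ = dualword v∈F (λ {j} j<n ĝ≉0 → rev-ˆ⁻ (ℕ.<⇒≤ j<n) v (begin
            v ˆ (n ∸ j)                                    ≈⟨ conv-ˆ support (rev cosupport) (n ∸ j) ⟩
            support ˆ (n ∸ j) * rev cosupport ˆ (n ∸ j)    ≈⟨ *-congˡ (rev-ˆ⁻ (ℕ.m∸n≤m n j) cosupport
              (trans (reflexive (≡.cong (cosupport ˆ_) (ℕ.m∸[m∸n]≡n (ℕ.<⇒≤ j<n)))) (cosupport-zero j ĝ≉0))) ⟩
            support ˆ (n ∸ j) * 0#                         ≈⟨ zeroʳ _ ⟩
            0#                                             ∎))
          v≈0 : ∀ i → v i ≈ 0#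
          v≈0 = lcd v v∈C v∈C⊥

      -- The spectrum of a dual word vanishes at every j with -j outside T. It thus vanishes on T
      -- when T and -T are disjoint; conversely one dual word suffices, whose spectrum is nonzero on
      -- all of -T.
      selfOrthogonal⇔ : IsSelfOrthogonal n q gp ⇔ (∀ {j} → j < n → Zero gp j → ¬ Zero gp (n ∸ j))
      selfOrthogonal⇔ = mk⇔ to from
        where
        from : (∀ {j} → j < n → Zero gp j → ¬ Zero gp (n ∸ j)) → IsSelfOrthogonal n q gp
        from antisymmetric v v∈C⊥ = codeword (proj₁ v∈C⊥) (λ {j} j<n ĝ≈0 →
          rev-ˆ (ℕ.<⇒≤ j<n) v (dual-zero v∈C⊥ (n ∸ j) (antisymmetric j<n ĝ≈0)))
        to : IsSelfOrthogonal n q gp → ∀ {j} → j < n → Zero gp j → ¬ Zero gp (n ∸ j)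
        to selfOrthogonal {j} j<n ĝ≈0 ĝ′≈0 = 1≉0 (trans (sym (cosupport-one (n ∸ j) ĝ′≈0))
          (rev-ˆ′ (ℕ.<⇒≤ j<n) cosupport (codeword-zero v∈C j ĝ≈0)))
          where
          -- `rev cosupport` is always in the dual, because reversing it again gives `cosupport`,
          -- which has no spectrum outside T.
          v∈C : CyclicCode n q gp (rev cosupport)
          v∈C = selfOrthogonal (rev cosupport) (dualword (λ i → cosupport-based (opposite i))
            (λ {j} _ ĝ≉0 → trans
              (ev-cong (pow θ j) (λ i → reflexive (≡.cong cosupport (opposite-involutive i))))
              (cosupport-zero j ĝ≉0)))

    -- The word 1 · g₁ lies in the first code over either field, hence in the second, where spectra
    -- vanish at the zeros of g₂. The two coefficient fields are never compared.
    sameCode-zeros : ∀ {g₁ g₂} → SameCode n q g₁ g₂ → ∀ j → Zero g₂ j → Zero g₁ j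
    sameCode-zeros {g₁} {g₂} same j ĝ₂≈0 = begin
      eval (pow θ j) g₁                      ≈⟨ *-identityˡ _ ⟨
      1# * eval (pow θ j) g₁                 ≈⟨ *-congʳ (origin-ˆ j) ⟨
      unit origin ˆ j * eval (pow θ j) g₁    ≈⟨ cycMul-ˆ (unit origin) g₁ j ⟨
      cycMul (unit origin) g₁ ˆ j
        ≈⟨ codeword-zero g₂ (proj₁ (same _) (unit origin , (λ i _ → unit∈F origin i) , λ _ → refl)) j ĝ₂≈0 ⟩
      0#                                     ∎

-- Jacobi symbols and the zero sets attached to choices.

module ZeroSets where

  open LegendreSymbol
  open Divisors
  open import Data.Nat as ℕ using (ℕ; zero; suc; _<_; z≤n; s≤s; _%_; _+_; _*_; _∸_)
  import Data.Nat.Properties as ℕ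
  open import Data.Nat.Divisibility
  open import Data.Nat.GCD using (gcd; gcd[m,n]∣m; gcd[m,n]∣n; gcd-greatest)
  open import Data.Nat.Coprimality using (coprime-divisor)
  import Data.Nat.Coprimality as Coprimality
  open import Data.Nat.Primality using (Prime; prime⇒nonZero; prime⇒irreducible)
  open import Data.Integer as ℤ using (ℤ; +_)
  open import Data.Bool using (Bool; true; false; not; if_then_else_)
  open import Data.Fin as Fin using (Fin; zero; suc)
  open import Data.Empty using (⊥-elim) renaming (⊥ to Empty)
  open import Data.Fin.Properties using (any?)
  open import Data.Fin.Subset using (Subset; ∣_∣; ⊤; ⊥)
  open import Data.Fin.Subset.Properties using (∣p∣≡n⇒p≡⊤; ∣⊤∣≡n)
  import Data.List as List
  open import Data.Vec using (lookup; tabulate)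
  open import Data.Vec.Properties using (lookup∘tabulate; tabulate∘lookup; tabulate-cong; lookup-replicate)
  open import Data.Product using (_×_; _,_; ∃; proj₁; proj₂)
  open import Data.Sum using (inj₁; inj₂)
  open import Function.Base using (_∘_)
  open import Function.Bundles using (_⇔_; mk⇔; Equivalence)
  open import Relation.Nullary using (¬_; Dec; yes; no; contradiction; does; ¬?)
  open import Relation.Nullary.Decidable using (dec-true; dec-false; decidable-stable)
  open import Relation.Binary.PropositionalEquality using (_≡_; _≢_; refl; sym; trans; cong; cong₂; subst; subst₂)

  module ZeroSet {g : ℕ} (p : Fin g → ℕ) (distinct : Distinct p) (primes : ∀ i → Prime (p i))
    (odd : ∀ i → p i % 2 ≡ 1) where

    private
      n : ℕ
      n = prodPrimes p

      p>0 : ∀ i → 0 < p i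
      p>0 i = prime>0 (primes i)

    n>0 : 0 < prodPrimes p
    n>0 = go p p>0
      where
      go : ∀ {g} (p : Fin g → ℕ) → (∀ i → 0 < p i) → 0 < prodPrimes p
      go {zero}  p _   = s≤s z≤n
      go {suc g} p p>0 = subst (0 <_) (sym (prodPrimes-suc p)) (ℕ.*-mono-≤ (p>0 zero) (go (p ∘ suc) (p>0 ∘ suc)))

    private instance
      n-nonZero : ℕ.NonZero n
      n-nonZero = ℕ.>-nonZero n>0

    divisor>0 : ∀ {d} → d ∣ n → 0 < d
    divisor>0 {zero}  0∣n = contradiction (0∣⇒≡0 0∣n) (ℕ.>⇒≢ n>0)
    divisor>0 {suc d} _   = s≤s z≤n

    divisor-≡ : ∀ {d e} → d ∣ n → e ∣ n → (∀ i → p i ∣ d → p i ∣ e) → (∀ i → p i ∣ e → p i ∣ d) → d ≡ e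
    divisor-≡ d∣n e∣n sub sup = ∣-antisym (squarefree-∣ p distinct primes d∣n sub) (squarefree-∣ p distinct primes e∣n sup)

    -- Otherwise the square of pᵢ would divide n.
    coprime-parts : ∀ {Q d} → Q * d ∣ n → ∀ i → p i ∣ Q → ¬ (p i ∣ d)
    coprime-parts {Q} {d} Qd∣n i p∣Q p∣d = p∤cofactor p distinct primes i
      (*-cancelˡ-∣ (p i) {{prime⇒nonZero (primes i)}} (subst (p i * p i ∣_) (prodPrimes-cofactor p i)
        (∣-trans (*-pres-∣ p∣Q p∣d) Qd∣n)))

    all-primes⇒n∣ : ∀ {d} → (∀ i → p i ∣ d) → n ∣ d
    all-primes⇒n∣ all = squarefree-∣ p distinct primes ∣-refl (λ i _ → all i)

    proper⇒¬all : ∀ {d} → d ∣ n → d < n → ¬ (∀ i → p i ∣ d)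
    proper⇒¬all d∣n d<n all =
      ℕ.<⇒≱ d<n (∣⇒≤ {{ℕ.>-nonZero (divisor>0 d∣n)}} (all-primes⇒n∣ all))

    missing*∣ : ∀ {d} → d ∣ n → ∀ i → ¬ (p i ∣ d) → p i * d ∣ n
    missing*∣ {d} d∣n i p∤d = subst (p i * d ∣_) (sym (prodPrimes-cofactor p i)) (*-monoʳ-∣ (p i)
      (coprime-divisor (Coprimality.sym (prime⇒coprime′ (primes i) p∤d)) (subst (d ∣_) (prodPrimes-cofactor p i) d∣n)))

    cofactor∣n : ∀ i → cofactor p i ∣ n
    cofactor∣n i = subst (cofactor p i ∣_) (sym (prodPrimes-cofactor p i)) (∣n⇒∣m*n (p i) ∣-refl)

    cofactor<n : ∀ i → cofactor p i < n
    cofactor<n i = subst (cofactor p i <_) (sym (trans (prodPrimes-cofactor p i) (ℕ.*-comm (p i) _)))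
      (ℕ.m<m*n (cofactor p i) (p i) {{ℕ.>-nonZero (divisor>0 (cofactor∣n i))}} (prime>1 (primes i)))

    -- On divisors of n this is inverse to `prodSubset p`; the two translate between choices and
    -- functions on subsets.
    support : ℕ → Subset g
    support d = tabulate (λ i → does (p i ∣? d))

    ∈support : ∀ {d i} → p i ∣ d → lookup (support d) i ≡ true
    ∈support {d} {i} p∣d = trans (lookup∘tabulate _ i) (dec-true (p i ∣? d) p∣d)

    ∉support : ∀ {d i} → ¬ (p i ∣ d) → lookup (support d) i ≡ false
    ∉support {d} {i} p∤d = trans (lookup∘tabulate _ i) (dec-false (p i ∣? d) p∤d)

    ∈support⁻ : ∀ {d i} → lookup (support d) i ≡ true → p i ∣ d
    ∈support⁻ {d} {i} i∈ with p i ∣? d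
    ... | yes p∣d = p∣d
    ... | no  p∤d = contradiction (trans (sym i∈) (∉support p∤d)) λ ()

    ∣prodSubset⇒∈ : ∀ {E i} → p i ∣ prodSubset p E → lookup E i ≡ true
    ∣prodSubset⇒∈ {E} {i} p∣e with prime∣prodSubset p (primes i) E p∣e
    ... | j , j∈E , pᵢ∣pⱼ = subst (λ k → lookup E k ≡ true)
            (sym (distinct i j (prime∣prime (primes i) (primes j) pᵢ∣pⱼ))) j∈E

    prodSubset-support : ∀ {d} → d ∣ n → prodSubset p (support d) ≡ d
    prodSubset-support {d} d∣n = divisor-≡ (prodSubset∣ p (support d)) d∣n
      (λ i → ∈support⁻ ∘ ∣prodSubset⇒∈ {support d}) (λ i → ∈⇒∣prodSubset p (support d) i ∘ ∈support)

    support-prodSubset : ∀ E → support (prodSubset p E) ≡ E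
    support-prodSubset E = trans (tabulate-cong same) (tabulate∘lookup E)
      where
      same : ∀ i → does (p i ∣? prodSubset p E) ≡ lookup E i
      same i with lookup E i in i∈
      ... | true  = dec-true (p i ∣? _) (∈⇒∣prodSubset p E i i∈)
      ... | false = dec-false (p i ∣? _) λ p∣ → contradiction (trans (sym i∈) (∣prodSubset⇒∈ {E} p∣)) λ ()

    subset-ext : ∀ {D E : Subset g} → (∀ i → lookup D i ≡ lookup E i) → D ≡ E
    subset-ext {D} {E} eq = trans (sym (tabulate∘lookup D)) (trans (tabulate-cong eq) (tabulate∘lookup E))

    prodSubset≡1⇒⊥ : ∀ {E} → prodSubset p E ≡ 1 → E ≡ ⊥
    prodSubset≡1⇒⊥ {E} e≡1 = subset-ext {E} {⊥} λ i → trans (outside i) (sym (lookup-replicate i false))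
      where
      outside : ∀ i → lookup E i ≡ false
      outside i with lookup E i in i∈
      ... | false = refl
      ... | true  = contradiction (∣1⇒≡1 (subst (p i ∣_) e≡1 (∈⇒∣prodSubset p E i i∈)))
                      (ℕ.<⇒≢ (prime>1 (primes i)) ∘ sym)

    prodSubset<n : ∀ D → ∣ D ∣ ≢ g → prodSubset p D < n
    prodSubset<n D proper = ℕ.≤∧≢⇒< (∣⇒≤ (prodSubset∣ p D)) λ eq → proper
      (trans (cong ∣_∣ (subset-ext {D} {⊤} λ i → trans (∣prodSubset⇒∈ {D} (subst (p i ∣_) (sym eq) (p∣prodPrimes p i)))
        (sym (lookup-replicate i true)))) (∣⊤∣≡n g))

    support-proper : ∀ {d} → d ∣ n → d < n → ∣ support d ∣ ≢ g
    support-proper {d} d∣n d<n full = proper⇒¬all d∣n d<n λ i → ∈support⁻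
      (trans (cong (λ D → lookup D i) (∣p∣≡n⇒p≡⊤ {p = support d} full)) (lookup-replicate i true))

    -- Take j = d + s (n / pᵢ) reduced modulo n: only the residue modulo pᵢ moves, to that of b.
    -- Neither d nor b is divisible by pᵢ, so the primes dividing j are those dividing d and the
    -- class is kept.
    representative : ∀ {d} → d ∣ n → ∀ i → ¬ (p i ∣ d) → ∀ {b} → ¬ (p i ∣ b) →
      ∃ λ j → 0 < j × j < n × gcd j n ≡ d × j mod p i ≡ b mod p i × (∀ l → l ≢ i → j mod p l ≡ d mod p l)
    representative {d} d∣n i p∤d {b} p∤b
      with linear-congruence (p i) (primes i) (odd i) (p∤cofactor p distinct primes i) d b
    ... | s , d+su≡b = j , j>0 , mod<n n>0 j₀ , gcd≡d , at , off
      where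
      u = cofactor p i
      j₀ = d + s * u
      j = j₀ mod n
      reduce : ∀ l → j mod p l ≡ j₀ mod p l
      reduce l = mod-mod (p>0 l) n>0 (p∣prodPrimes p l) j₀
      at : j mod p i ≡ b mod p i
      at = trans (reduce i) d+su≡b
      off : ∀ l → l ≢ i → j mod p l ≡ d mod p l
      off l l≢i = trans (reduce l) (mod-+-multiple d (p>0 l) (∣n⇒∣m*n s (other∣cofactor p l≢i)))
      to : ∀ l → p l ∣ j → p l ∣ d
      to l p∣j with l Fin.≟ i
      ... | yes refl = contradiction (∣-mod (p>0 l) at p∣j) p∤b
      ... | no l≢i   = ∣-mod (p>0 l) (off l l≢i) p∣j
      from : ∀ l → p l ∣ d → p l ∣ j
      from l p∣d with l Fin.≟ i
      ... | yes refl = contradiction p∣d p∤d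
      ... | no l≢i   = ∣-mod (p>0 l) (sym (off l l≢i)) p∣d
      gcd≡d : gcd j n ≡ d
      gcd≡d = divisor-≡ (gcd[m,n]∣n j n) d∣n
        (λ l p∣gcd → to l (∣-trans p∣gcd (gcd[m,n]∣m j n)))
        (λ l p∣d → gcd-greatest (from l p∣d) (p∣prodPrimes p l))
      j>0 : 0 < j
      j>0 = ℕ.n≢0⇒n>0 λ j≡0 → p∤b (∣-mod (p>0 i) at (subst (p i ∣_) (sym j≡0) (p i ∣0)))

    private
      factor : ℕ → ℕ → Fin g → ℤ
      factor a Q i = if (Q mod p i) ℕ.≡ᵇ 0 then legendre a (p i) else + 1

      jacobi≡ : ∀ a Q → jacobi p a Q ≡ prodℤ (List.tabulate (factor a Q))
      jacobi≡ a Q = prodℤ-allFin (factor a Q)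

      factor-∣ : ∀ a {Q i} → p i ∣ Q → factor a Q i ≡ legendre a (p i)
      factor-∣ a {Q} {i} p∣Q rewrite ≡ᵇ-true (∣⇒mod≡0 (p>0 i) p∣Q) = refl

      factor-∤ : ∀ a {Q i} → ¬ (p i ∣ Q) → factor a Q i ≡ + 1
      factor-∤ a {Q} {i} p∤Q rewrite ≡ᵇ-false (p∤Q ∘ mod≡0⇒∣ (p>0 i) Q) = refl

      factor-cong : ∀ {a b} Q i → legendre a (p i) ≡ legendre b (p i) → factor a Q i ≡ factor b Q i
      factor-cong Q i eq = cong (λ s → if (Q mod p i) ℕ.≡ᵇ 0 then s else + 1) eq

    jacobi-unit : ∀ {a Q} → (∀ i → p i ∣ Q → ¬ (p i ∣ a)) → IsUnit (jacobi p a Q)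
    jacobi-unit {a} {Q} coprime = subst IsUnit (sym (jacobi≡ a Q)) (prodℤ-unit (factor a Q) unit)
      where
      unit : ∀ i → IsUnit (factor a Q i)
      unit i with p i ∣? Q
      ... | yes p∣Q = subst IsUnit (sym (factor-∣ a p∣Q)) (legendre-unit (p i) (primes i) (odd i) (coprime i p∣Q))
      ... | no  p∤Q = inj₁ (factor-∤ a p∤Q)

    jacobi-flip : ∀ {a b Q} l → p l ∣ Q → legendre a (p l) ≡ ℤ.- legendre b (p l) →
      (∀ i → i ≢ l → legendre a (p i) ≡ legendre b (p i)) → jacobi p a Q ≡ ℤ.- jacobi p b Q
    jacobi-flip {a} {b} {Q} l p∣Q at off = trans (jacobi≡ a Q) (trans
      (prodℤ-flip (factor a Q) (factor b Q) l
        (trans (factor-∣ a p∣Q) (trans at (cong (ℤ.-_) (sym (factor-∣ b p∣Q)))))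
        (λ i i≢l → factor-cong Q i (off i i≢l)))
      (cong (ℤ.-_) (sym (jacobi≡ b Q))))

    jacobi-stable : ∀ {a b Q} l → ¬ (p l ∣ Q) →
      (∀ i → i ≢ l → legendre a (p i) ≡ legendre b (p i)) → jacobi p a Q ≡ jacobi p b Q
    jacobi-stable {a} {b} {Q} l p∤Q off = trans (jacobi≡ a Q)
      (trans (prodℤ-cong (factor a Q) (factor b Q) same) (sym (jacobi≡ b Q)))
      where
      same : ∀ i → factor a Q i ≡ factor b Q i
      same i with i Fin.≟ l
      ... | yes refl = trans (factor-∤ a p∤Q) (sym (factor-∤ b p∤Q))
      ... | no i≢l   = factor-cong Q i (off i i≢l)

    jacobi-prime : ∀ a i → jacobi p a (p i) ≡ legendre a (p i)
    jacobi-prime a i = trans (jacobi≡ a (p i)) (trans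
      (prodℤ-single (factor a (p i)) i λ l l≢i → factor-∤ a λ pₗ∣pᵢ →
        l≢i (distinct l i (prime∣prime (primes l) (primes i) pₗ∣pᵢ)))
      (factor-∣ a ∣-refl))

    record InZeroSet (ch : Choice) (j : ℕ) : Set where
      constructor inZeroSet✓
      field symbol : jacobi p j (proj₁ (ch (gcd j n))) ≡ sign (proj₂ (ch (gcd j n)))
    open InZeroSet

    inZeroSet-at : ∀ {ch j d} → gcd j n ≡ d → InZeroSet ch j ⇔ (jacobi p j (proj₁ (ch d)) ≡ sign (proj₂ (ch d)))
    inZeroSet-at refl = mk⇔ symbol inZeroSet✓

    gcd-proper : ∀ {j} → 0 < j → j < n → gcd j n ∣ n × gcd j n < n
    gcd-proper {j} 0<j j<n = gcd[m,n]∣n j n , ℕ.≤-<-trans (∣⇒≤ {{ℕ.>-nonZero 0<j}} (gcd[m,n]∣m j n)) j<n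

    gcd-divisor : ∀ {d} → d ∣ n → gcd d n ≡ d
    gcd-divisor {d} d∣n = ∣-antisym (gcd[m,n]∣m d n) (gcd-greatest ∣-refl d∣n)

    -- Changing j only modulo a prime that divides Q but not Q′ flips (j / Q) and fixes (j / Q′).
    Q-determined : ∀ {ch ch′} → ValidChoice n ch →
      (∀ {j} → 0 < j → j < n → InZeroSet ch j ⇔ InZeroSet ch′ j) →
      ∀ {d} → d ∣ n → d < n → ∀ l → p l ∣ proj₁ (ch d) → p l ∣ proj₁ (ch′ d)
    Q-determined {ch} {ch′} valid same {d} d∣n d<n l p∣Q with p l ∣? proj₁ (ch′ d)
    ... | yes p∣Q′ = p∣Q′
    ... | no  p∤Q′ = ⊥-elim absurd
      where
      Q  = proj₁ (ch d)
      Q′ = proj₁ (ch′ d)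
      s  = jacobi p d Q
      t  = sign (proj₂ (ch d))
      Qd∣n : Q * d ∣ n
      Qd∣n = proj₁ (valid d d∣n d<n)
      p∤d : ¬ (p l ∣ d)
      p∤d = coprime-parts Qd∣n l p∣Q
      s-unit : IsUnit s
      s-unit = jacobi-unit (coprime-parts Qd∣n)
      module Flipped (b : ℕ) (p∤b : ¬ (p l ∣ b)) (flipped : legendre b (p l) ≡ ℤ.- legendre d (p l)) where
        rep = representative d∣n l p∤d p∤b
        j = proj₁ rep
        j>0 = proj₁ (proj₂ rep)
        j<n = proj₁ (proj₂ (proj₂ rep))
        gcd≡d = proj₁ (proj₂ (proj₂ (proj₂ rep)))
        at = proj₁ (proj₂ (proj₂ (proj₂ (proj₂ rep))))
        off = λ i i≢l → legendre-cong (p i) (proj₂ (proj₂ (proj₂ (proj₂ (proj₂ rep)))) i i≢l)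
        j-flip : jacobi p j Q ≡ ℤ.- s
        j-flip = jacobi-flip l p∣Q (trans (legendre-cong (p l) at) flipped) off
        j-stable : jacobi p j Q′ ≡ jacobi p d Q′
        j-stable = jacobi-stable l p∤Q′ off
        open Equivalence
        d≈ : s ≡ t → jacobi p d Q′ ≡ sign (proj₂ (ch′ d))
        d≈ = to (inZeroSet-at (gcd-divisor d∣n)) ∘ to (same (divisor>0 d∣n) d<n) ∘ from (inZeroSet-at (gcd-divisor d∣n))
        d≈⁻ : jacobi p d Q′ ≡ sign (proj₂ (ch′ d)) → s ≡ t
        d≈⁻ = to (inZeroSet-at (gcd-divisor d∣n)) ∘ from (same (divisor>0 d∣n) d<n) ∘ from (inZeroSet-at (gcd-divisor d∣n))
        j≈ : jacobi p j Q ≡ t → jacobi p j Q′ ≡ sign (proj₂ (ch′ d))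
        j≈ = to (inZeroSet-at gcd≡d) ∘ to (same j>0 j<n) ∘ from (inZeroSet-at gcd≡d)
        j≈⁻ : jacobi p j Q′ ≡ sign (proj₂ (ch′ d)) → jacobi p j Q ≡ t
        j≈⁻ = to (inZeroSet-at gcd≡d) ∘ from (same j>0 j<n) ∘ from (inZeroSet-at gcd≡d)
        impossible : Empty
        -- Both d and j lie in the class of d. The second choice treats them alike because their
        -- symbols over Q′ agree, while the first contains exactly one of them because their symbols
        -- over Q are opposite.
        impossible with s ℤ.≟ t
        ... | yes s≡t = unit≢neg s-unit (trans s≡t (trans (sym (j≈⁻ (trans j-stable (d≈ s≡t)))) j-flip))
        ... | no  s≢t = s≢t (d≈⁻ (trans (sym j-stable) (j≈ (trans j-flip (unit-sign s-unit (sign-unit _) s≢t)))))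
      absurd : Empty
      absurd with opposite-sign (legendre-unit (p l) (primes l) (odd l) p∤d)
      ... | ε , eq with legendre-takes-both-signs (p l) (primes l) (odd l) ε
      ...   | b , p∤b , leg = Flipped.impossible b p∤b (trans leg eq)

    -- Once Q is known, the sign can be read off from d as a member of its own class: (d / Q) is 1
    -- or -1, and whether d is a zero tells whether it equals ε.
    choice-determined : ∀ {ch ch′} → ValidChoice n ch → ValidChoice n ch′ →
      (∀ {j} → 0 < j → j < n → InZeroSet ch j ⇔ InZeroSet ch′ j) →
      ∀ {d} → d ∣ n → d < n → ch d ≡ ch′ d
    choice-determined {ch} {ch′} valid valid′ same {d} d∣n d<n = cong₂ _,_ Q≡Q′ ε≡ε′
      where
      open Equivalence
      flip⇔ : ∀ {j} → 0 < j → j < n → InZeroSet ch′ j ⇔ InZeroSet ch j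
      flip⇔ 0<j j<n = mk⇔ (from (same 0<j j<n)) (to (same 0<j j<n))
      Q  = proj₁ (ch d)
      Q′ = proj₁ (ch′ d)
      Q≡Q′ : Q ≡ Q′
      Q≡Q′ = divisor-≡ (m*n∣⇒m∣ Q d (proj₁ (valid d d∣n d<n))) (m*n∣⇒m∣ Q′ d (proj₁ (valid′ d d∣n d<n)))
        (Q-determined {ch} {ch′} valid same d∣n d<n) (Q-determined {ch′} {ch} valid′ flip⇔ d∣n d<n)
      s = jacobi p d Q
      s-unit : IsUnit s
      s-unit = jacobi-unit (coprime-parts (proj₁ (valid d d∣n d<n)))
      here : s ≡ sign (proj₂ (ch d)) → s ≡ sign (proj₂ (ch′ d))
      here eq = trans (cong (jacobi p d) Q≡Q′) (to (inZeroSet-at (gcd-divisor d∣n))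
        (to (same (divisor>0 d∣n) d<n) (from (inZeroSet-at (gcd-divisor d∣n)) eq)))
      here⁻ : s ≡ sign (proj₂ (ch′ d)) → s ≡ sign (proj₂ (ch d))
      here⁻ eq = to (inZeroSet-at (gcd-divisor d∣n)) (from (same (divisor>0 d∣n) d<n)
        (from (inZeroSet-at (gcd-divisor d∣n)) (trans (sym (cong (jacobi p d) Q≡Q′)) eq)))
      ε≡ε′ : proj₂ (ch d) ≡ proj₂ (ch′ d)
      ε≡ε′ with s ℤ.≟ sign (proj₂ (ch d))
      ... | yes s≡ = sign-injective (trans (sym s≡) (here s≡))
      ... | no  s≢ = sign-injective (trans (sym (unit-sign s-unit (sign-unit _) s≢)) (unit-sign s-unit (sign-unit _) (s≢ ∘ here⁻)))

    -- Cancelling n / pᵢ from Q (n / pᵢ) ∣ n leaves Q ∣ pᵢ with Q > 1.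
    Q-cofactor : ∀ {ch} → ValidChoice n ch → ∀ i → proj₁ (ch (cofactor p i)) ≡ p i
    Q-cofactor {ch} valid i with valid (cofactor p i) (cofactor∣n i) (cofactor<n i)
    ... | Qd∣n , 1<Q with prime⇒irreducible (primes i) (*-cancelˡ-∣ (cofactor p i) {{ℕ.>-nonZero (divisor>0 (cofactor∣n i))}}
          (subst₂ _∣_ (ℕ.*-comm (proj₁ (ch (cofactor p i))) _) (trans (prodPrimes-cofactor p i) (ℕ.*-comm (p i) _)) Qd∣n))
    ...   | inj₁ Q≡1 = contradiction (sym Q≡1) (ℕ.<⇒≢ 1<Q)
    ...   | inj₂ Q≡p = Q≡p

    inZeroSet-cofactor : ∀ {ch} → ValidChoice n ch → ∀ i {j} → gcd j n ≡ cofactor p i →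
      InZeroSet ch j ⇔ (legendre j (p i) ≡ sign (proj₂ (ch (cofactor p i))))
    inZeroSet-cofactor {ch} valid i {j} gcd≡ = mk⇔
      (λ m → trans (sym eq) (to (inZeroSet-at gcd≡) m))
      (λ e → from (inZeroSet-at gcd≡) (trans eq e))
      where
      open Equivalence
      eq : jacobi p j (proj₁ (ch (cofactor p i))) ≡ legendre j (p i)
      eq = trans (cong (jacobi p j) (Q-cofactor {ch} valid i)) (jacobi-prime j i)

    -- The class of n / pᵢ realises both symbols, which lets conditions on the zero set be tested at
    -- each prime separately.
    probe : ∀ i ε → ∃ λ j → 0 < j × j < n × gcd j n ≡ cofactor p i × ¬ (p i ∣ j) × legendre j (p i) ≡ sign ε
    probe i ε =
      let b , p∤b , leg = legendre-takes-both-signs (p i) (primes i) (odd i) ε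
          j , j>0 , j<n , gcd≡ , at , _ = representative (cofactor∣n i) i (p∤cofactor p distinct primes i) p∤b
      in j , j>0 , j<n , gcd≡ , p∤b ∘ ∣-mod (p>0 i) at , trans (legendre-cong (p i) at) leg

    private
      p∣sum : ∀ i {j} → j < n → p i ∣ (n ∸ j) + j
      p∣sum i j<n = subst (p i ∣_) (sym (ℕ.m∸n+n≡m (ℕ.<⇒≤ j<n))) (p∣prodPrimes p i)

      p∤complement : ∀ i {j} → j < n → ¬ (p i ∣ j) → ¬ (p i ∣ n ∸ j)
      p∤complement i {j} j<n p∤j p∣ = p∤j (∣m+n∣m⇒∣n (p∣sum i j<n) p∣)

      gcd-negate : ∀ {j} → j < n → gcd (n ∸ j) n ≡ gcd j n
      gcd-negate {j} j<n = gcd-complement {n ∸ j} {j} (ℕ.m∸n+n≡m (ℕ.<⇒≤ j<n))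

    -- If pᵢ ≡ 3, take j in the class of n / pᵢ with symbol -ε. Then -j has symbol ε and is a zero,
    -- whereas j is not.
    symmetric⇒1mod4 : ∀ {ch} → ValidChoice n ch →
      (∀ {j} → 0 < j → j < n → InZeroSet ch (n ∸ j) → InZeroSet ch j) → ∀ i → p i % 4 ≢ 3
    symmetric⇒1mod4 {ch} valid symmetric i p%4≡3 = contradiction
      (probe i (not ε)) λ (j , j>0 , j<n , gcd≡ , p∤j , leg) →
        sign≢ (trans (sym leg) (to (inZeroSet-cofactor {ch} valid i gcd≡) (symmetric j>0 j<n
          (from (inZeroSet-cofactor {ch} valid i (trans (gcd-negate j<n) gcd≡))
            (trans (legendre-neg-3mod4 (p i) (primes i) p%4≡3 (p∤complement i j<n p∤j) (p∣sum i j<n))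
              (trans (cong (ℤ.-_) leg) neg-sign))))))
      where
      open Equivalence
      ε = proj₂ (ch (cofactor p i))
      neg-sign : ∀ {ε} → ℤ.- sign (not ε) ≡ sign ε
      neg-sign {true}  = refl
      neg-sign {false} = refl
      sign≢ : ∀ {ε} → sign (not ε) ≢ sign ε
      sign≢ {true}  ()
      sign≢ {false} ()

    -- If pᵢ ≡ 1, an element of the class of n / pᵢ with symbol ε is a zero together with its
    -- negative.
    antisymmetric⇒3mod4 : ∀ {ch} → ValidChoice n ch →
      (∀ {j} → 0 < j → j < n → InZeroSet ch j → ¬ InZeroSet ch (n ∸ j)) → ∀ i → p i % 4 ≢ 1
    antisymmetric⇒3mod4 {ch} valid antisymmetric i p%4≡1 =
      let j , j>0 , j<n , gcd≡ , p∤j , leg = probe i (proj₂ (ch (cofactor p i))) in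
      antisymmetric j>0 j<n
        (from (inZeroSet-cofactor {ch} valid i gcd≡) leg)
        (from (inZeroSet-cofactor {ch} valid i (trans (gcd-negate j<n) gcd≡))
          (trans (legendre-neg-1mod4 (p i) (primes i) p%4≡1 (p∤complement i j<n p∤j) (p∣sum i j<n)) leg))
      where open Equivalence

    private
      missing : ∀ d → Dec (∃ λ i → ¬ (p i ∣ d))
      missing d = any? (λ i → ¬? (p i ∣? d))

      primeOf : ∀ {d} → Dec (∃ λ i → ¬ (p i ∣ d)) → ℕ × Bool
      primeOf (yes (i , _)) = p i , true
      -- A default for arguments divisible by every pᵢ; a proper divisor of n always misses some
      -- prime and falls under the other clause.
      primeOf (no _)        = 1 , true

    primeChoice : Choice
    primeChoice d = primeOf (missing d)

    primeChoice-prime : ∀ {d} → d ∣ n → d < n → ∃ λ i → ¬ (p i ∣ d) × primeChoice d ≡ (p i , true)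
    primeChoice-prime {d} d∣n d<n with missing d
    ... | yes (i , p∤d) = i , p∤d , refl
    ... | no none = contradiction (λ i → decidable-stable (p i ∣? d) (λ p∤d → none (i , p∤d))) (proper⇒¬all d∣n d<n)

    primeChoice-valid : ValidChoice n primeChoice
    primeChoice-valid d d∣n d<n with primeChoice-prime d∣n d<n
    ... | i , p∤d , eq = subst (λ o → proj₁ o * d ∣ n × 1 < proj₁ o) (sym eq) (missing*∣ d∣n i p∤d , prime>1 (primes i))

    private
      -- The prime depends on gcd(j, n) only, so the same i describes membership of j and of -j by
      -- Legendre symbols.
      primeChoice-zeros : ∀ {j} → 0 < j → j < n → ∃ λ i → ¬ (p i ∣ j) ×
        (∀ {j′} → gcd j′ n ≡ gcd j n → InZeroSet primeChoice j′ ⇔ (legendre j′ (p i) ≡ + 1))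
      primeChoice-zeros {j} j>0 j<n with gcd-proper j>0 j<n
      ... | d∣n , d<n with primeChoice-prime d∣n d<n
      ...   | i , p∤d , eq = i , (λ p∣j → p∤d (gcd-greatest p∣j (p∣prodPrimes p i))) , λ {j′} gcd≡ → mk⇔
              (λ m → trans (sym (jacobi-prime j′ i)) (subst (λ o → jacobi p j′ (proj₁ o) ≡ sign (proj₂ o)) eq (to (inZeroSet-at gcd≡) m)))
              (λ e → from (inZeroSet-at gcd≡) (subst (λ o → jacobi p j′ (proj₁ o) ≡ sign (proj₂ o)) (sym eq) (trans (jacobi-prime j′ i) e)))
        where open Equivalence

    1mod4⇒symmetric : (∀ i → p i % 4 ≡ 1) →
      ∀ {j} → 0 < j → j < n → InZeroSet primeChoice (n ∸ j) → InZeroSet primeChoice j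
    1mod4⇒symmetric p%4≡1 j>0 j<n m with primeChoice-zeros j>0 j<n
    ... | i , p∤j , zeros = from (zeros refl) (trans
          (sym (legendre-neg-1mod4 (p i) (primes i) (p%4≡1 i) (p∤complement i j<n p∤j) (p∣sum i j<n)))
          (to (zeros (gcd-negate j<n)) m))
      where open Equivalence

    3mod4⇒antisymmetric : (∀ i → p i % 4 ≡ 3) →
      ∀ {j} → 0 < j → j < n → InZeroSet primeChoice j → ¬ InZeroSet primeChoice (n ∸ j)
    3mod4⇒antisymmetric p%4≡3 j>0 j<n m m′ with primeChoice-zeros j>0 j<n
    ... | i , p∤j , zeros = contradiction (trans (sym (to (zeros (gcd-negate j<n)) m′)) (trans
          (legendre-neg-3mod4 (p i) (primes i) (p%4≡3 i) (p∤complement i j<n p∤j) (p∣sum i j<n))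
          (cong (ℤ.-_) (to (zeros refl) m)))) λ ()
      where open Equivalence

-- From zero sets to codes, and the final count.

open Divisors
open Counting
open FiniteFields
open CodeCriteria
open Spectra
open ZeroSets
open import Data.Nat as ℕ using (ℕ; zero; suc; _≤_; _<_; z≤n; s≤s; _%_; _*_; _∸_; _^_)
import Data.Nat.Properties as ℕ
open import Data.Nat.Divisibility using (_∣_; divides; m*n∣⇒m∣)
open import Data.Nat.GCD using (gcd)
open import Data.Nat.Primality using (Prime)
import Data.Integer as ℤ
open import Data.Bool using (Bool; true; false; T)
open import Data.Fin using (Fin)
open import Data.Fin.Subset using (Subset; ∣_∣)
open import Data.List using (List; []; _∷_; upTo; drop; filterᵇ)
open import Data.List.Membership.Propositional using (_∈_)
open import Data.List.Membership.Propositional.Properties using (∈-applyUpTo⁺; ∈-applyUpTo⁻; ∈-filter⁺; ∈-filter⁻)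
open import Data.List.Relation.Unary.Any using (here; there)
open import Data.Product using (Σ; _×_; _,_; ∃; proj₁; proj₂)
open import Function.Base using (_∘_; id)
open import Function.Bundles using (_⇔_; mk⇔; Equivalence)
open import Relation.Nullary using (¬_; yes; contradiction; does)
open import Relation.Nullary.Decidable using (dec-true; T?)
open import Relation.Binary.PropositionalEquality using (_≡_; _≢_; refl; sym; trans; cong; cong₂; subst)

-- Both necessity proofs refute one residue of pᵢ; oddness leaves only the other.
odd-mod4 : ∀ m → m % 2 ≡ 1 → (m % 4 ≢ 3 → m % 4 ≡ 1) × (m % 4 ≢ 1 → m % 4 ≡ 3)
odd-mod4 m odd = cases (m % 4) (mod<n {4} (s≤s z≤n) m)
  (trans (mod-mod {2} {4} (s≤s z≤n) (s≤s z≤n) (divides 2 refl) m) odd)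
  where
  cases : ∀ r → r < 4 → r % 2 ≡ 1 → (r ≢ 3 → r ≡ 1) × (r ≢ 1 → r ≡ 3)
  cases 1 _ _ = (λ _ → refl) , λ r≢1 → contradiction refl r≢1
  cases 3 _ _ = (λ r≢3 → contradiction refl r≢3) , λ _ → refl
  cases 0 _ ()
  cases 2 _ ()
  cases (suc (suc (suc (suc r)))) (s≤s (s≤s (s≤s (s≤s ())))) _

∈-range⁺ : ∀ {n j} → 0 < j → j < n → j ∈ drop 1 (upTo n)
∈-range⁺ {suc n} {suc j} _ (s≤s j<n) = ∈-applyUpTo⁺ suc j<n

∈-range⁻ : ∀ {n j} → j ∈ drop 1 (upTo n) → 0 < j × j < n
∈-range⁻ {suc n} j∈ with ∈-applyUpTo⁻ suc j∈
... | i , i<n , refl = s≤s z≤n , s≤s i<n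

filterᵇ-cong : ∀ {f h : ℕ → Bool} xs → (∀ {x} → x ∈ xs → f x ≡ h x) → filterᵇ f xs ≡ filterᵇ h xs
filterᵇ-cong []       eq = refl
filterᵇ-cong {f} {h} (x ∷ xs) eq with f x | h x | eq (here refl)
... | true  | _ | refl = cong (x ∷_) (filterᵇ-cong xs (eq ∘ there))
... | false | _ | refl = filterᵇ-cong xs (eq ∘ there)

module OfLength {g : ℕ} (p : Fin g → ℕ) (distinct : Distinct p) (primes : ∀ i → Prime (p i))
  (odd : ∀ i → p i % 2 ≡ 1) where

  open ZeroSet p distinct primes odd

  private n = prodPrimes p

  inZeroSet-true : ∀ {ch j} → (inZeroSet p ch j ≡ true) ⇔ InZeroSet ch j
  inZeroSet-true {ch} {j} = mk⇔ to′ (λ m → dec-true (_ ℤ.≟ _) (InZeroSet.symbol m))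
    where
    to′ : inZeroSet p ch j ≡ true → InZeroSet ch j
    to′ eq with jacobi p j (proj₁ (ch (gcd j n))) ℤ.≟ sign (proj₂ (ch (gcd j n)))
    ... | yes s≡ = inZeroSet✓ s≡

  ∈zeroSet : ∀ {ch j} → j ∈ zeroSet p ch ⇔ (0 < j × j < n × InZeroSet ch j)
  ∈zeroSet {ch} {j} = mk⇔
    (λ j∈ → let j∈range , t = ∈-filter⁻ (T? ∘ inZeroSet p ch) j∈
                j>0 , j<n = ∈-range⁻ {n} j∈range in
            j>0 , j<n , to inZeroSet-true (T⇒true t))
    (λ (j>0 , j<n , m) → ∈-filter⁺ (T? ∘ inZeroSet p ch) (∈-range⁺ j>0 j<n)
            (subst T (sym (from (inZeroSet-true {ch}) m)) _))
    where
    open Equivalence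
    T⇒true : ∀ {b} → T b → b ≡ true
    T⇒true {true} _ = refl

  zeroSet-cong : ∀ {ch ch′} → (∀ {d} → d ∣ n → d < n → ch d ≡ ch′ d) → zeroSet p ch ≡ zeroSet p ch′
  zeroSet-cong eq = filterᵇ-cong (drop 1 (upTo n)) λ {j} j∈ →
    let j>0 , j<n = ∈-range⁻ {n} j∈ ; d∣n , d<n = gcd-proper j>0 j<n in
    cong (λ o → does (jacobi p j (proj₁ o) ℤ.≟ sign (proj₂ o))) (eq d∣n d<n)

  module QRCodes {q : ℕ} (q-power : IsPrimePower q) (N′ : ℕ) (K : FiniteField) (size≡ : FiniteField.size K ≡ q ^ N′)
    (θ : FiniteField.Carrier K) (prim : QR.IsPrimitiveRoot K n θ) where

    open FiniteField K using () renaming (refl to ≈-refl; sym to ≈-sym; trans to ≈-trans)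
    open QR K
    open FieldTheory K using (eval-cong; rootProduct; rootProduct-root; rootProduct-root⁻)

    open Criteria K n>0 θ prim q-power N′ size≡
      using (Zero; LCD⇔; selfOrthogonal⇔; sameCode-zeros)
    open CyclicCodes K n>0
    open PrimitiveRoot θ prim using (pow-injective)

    gen : Choice → Poly
    gen = generator p θ

    -- Below n the powers of θ are distinct, so θʲ can be a root only through its own factor. The
    -- exponents in `zeroSet` start at 1, which excludes j = 0.
    zero⇔ : ∀ {ch j} → j < n → Zero (gen ch) j ⇔ (0 < j × InZeroSet ch j)
    zero⇔ {ch} {j} j<n = mk⇔ to′ (λ (j>0 , m) →
      rootProduct-root θ (pow θ j) (zeroSet p ch) (from ∈zeroSet (j>0 , j<n , m)) ≈-refl)
      where
      open Equivalence
      to′ : Zero (gen ch) j → 0 < j × InZeroSet ch j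
      to′ root with rootProduct-root⁻ θ (pow θ j) (zeroSet p ch) root
      ... | t , t∈ , θʲ≈θᵗ with to ∈zeroSet t∈
      ...   | t>0 , t<n , m = subst (λ j → 0 < j × InZeroSet ch j) (sym (pow-injective j<n t<n θʲ≈θᵗ)) (t>0 , m)

    -- Covers -0, written `n ∸ 0`: θⁿ is θ⁰, and 0 is not a zero exponent.
    ¬zero-n : ∀ {ch} → ¬ Zero (gen ch) n
    ¬zero-n {ch} root = contradiction (proj₁ (to (zero⇔ {ch} n>0) (≈-trans (eval-cong (≈-sym (proj₁ prim)) (gen ch)) root))) λ ()
      where open Equivalence

    private
      negate< : ∀ {j} → 0 < j → j < n → n ∸ j < n
      negate< j>0 j<n = ℕ.∸-monoʳ-< {n} j>0 (ℕ.<⇒≤ j<n)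

      negate>0 : ∀ {j} → j < n → 0 < n ∸ j
      negate>0 = ℕ.m<n⇒0<n∸m

    -- Restricted to 0 < j < n, a range that `n ∸ j` preserves; the exponent 0 is never a zero.
    Symmetric Antisymmetric : Choice → Set
    Symmetric ch     = ∀ {j} → 0 < j → j < n → InZeroSet ch (n ∸ j) → InZeroSet ch j
    Antisymmetric ch = ∀ {j} → 0 < j → j < n → InZeroSet ch j → ¬ InZeroSet ch (n ∸ j)

    LCD⇒symmetric : ∀ {ch} → IsLCD n q (gen ch) → Symmetric ch
    LCD⇒symmetric {ch} lcd j>0 j<n m = proj₂ (to (zero⇔ {ch} j<n) (to (LCD⇔ (gen ch)) lcd j<n
      (from (zero⇔ {ch} (negate< j>0 j<n)) (negate>0 j<n , m))))
      where open Equivalence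

    symmetric⇒LCD : ∀ {ch} → Symmetric ch → IsLCD n q (gen ch)
    symmetric⇒LCD {ch} symmetric = from (LCD⇔ (gen ch)) zeros
      where
      open Equivalence
      zeros : ∀ {j} → j < n → Zero (gen ch) (n ∸ j) → Zero (gen ch) j
      zeros {zero}  _   root = contradiction root (¬zero-n {ch})
      zeros {suc j} j<n root = from (zero⇔ {ch} j<n)
        (s≤s z≤n , symmetric (s≤s z≤n) j<n (proj₂ (to (zero⇔ {ch} (negate< (s≤s z≤n) j<n)) root)))

    selfOrthogonal⇒antisymmetric : ∀ {ch} → IsSelfOrthogonal n q (gen ch) → Antisymmetric ch
    selfOrthogonal⇒antisymmetric {ch} so j>0 j<n m m′ =
      to (selfOrthogonal⇔ (gen ch)) so j<n (from (zero⇔ {ch} j<n) (j>0 , m))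
        (from (zero⇔ {ch} (negate< j>0 j<n)) (negate>0 j<n , m′))
      where open Equivalence

    antisymmetric⇒selfOrthogonal : ∀ {ch} → Antisymmetric ch → IsSelfOrthogonal n q (gen ch)
    antisymmetric⇒selfOrthogonal {ch} antisymmetric = from (selfOrthogonal⇔ (gen ch)) λ j<n root root′ →
      let j>0 , m = to (zero⇔ {ch} j<n) root in
      antisymmetric j>0 j<n m (proj₂ (to (zero⇔ {ch} (negate< j>0 j<n)) root′))
      where open Equivalence

    sameCode⇒sameZeros : ∀ {ch ch′} → SameCode n q (gen ch) (gen ch′) →
                         ∀ {j} → 0 < j → j < n → InZeroSet ch j ⇔ InZeroSet ch′ j
    sameCode⇒sameZeros {ch} {ch′} same {j} j>0 j<n = mk⇔
      (λ m → proj₂ (to (zero⇔ {ch′} j<n) (sameCode-zeros {gen ch′} {gen ch} (λ c → proj₂ (same c) , proj₁ (same c)) j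
        (from (zero⇔ {ch} j<n) (j>0 , m)))))
      (λ m → proj₂ (to (zero⇔ {ch} j<n) (sameCode-zeros {gen ch} {gen ch′} same j
        (from (zero⇔ {ch′} j<n) (j>0 , m)))))
      where open Equivalence

    choiceOf : (Subset g → Bool × Subset g) → Choice
    choiceOf φ d = prodSubset p (proj₂ (φ (support d))) , proj₁ (φ (support d))

    choiceOf-valid : ∀ {φ} → (∀ D → Option D (φ D)) → ValidChoice n (choiceOf φ)
    choiceOf-valid {φ} options d d∣n d<n =
      subst (λ d → prodSubset p E * d ∣ n) (prodSubset-support d∣n) (prodSubset-disjoint p D E (proj₁ option)) ,
      ℕ.≤∧≢⇒< (divisor>0 (prodSubset∣ p E)) (proj₂ option ∘ prodSubset≡1⇒⊥ ∘ sym)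
      where
      D = support d
      E = proj₂ (φ D)
      option = options D (support-proper d∣n d<n)

    -- Equal codes have equal zeros, which determine the choices at d = `prodSubset p D`; applying
    -- `support` recovers the subsets from d and from Q_d.
    choiceOf-injective : ∀ {φ ψ} → (∀ D → Option D (φ D)) → (∀ D → Option D (ψ D)) →
      SameCode n q (gen (choiceOf φ)) (gen (choiceOf ψ)) → ∀ D → ∣ D ∣ ≢ g → φ D ≡ ψ D
    choiceOf-injective {φ} {ψ} φ-options ψ-options same D proper = cong₂ _,_ (cong proj₂ eq)
      (trans (sym (support-prodSubset _)) (trans (cong (support ∘ proj₁) eq) (support-prodSubset _)))
      where
      eq : (prodSubset p (proj₂ (φ D)) , proj₁ (φ D)) ≡ (prodSubset p (proj₂ (ψ D)) , proj₁ (ψ D))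
      eq = subst (λ D → (prodSubset p (proj₂ (φ D)) , proj₁ (φ D)) ≡ (prodSubset p (proj₂ (ψ D)) , proj₁ (ψ D)))
        (support-prodSubset D)
        (choice-determined {choiceOf φ} {choiceOf ψ} (choiceOf-valid {φ} φ-options) (choiceOf-valid {ψ} ψ-options)
          (sameCode⇒sameZeros {choiceOf φ} {choiceOf ψ} same) (prodSubset∣ p D) (prodSubset<n D proper))

    -- φ is read off from `ch`. Any ψ agreeing with it on proper subsets gives a choice equal to
    -- `ch` at the proper divisors, hence the same list `zeroSet` and literally the same generator.
    choiceOf-surjective : ∀ {ch} → ValidChoice n ch → ∃ λ φ → (∀ D → Option D (φ D)) ×
      (∀ {ψ} → (∀ D → Option D (ψ D)) → (∀ D → ∣ D ∣ ≢ g → φ D ≡ ψ D) → SameCode n q (gen ch) (gen (choiceOf ψ)))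
    choiceOf-surjective {ch} valid = φ , option , λ {ψ} _ φ≡ψ →
      subst (λ ts → SameCode n q (gen ch) (rootProduct θ ts)) (zeroSet-cong {ch} {choiceOf ψ} (agree φ≡ψ)) (λ c → id , id)
      where
      φ : Subset g → Bool × Subset g
      φ D = proj₂ (ch (prodSubset p D)) , support (proj₁ (ch (prodSubset p D)))
      option : ∀ D → Option D (φ D)
      option D proper = (λ i i∈D → ∉support λ p∣Q → coprime-parts Qd∣n i p∣Q (∈⇒∣prodSubset p D i i∈D)) ,
        λ empty → ℕ.<⇒≢ 1<Q (trans (sym (prodSubset-⊥ p)) (trans (cong (prodSubset p) (sym empty))
          (prodSubset-support (m*n∣⇒m∣ Q (prodSubset p D) Qd∣n))))
        where
        Q = proj₁ (ch (prodSubset p D))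
        Qd∣n = proj₁ (valid (prodSubset p D) (prodSubset∣ p D) (prodSubset<n D proper))
        1<Q = proj₂ (valid (prodSubset p D) (prodSubset∣ p D) (prodSubset<n D proper))
      agree : ∀ {ψ} → (∀ D → ∣ D ∣ ≢ g → φ D ≡ ψ D) → ∀ {d} → d ∣ n → d < n → ch d ≡ choiceOf ψ d
      agree {ψ} φ≡ψ {d} d∣n d<n = trans (cong₂ _,_ (sym (prodSubset-support (m*n∣⇒m∣ Q d (proj₁ (valid d d∣n d<n))))) refl)
        (cong (λ o → prodSubset p (proj₂ o) , proj₁ o) (trans
          (cong (λ d → proj₂ (ch d) , support (proj₁ (ch d))) (sym (prodSubset-support d∣n)))
          (φ≡ψ (support d) (support-proper d∣n d<n))))
        where Q = proj₁ (ch d)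

    count-codes : Count (ValidChoice n) (λ ch ch′ → SameCode n q (gen ch) (gen ch′)) (qrCount g)
    count-codes = subst (Count (ValidChoice n) _) (∏Subsets≡qrCount g)
      (count-map choiceOf (λ {φ} → choiceOf-valid {φ}) choiceOf-injective (λ {ch} → choiceOf-surjective {ch}) (count-Π count-options))


theorem2p2 :
  (g : ℕ) → 1 ≤ g →
  (p : Fin g → ℕ) → (∀ i j → p i ≡ p j → i ≡ j) →
  (∀ i → Prime (p i)) → (∀ i → p i % 2 ≡ 1) →
  (q : ℕ) → IsPrimePower q → gcd (prodPrimes p) q ≡ 1 →
  (N' : ℕ) → IsMultOrder (prodPrimes p) q N' →
  (K : FiniteField) → FiniteField.size K ≡ q ^ N' →
  (θ : FiniteField.Carrier K) → QR.IsPrimitiveRoot K (prodPrimes p) θ →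
  -- (1) number of QR codes of length n
  (Σ (Fin (qrCount g) → Choice) λ f →
      (∀ i → ValidChoice (prodPrimes p) (f i))
    × (∀ i j → QR.SameCode K (prodPrimes p) q
                 (QR.generator K p θ (f i)) (QR.generator K p θ (f j)) → i ≡ j)
    × (∀ ch → ValidChoice (prodPrimes p) ch →
         Σ (Fin (qrCount g)) λ i →
           QR.SameCode K (prodPrimes p) q
             (QR.generator K p θ ch) (QR.generator K p θ (f i))))
  -- (2) LCD QR codes
  × ((Σ Choice λ ch → ValidChoice (prodPrimes p) ch
        × QR.IsLCD K (prodPrimes p) q (QR.generator K p θ ch))
     ⇔ (∀ i → p i % 4 ≡ 1))
  -- (3) self-orthogonal QR codes
  × ((Σ Choice λ ch → ValidChoice (prodPrimes p) ch
        × QR.IsSelfOrthogonal K (prodPrimes p) q (QR.generator K p θ ch))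
     ⇔ (∀ i → p i % 4 ≡ 3))
theorem2p2 g _ p distinct primes odd q q-power _ N′ _ K size≡ θ prim =
  (decode codes , valid codes , injective codes , surjective codes) ,
  mk⇔ (λ (ch , ch-valid , lcd) i → proj₁ (odd-mod4 (p i) (odd i))
        (symmetric⇒1mod4 {ch} ch-valid (LCD⇒symmetric {ch} lcd) i))
      (λ p%4≡1 → primeChoice , primeChoice-valid , symmetric⇒LCD {primeChoice} (1mod4⇒symmetric p%4≡1)) ,
  mk⇔ (λ (ch , ch-valid , so) i → proj₂ (odd-mod4 (p i) (odd i))
        (antisymmetric⇒3mod4 {ch} ch-valid (selfOrthogonal⇒antisymmetric {ch} so) i))
      (λ p%4≡3 → primeChoice , primeChoice-valid ,
        antisymmetric⇒selfOrthogonal {primeChoice} (3mod4⇒antisymmetric p%4≡3))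
  where
  open Count
  open ZeroSet p distinct primes odd
  open OfLength.QRCodes p distinct primes odd q-power N′ K size≡ θ prim
  codes = count-codes
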